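{- Let $\tau\subset\mathbb{Z}^4_{\ge 0}$ be a B-facet. Then $\tau$ is of (at least) one of the following four types: (1) a $B_1$-facet: there is an index $i\in\{1,2,3,4\}$ such that exactly one point of $\tau$ has nonzero $i$-th coordinate, and that coordinate equals $1$; (2) a $B_2$-facet: there are distinct indices $i,j$ such that for every point $x\in\tau$ we have $(x_i,x_j)\in\{(0,0),(1,0),(0,1)\}$; (3) a flat border: there are distinct indices $i,j$ and a point $C\in\tau$ with $C_i=C_j=1$ such that $\tau$ contains at least two distinct points $A,B$ with $A_i=A_j=B_i=B_j=0$, and every point of $\tau$ other than $C$ lies in $\{x_i=0\}\cup\{x_j=0\}$; (4) the standard cross-polytope: $\tau=\{(1,1,0,0),(1,0,1,0),(1,0,0,1),(0,1,1,0),(0,1,0,1),(0,0,1,1)\}$.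
   Context: Conventions: a polytope is a finite subset of $\mathbb{Z}^n$; its dimension is the dimension of its affine span. A $k$-simplex is a set of $k+1$ affinely independent points. A $k$-simplex $S\subset\mathbb{Z}^n_{\ge0}$ is a B-simplex if there is a coordinate index $i$ such that exactly $k$ of its vertices lie in the hyperplane $\{x_i=0\}$ and the remaining vertex has $i$-th coordinate equal to $1$ (i.e. it is a pyramid of height $1$ with base on a coordinate hyperplane; for $k=0$ this means the point has some coordinate equal to $1$). A B-facet in $\mathbb{Z}^n_{\ge0}$ is a finite set $\tau\subset\mathbb{Z}^n_{\ge 0}$ whose affine span is a hyperplane $\{x:\langle a,x\rangle=b\}$ with all $a_j>0$ (positive normal covector), such that every $(n-1)$-simplex with vertices in $\tau$ is a B-simplex. -}

module Defs where

open import Data.Fin.Base using (Fin)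
open import Data.Integer.Base using (+_)
open import Data.List.Base using (List; []; _∷_; length)
import Data.List.Base as List
open import Data.List.Membership.Propositional using (_∈_)
open import Data.List.Relation.Binary.BagAndSetEquality using (_∼[_]_; set)
open import Data.Nat.Base using (ℕ; suc)
open import Data.Product.Base using (∃-syntax; _×_; _,_)
open import Data.Rational.Base using (ℚ; 0ℚ; 1ℚ; _*_; _<_; _/_)
open import Data.Rational.Properties using (+-0-commutativeMonoid)
open import Algebra.Properties.CommutativeMonoid.Sum +-0-commutativeMonoid using (sum)
open import Data.Sum.Base using (_⊎_)
open import Data.Vec.Base using (Vec; []; _∷_; lookup)
open import Function.Bundles using (_⇔_)
open import Relation.Binary.PropositionalEquality.Core using (_≡_; _≢_)

-- ℤ≥0 is rendered as ℕ, so this is ℤⁿ≥0.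
Point : ℕ → Set
Point n = Vec ℕ n

-- A finite subset of ℤⁿ≥0, represented by a list enumerating it.  Order and
-- repetitions carry no meaning: every notion below is invariant under set
-- equality of lists.
Polytope : ℕ → Set
Polytope n = List (Point n)

-- All points are integral, so linear algebra over ℚ gives the same affine
-- independence and the same hyperplanes as linear algebra over ℝ.
coord : ∀ {n} → Point n → Fin n → ℚ
coord x i = + lookup x i / 1

AffinelyIndependent : ∀ {m n} → (Fin m → Point n) → Set
AffinelyIndependent {m} p =
  (c : Fin m → ℚ) →
  sum c ≡ 0ℚ →
  (∀ i → sum (λ j → c j * coord (p j) i) ≡ 0ℚ) →
  ∀ j → c j ≡ 0ℚ

InAffineSpan : ∀ {n} → Polytope n → (Fin n → ℚ) → Set
InAffineSpan τ x =
  ∃[ c ] (sum c ≡ 1ℚ ×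
          (∀ i → sum {length τ} (λ j → c j * coord (List.lookup τ j) i) ≡ x i))

-- A k-simplex in ℤⁿ≥0.  The vertices are listed in some order; affine
-- independence makes them pairwise distinct.
record Simplex (k n : ℕ) : Set where
  field
    vertex      : Fin (suc k) → Point n
    independent : AffinelyIndependent vertex

open Simplex public

IsBSimplex : ∀ {k n} → Simplex k n → Set
IsBSimplex S =
  ∃[ i ] ∃[ apex ] (lookup (vertex S apex) i ≡ 1 ×
                    (∀ m → m ≢ apex → lookup (vertex S m) i ≡ 0))

-- The ambient dimension is suc d, so that (dimension − 1)-simplices are
-- d-simplices.
record IsBFacet {d} (τ : Polytope (suc d)) : Set where
  field
    normal          : Fin (suc d) → ℚ
    offset          : ℚ
    normal-positive : ∀ j → 0ℚ < normal j
    span-hyperplane : ∀ x → InAffineSpan τ x ⇔ sum (λ j → normal j * x j) ≡ offset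
    simplices-B     : (S : Simplex d (suc d)) → (∀ m → vertex S m ∈ τ) → IsBSimplex S

IsB₁ : ∀ {n} → Polytope n → Set
IsB₁ τ =
  ∃[ i ] ∃[ x ] (x ∈ τ × lookup x i ≡ 1 ×
                 (∀ y → y ∈ τ → lookup y i ≢ 0 → y ≡ x))

IsB₂ : ∀ {n} → Polytope n → Set
IsB₂ τ =
  ∃[ i ] ∃[ j ] (i ≢ j ×
    (∀ x → x ∈ τ →
      (lookup x i , lookup x j) ∈ (0 , 0) ∷ (1 , 0) ∷ (0 , 1) ∷ []))

IsFlatBorder : ∀ {n} → Polytope n → Set
IsFlatBorder τ =
  ∃[ i ] ∃[ j ] ∃[ C ] (i ≢ j ×
    C ∈ τ × lookup C i ≡ 1 × lookup C j ≡ 1 ×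
    (∃[ A ] ∃[ B ] (A ≢ B ×
      A ∈ τ × lookup A i ≡ 0 × lookup A j ≡ 0 ×
      B ∈ τ × lookup B i ≡ 0 × lookup B j ≡ 0)) ×
    (∀ x → x ∈ τ → x ≢ C → lookup x i ≡ 0 ⊎ lookup x j ≡ 0))

crossPolytope : Polytope 4
crossPolytope =
  (1 ∷ 1 ∷ 0 ∷ 0 ∷ []) ∷
  (1 ∷ 0 ∷ 1 ∷ 0 ∷ []) ∷
  (1 ∷ 0 ∷ 0 ∷ 1 ∷ []) ∷
  (0 ∷ 1 ∷ 1 ∷ 0 ∷ []) ∷
  (0 ∷ 1 ∷ 0 ∷ 1 ∷ []) ∷
  (0 ∷ 0 ∷ 1 ∷ 1 ∷ []) ∷ []

IsCrossPolytope : Polytope 4 → Set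
IsCrossPolytope τ = τ ∼[ set ] crossPolytope

{-# OPTIONS --safe #-}
module Submission where

-- Three consequences of the hypothesis suffice: τ is an antichain for the coordinatewise order, τ spans
-- its hyperplane, and any four points whose projection to three coordinates has nonzero volume have a
-- coordinate in which they form a unit vector.
--
-- Suppose first that two points e ≠ e′ of τ lie in a plane x_k = x_l = 0.  Four vertices e, e′, r, s are
-- affinely independent as soon as the (k , l)-projections of r and s are linearly independent.  If all such
-- pairs of projections form a unit vector in coordinate k or l, then the projection of τ is so restricted
-- that τ is a B₁-facet, a B₂-facet or a flat border.  Otherwise a pair h, h′ violates this, which forces
-- e = (1, x, 0, 0), e′ = (0, y, 0, 0) and h_i = h′_i = 0, up to order.  If e is the only point with
-- x_i ≠ 0, then τ is a B₁-facet; comparing any other such point f to h and h′ shows f = (1, *, *, 0) and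
-- h_l = h′_l = 1, up to exchanging k and l, and τ is a B₂-facet for i and l.
--
-- Suppose now that every coordinate plane contains at most one point of τ.  Some x_l = 0 contains a
-- triangle t₁ t₂ t₃, and all other values of x_l are 1.  If there are two points p ≠ p′ with x_l = 1, then
-- p and p′ vanish in a coordinate k in which one vertex of the triangle is 0 and the others are 1, and so all
-- nonzero values of x_k are 1 too.  Either no point has x_k = x_l = 1, and τ is a B₂-facet, or such a point
-- determines all coordinates, and τ is the cross-polytope.

open import Algebra.Bundles using (CommutativeRing)
open import Data.Bool.Base using (if_then_else_; _∨_)
open import Data.Empty using (⊥; ⊥-elim)
open import Data.Fin.Base using (Fin; zero; suc)
import Data.Fin.Properties as FinP
open import Data.Integer.Base as ℤ using (ℤ; +_; 0ℤ)
import Data.Integer.Properties as ℤP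
import Data.Integer.Solver as ℤSolver
open import Data.List.Base as List using ([]; _∷_; length)
open import Data.List.Membership.DecPropositional using () renaming (_∈?_ to member?)
open import Data.List.Membership.Propositional using (_∈_; find; lose)
open import Data.List.Membership.Propositional.Properties using (∈-lookup)
open import Data.List.Relation.Unary.Any using (Any; any?; index; here; there)
open import Data.List.Relation.Unary.Any.Properties using (lookup-index)
open import Data.Nat.Base as ℕ using (ℕ; zero; suc; z≤n; s≤s)
import Data.Nat.Properties as ℕP
open import Algebra.Properties.CommutativeSemigroup ℕP.*-commutativeSemigroup
  using (x∙yz≈y∙xz; x∙yz≈yx∙z)
open import Data.Product.Base using (∃-syntax; _×_; _,_; proj₁; proj₂)
open import Data.Rational.Base as ℚ using (ℚ; 0ℚ; 1ℚ; _/_; toℚᵘ)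
import Data.Rational.Properties as ℚP
import Data.Rational.Solver as ℚSolver
open import Algebra.Properties.CommutativeMonoid.Sum ℚP.+-0-commutativeMonoid
  using (sum; sum-cong-≗; ∑-distrib-+)
open import Algebra.Properties.Group ℚP.+-0-group using (∙-cancelˡ)
open import Algebra.Properties.Semiring.Sum (CommutativeRing.semiring ℚP.+-*-commutativeRing)
  using (*-distribˡ-sum; *-distribʳ-sum)
open import Data.Rational.Unnormalised.Base as ℚᵘ using (mkℚᵘ; *≡*)
import Data.Rational.Unnormalised.Properties as ℚᵘP
open import Data.Sum.Base as Sum using (_⊎_; inj₁; inj₂; [_,_])
open import Data.Vec.Base using (Vec; []; _∷_; lookup; tabulate)
open import Data.Vec.Properties using (≡-dec; tabulate∘lookup; tabulate-cong)
open import Function.Base using (_∘_; id)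
open import Function.Bundles using (Equivalence; mk⇔)
open import Relation.Binary.Definitions using (tri<; tri≈; tri>)
open import Relation.Binary.PropositionalEquality hiding ([_])
open import Relation.Nullary using (¬_; Dec; yes; no; contradiction)
open import Relation.Nullary.Decidable
  using (¬?; decidable-stable; does; from-yes; _⊎-dec_; _×-dec_)
open import Defs

-- Rational linear algebra

-- When `e` and `e′` project to the origin of the (k , l)-plane, the volume of `e e′ r s` is a
-- coordinate difference of `e` and `e′` times the area of the triangle formed by the origin and the
-- projections of `r` and `s`. The difference never vanishes, as dropping one coordinate is
-- injective on an antichain; so planar data decide. Without such edges the leverage is different. A
-- unit vector has three zeros, and two of them at points that already share another zero coordinate
-- would put both points into one coordinate plane. This excludes nearly every position of the 1.
-- The obstacle in the edge case is that the simplex `e f h h′` may be flat, and then the hypothesis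
-- says nothing about it; `f` must be compared with `h` and `h′` separately. Some subcases close
-- only through a different edge, which proves the theorem at once. Hence many lemmas return
-- `Result` as an alternative.

ι : ℤ → ℚ
ι z = z / 1

toℚᵘ-ι : ∀ z → toℚᵘ (ι z) ℚᵘ.≃ mkℚᵘ z 0
toℚᵘ-ι z = ℚP.toℚᵘ-fromℚᵘ (mkℚᵘ z 0)

ι-+ : ∀ a b → ι (a ℤ.+ b) ≡ ι a ℚ.+ ι b
ι-+ a b = ℚP.toℚᵘ-injective (begin
  toℚᵘ (ι (a ℤ.+ b))             ≈⟨ toℚᵘ-ι (a ℤ.+ b) ⟩
  mkℚᵘ (a ℤ.+ b) 0               ≈⟨ *≡*
      (cong (ℤ._* + 1) (sym (cong₂ ℤ._+_ (ℤP.*-identityʳ a) (ℤP.*-identityʳ b)))) ⟩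
  mkℚᵘ a 0 ℚᵘ.+ mkℚᵘ b 0         ≈⟨ ℚᵘP.+-cong (toℚᵘ-ι a) (toℚᵘ-ι b) ⟨
  toℚᵘ (ι a) ℚᵘ.+ toℚᵘ (ι b)     ≈⟨ ℚP.toℚᵘ-homo-+ (ι a) (ι b) ⟨
  toℚᵘ (ι a ℚ.+ ι b)             ∎)
  where open ℚᵘP.≃-Reasoning

ι-* : ∀ a b → ι (a ℤ.* b) ≡ ι a ℚ.* ι b
ι-* a b = ℚP.toℚᵘ-injective (begin
  toℚᵘ (ι (a ℤ.* b))             ≈⟨ toℚᵘ-ι (a ℤ.* b) ⟩
  mkℚᵘ (a ℤ.* b) 0               ≈⟨ *≡* refl ⟩
  mkℚᵘ a 0 ℚᵘ.* mkℚᵘ b 0         ≈⟨ ℚᵘP.*-cong (toℚᵘ-ι a) (toℚᵘ-ι b) ⟨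
  toℚᵘ (ι a) ℚᵘ.* toℚᵘ (ι b)     ≈⟨ ℚP.toℚᵘ-homo-* (ι a) (ι b) ⟨
  toℚᵘ (ι a ℚ.* ι b)             ∎)
  where open ℚᵘP.≃-Reasoning

ι-neg : ∀ a → ι (ℤ.- a) ≡ ℚ.- ι a
ι-neg a = ℚP.toℚᵘ-injective (begin
  toℚᵘ (ι (ℤ.- a))               ≈⟨ toℚᵘ-ι (ℤ.- a) ⟩
  ℚᵘ.- mkℚᵘ a 0                  ≈⟨ ℚᵘP.-‿cong (toℚᵘ-ι a) ⟨
  ℚᵘ.- toℚᵘ (ι a)                ≈⟨ ℚP.toℚᵘ-homo‿- (ι a) ⟨
  toℚᵘ (ℚ.- ι a)                 ∎)
  where open ℚᵘP.≃-Reasoning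

ι-injective : ∀ {a b} → ι a ≡ ι b → a ≡ b
ι-injective {a} {b} eq with ℚᵘP.≃-trans (ℚᵘP.≃-sym (toℚᵘ-ι a))
    (ℚᵘP.≃-trans (ℚᵘP.≃-reflexive (cong toℚᵘ eq)) (toℚᵘ-ι b))
... | *≡* e = trans (sym (ℤP.*-identityʳ a)) (trans e (ℤP.*-identityʳ b))

ι-mono-≤ : ∀ {m n} → m ℕ.≤ n → ι (+ m) ℚ.≤ ι (+ n)
ι-mono-≤ {m} {n} m≤n = ℚP.toℚᵘ-cancel-≤ (ℚᵘP.≤-respˡ-≃ (ℚᵘP.≃-sym (toℚᵘ-ι (+ m)))
  (ℚᵘP.≤-respʳ-≃ (ℚᵘP.≃-sym (toℚᵘ-ι (+ n))) (ℚᵘ.*≤* (ℤP.*-monoʳ-≤-nonNeg (+ 1) (ℤ.+≤+ m≤n)))))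

*-cancelˡ-0 : ∀ p {q} → p ≢ 0ℚ → p ℚ.* q ≡ 0ℚ → q ≡ 0ℚ
*-cancelˡ-0 p {q} p≢0 pq≡0 = begin
  q                        ≡⟨ ℚP.*-identityˡ q ⟨
  1ℚ ℚ.* q                 ≡⟨ cong (ℚ._* q) (ℚP.*-inverseˡ p) ⟨
  (ℚ.1/ p ℚ.* p) ℚ.* q     ≡⟨ ℚP.*-assoc (ℚ.1/ p) p q ⟩
  ℚ.1/ p ℚ.* (p ℚ.* q)     ≡⟨ cong (ℚ.1/ p ℚ.*_) pq≡0 ⟩
  ℚ.1/ p ℚ.* 0ℚ            ≡⟨ ℚP.*-zeroʳ (ℚ.1/ p) ⟩
  0ℚ                       ∎
  where open ≡-Reasoning
        instance _ = ℚ.≢-nonZero p≢0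

*-cancelˡ-pos : ∀ {p q r} → 0ℚ ℚ.< p → p ℚ.* q ≡ p ℚ.* r → q ≡ r
*-cancelˡ-pos {p} 0<p eq = ℚP.≤-antisym (ℚP.*-cancelˡ-≤-pos p (ℚP.≤-reflexive eq))
                                        (ℚP.*-cancelˡ-≤-pos p (ℚP.≤-reflexive (sym eq)))
  where instance _ = ℚ.positive 0<p

δ : ∀ {n} → Fin n → Fin n → ℚ
δ zero    zero    = 1ℚ
δ zero    (suc _) = 0ℚ
δ (suc _) zero    = 0ℚ
δ (suc i) (suc j) = δ i j

δ-≢ : ∀ {n} {i j : Fin n} → i ≢ j → δ i j ≡ 0ℚ
δ-≢ {i = zero}  {zero}  i≢j = contradiction refl i≢j
δ-≢ {i = zero}  {suc _} i≢j = refl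
δ-≢ {i = suc _} {zero}  i≢j = refl
δ-≢ {i = suc i} {suc j} i≢j = δ-≢ (i≢j ∘ cong suc)

δ-refl : ∀ {n} (i : Fin n) → δ i i ≡ 1ℚ
δ-refl zero    = refl
δ-refl (suc i) = δ-refl i

sum-zero : ∀ {n} (f : Fin n → ℚ) → (∀ i → f i ≡ 0ℚ) → sum f ≡ 0ℚ
sum-zero {zero}  f f≡0 = refl
sum-zero {suc n} f f≡0 = cong₂ ℚ._+_ (f≡0 zero) (sum-zero (f ∘ suc) (f≡0 ∘ suc))

sum-δ : ∀ {n} (i : Fin n) (f : Fin n → ℚ) → sum (λ j → δ i j ℚ.* f j) ≡ f i
sum-δ zero f = begin
  1ℚ ℚ.* f zero ℚ.+ sum (λ j → 0ℚ ℚ.* f (suc j)) ≡⟨ cong₂ ℚ._+_ (ℚP.*-identityˡ (f zero))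
      (sum-zero (λ j → 0ℚ ℚ.* f (suc j)) (λ j → ℚP.*-zeroˡ (f (suc j)))) ⟩
  f zero ℚ.+ 0ℚ                                  ≡⟨ ℚP.+-identityʳ (f zero) ⟩
  f zero                                         ∎
  where open ≡-Reasoning
sum-δ (suc i) f = begin
  0ℚ ℚ.* f zero ℚ.+ sum (λ j → δ i j ℚ.* f (suc j)) ≡⟨ cong₂ ℚ._+_ (ℚP.*-zeroˡ (f zero)) (sum-δ i (f ∘ suc)) ⟩
  0ℚ ℚ.+ f (suc i)                                  ≡⟨ ℚP.+-identityˡ _ ⟩
  f (suc i)                                         ∎
  where open ≡-Reasoning

sum-mono-≤ : ∀ {n} (f g : Fin n → ℚ) → (∀ i → f i ℚ.≤ g i) → sum f ℚ.≤ sum g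
sum-mono-≤ {zero}  f g f≤g = ℚP.≤-refl
sum-mono-≤ {suc n} f g f≤g = ℚP.+-mono-≤ (f≤g zero) (sum-mono-≤ (f ∘ suc) (g ∘ suc) (f≤g ∘ suc))

-- One strict term would make the whole sum strict. Once the first terms are equal they cancel, and
-- the tails have the same shape.
sum-mono-≡ : ∀ {n} (f g : Fin n → ℚ) → (∀ i → f i ℚ.≤ g i) → sum f ≡ sum g → ∀ i → f i ≡ g i
sum-mono-≡ {suc n} f g f≤g eq i with f zero ℚP.<? g zero
... | yes f<g = ⊥-elim (ℚP.<-irrefl eq (ℚP.+-mono-<-≤ f<g
                 (sum-mono-≤ (f ∘ suc) (g ∘ suc) (f≤g ∘ suc))))
sum-mono-≡ {suc n} f g f≤g eq i | no f≮g = go i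
  where
  f≡g : f zero ≡ g zero
  f≡g = ℚP.≤-antisym (f≤g zero) (ℚP.≮⇒≥ f≮g)
  go : ∀ i → f i ≡ g i
  go zero    = f≡g
  go (suc i) = sum-mono-≡ (f ∘ suc) (g ∘ suc) (f≤g ∘ suc)
    (∙-cancelˡ (f zero) _ _ (trans eq (cong (ℚ._+ sum (g ∘ suc)) (sym f≡g)))) i

-- Volumes and affine independence

infix 30 _⟨_⟩
_⟨_⟩ : ∀ {n} → Point n → Fin n → ℕ
x ⟨ i ⟩ = lookup x i

det3 : (a b c d e f g h i : ℤ) → ℤ
det3 a b c d e f g h i =
  a ℤ.* (e ℤ.* i ℤ.- f ℤ.* h) ℤ.- b ℤ.* (d ℤ.* i ℤ.- f ℤ.* g) ℤ.+ c ℤ.* (d ℤ.* h ℤ.- e ℤ.* g)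

Δ : Point 4 → Point 4 → Fin 4 → ℤ
Δ x y i = + y ⟨ i ⟩ ℤ.- + x ⟨ i ⟩

-- Six times the signed volume of the tetrahedron xyzw projected to the coordinates i, j, k.
vol : (i j k : Fin 4) (x y z w : Point 4) → ℤ
vol i j k x y z w = det3 (Δ x y i) (Δ x y j) (Δ x y k) (Δ x z i) (Δ x z j) (Δ x z k) (Δ x w i) (Δ x w j)
    (Δ x w k)

module _ where
  open ℚSolver.+-*-Solver

  translate : ∀ c₀ c₁ c₂ c₃ x y z w →
    c₁ ℚ.* (y ℚ.- x) ℚ.+ c₂ ℚ.* (z ℚ.- x) ℚ.+ c₃ ℚ.* (w ℚ.- x) ≡
    (c₀ ℚ.* x ℚ.+ (c₁ ℚ.* y ℚ.+ (c₂ ℚ.* z ℚ.+ (c₃ ℚ.* w ℚ.+ 0ℚ)))) ℚ.- x ℚ.*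
        (c₀ ℚ.+ (c₁ ℚ.+ (c₂ ℚ.+ (c₃ ℚ.+ 0ℚ))))
  translate = solve 8 (λ c₀ c₁ c₂ c₃ x y z w →
    c₁ :* (y :- x) :+ c₂ :* (z :- x) :+ c₃ :* (w :- x) :=
    (c₀ :* x :+ (c₁ :* y :+ (c₂ :* z :+ (c₃ :* w :+ con 0ℚ)))) :- x :* (c₀ :+ (c₁ :+ (c₂ :+ (c₃ :+ con 0ℚ)))))
        refl

  -- The first row r₁ may be replaced by α r₁ + β r₂ + γ r₃ at the cost of a factor α.
  cramer : ∀ α β γ a b c d e f g h i →
    (a ℚ.* (e ℚ.* i ℚ.- f ℚ.* h) ℚ.- b ℚ.* (d ℚ.* i ℚ.- f ℚ.* g) ℚ.+ c ℚ.* (d ℚ.* h ℚ.- e ℚ.* g)) ℚ.* α ≡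
    (α ℚ.* a ℚ.+ β ℚ.* d ℚ.+ γ ℚ.* g) ℚ.* (e ℚ.* i ℚ.- f ℚ.* h) ℚ.-
    (α ℚ.* b ℚ.+ β ℚ.* e ℚ.+ γ ℚ.* h) ℚ.* (d ℚ.* i ℚ.- f ℚ.* g) ℚ.+
    (α ℚ.* c ℚ.+ β ℚ.* f ℚ.+ γ ℚ.* i) ℚ.* (d ℚ.* h ℚ.- e ℚ.* g)
  cramer = solve 12 (λ α β γ a b c d e f g h i →
    (a :* (e :* i :- f :* h) :- b :* (d :* i :- f :* g) :+ c :* (d :* h :- e :* g)) :* α :=
    (α :* a :+ β :* d :+ γ :* g) :* (e :* i :- f :* h) :-
    (α :* b :+ β :* e :+ γ :* h) :* (d :* i :- f :* g) :+
    (α :* c :+ β :* f :+ γ :* i) :* (d :* h :- e :* g)) refl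

  -- A cyclic shift of the rows preserves the determinant, so a result about the first coefficient
  -- covers all three.
  det-cycle : ∀ a b c d e f g h i →
    a ℚ.* (e ℚ.* i ℚ.- f ℚ.* h) ℚ.- b ℚ.* (d ℚ.* i ℚ.- f ℚ.* g) ℚ.+ c ℚ.* (d ℚ.* h ℚ.- e ℚ.* g) ≡
    d ℚ.* (h ℚ.* c ℚ.- i ℚ.* b) ℚ.- e ℚ.* (g ℚ.* c ℚ.- i ℚ.* a) ℚ.+ f ℚ.* (g ℚ.* b ℚ.- h ℚ.* a)
  det-cycle = solve 9 (λ a b c d e f g h i →
    a :* (e :* i :- f :* h) :- b :* (d :* i :- f :* g) :+ c :* (d :* h :- e :* g) :=
    d :* (h :* c :- i :* b) :- e :* (g :* c :- i :* a) :+ f :* (g :* b :- h :* a)) refl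

  rotate : ∀ α β γ a d g → α ℚ.* a ℚ.+ β ℚ.* d ℚ.+ γ ℚ.* g ≡ β ℚ.* d ℚ.+ γ ℚ.* g ℚ.+ α ℚ.* a
  rotate = solve 6 (λ α β γ a d g → α :* a :+ β :* d :+ γ :* g := β :* d :+ γ :* g :+ α :* a) refl

  factor-out : ∀ p q r s u v w →
      p ℚ.* (s ℚ.* u) ℚ.+ q ℚ.* (s ℚ.* v) ℚ.+ r ℚ.* (s ℚ.* w) ≡ s ℚ.* (p ℚ.* u ℚ.+ q ℚ.* v ℚ.+ r ℚ.* w)
  factor-out = solve 7 (λ p q r s u v w →
      p :* (s :* u) :+ q :* (s :* v) :+ r :* (s :* w) := s :* (p :* u :+ q :* v :+ r :* w)) refl

  distribute : ∀ n p q r s → n ℚ.* (p ℚ.* q ℚ.+ r ℚ.* s) ≡ p ℚ.* (q ℚ.* n) ℚ.+ r ℚ.* (s ℚ.* n)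
  distribute = solve 5 (λ n p q r s → n :* (p :* q :+ r :* s) := p :* (q :* n) :+ r :* (s :* n)) refl

  sub-add-cancel : ∀ o b → o ℚ.- b ℚ.+ b ≡ o
  sub-add-cancel = solve 2 (λ o b → o :- b :+ b := o) refl

det3ℚ : (a b c d e f g h i : ℚ) → ℚ
det3ℚ a b c d e f g h i =
  a ℚ.* (e ℚ.* i ℚ.- f ℚ.* h) ℚ.- b ℚ.* (d ℚ.* i ℚ.- f ℚ.* g) ℚ.+ c ℚ.* (d ℚ.* h ℚ.- e ℚ.* g)

ι-- : ∀ a b → ι (a ℤ.- b) ≡ ι a ℚ.- ι b
ι-- a b = trans (ι-+ a (ℤ.- b)) (cong (ι a ℚ.+_) (ι-neg b))

ι-det3 : ∀ a b c d e f g h i →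
  ι (det3 a b c d e f g h i) ≡ det3ℚ (ι a) (ι b) (ι c) (ι d) (ι e) (ι f) (ι g) (ι h) (ι i)
ι-det3 a b c d e f g h i =
  trans (ι-+ (a ℤ.* _ ℤ.- b ℤ.* _) _) (cong₂ ℚ._+_
    (trans (ι-- (a ℤ.* _) _) (cong₂ ℚ._-_ (minor a e i f h) (minor b d i f g)))
    (minor c d h e g))
  where
  minor : ∀ p q r s t → ι (p ℤ.* (q ℤ.* r ℤ.- s ℤ.* t)) ≡ ι p ℚ.* (ι q ℚ.* ι r ℚ.- ι s ℚ.* ι t)
  minor p q r s t = trans (ι-* p _)
      (cong (ι p ℚ.*_) (trans (ι-- (q ℤ.* r) _) (cong₂ ℚ._-_ (ι-* q r) (ι-* s t))))

-- By `cramer`, the determinant times `α` is a determinant whose first row is the given combination,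
-- here zero.
row-coefficient-zero : ∀ α β γ a b c d e f g h i → det3ℚ a b c d e f g h i ≢ 0ℚ →
  α ℚ.* a ℚ.+ β ℚ.* d ℚ.+ γ ℚ.* g ≡ 0ℚ →
  α ℚ.* b ℚ.+ β ℚ.* e ℚ.+ γ ℚ.* h ≡ 0ℚ →
  α ℚ.* c ℚ.+ β ℚ.* f ℚ.+ γ ℚ.* i ≡ 0ℚ → α ≡ 0ℚ
row-coefficient-zero α β γ a b c d e f g h i det≢0 e₁ e₂ e₃ = *-cancelˡ-0 _ det≢0 (begin
  det3ℚ a b c d e f g h i ℚ.* α ≡⟨ cramer α β γ a b c d e f g h i ⟩
  _ ≡⟨ cong₂ ℚ._+_ (cong₂ ℚ._-_ (vanish e₁) (vanish e₂)) (vanish e₃) ⟩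
  0ℚ ∎)
  where
  open ≡-Reasoning
  vanish : ∀ {p q} → p ≡ 0ℚ → p ℚ.* q ≡ 0ℚ
  vanish {q = q} refl = ℚP.*-zeroˡ q

-- Translating by `x` turns the affine relation into a linear one between three difference vectors.
-- A nonzero minor kills `c₁`, `c₂` and `c₃`, and the coefficient sum then kills `c₀`.
vol≢0⇒independent : ∀ i j k x y z w → vol i j k x y z w ≢ 0ℤ →
                    AffinelyIndependent (lookup (x ∷ y ∷ z ∷ w ∷ []))
vol≢0⇒independent i j k x y z w vol≢0 c Σc≡0 Σcx≡0 = result
  where
  c₀ = c zero
  c₁ = c (suc zero)
  c₂ = c (suc (suc zero))
  c₃ = c (suc (suc (suc zero)))
  Y Z W : Fin 4 → ℚ
  Y m = ι (Δ x y m)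
  Z m = ι (Δ x z m)
  W m = ι (Δ x w m)
  relation : ∀ m → c₁ ℚ.* Y m ℚ.+ c₂ ℚ.* Z m ℚ.+ c₃ ℚ.* W m ≡ 0ℚ
  relation m = begin
    c₁ ℚ.* Y m ℚ.+ c₂ ℚ.* Z m ℚ.+ c₃ ℚ.* W m
      ≡⟨ cong₂ ℚ._+_ (cong₂ ℚ._+_ (cong (c₁ ℚ.*_) (expand y)) (cong (c₂ ℚ.*_) (expand z)))
          (cong (c₃ ℚ.*_) (expand w)) ⟩
    c₁ ℚ.* (coord y m ℚ.- coord x m) ℚ.+ c₂ ℚ.* (coord z m ℚ.- coord x m) ℚ.+ c₃ ℚ.* (coord w m ℚ.- coord x m)
      ≡⟨ translate c₀ c₁ c₂ c₃ (coord x m) (coord y m) (coord z m) (coord w m) ⟩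
    _ ≡⟨ cong₂ (λ p q → p ℚ.- coord x m ℚ.* q) (Σcx≡0 m) Σc≡0 ⟩
    0ℚ ℚ.- coord x m ℚ.* 0ℚ ≡⟨ cong (λ p → 0ℚ ℚ.- p) (ℚP.*-zeroʳ (coord x m)) ⟩
    0ℚ ∎
    where
    open ≡-Reasoning
    expand : ∀ u → ι (Δ x u m) ≡ coord u m ℚ.- coord x m
    expand u = ι-- (+ (u ⟨ m ⟩)) (+ (x ⟨ m ⟩))
  det≢0 : det3ℚ (Y i) (Y j) (Y k) (Z i) (Z j) (Z k) (W i) (W j) (W k) ≢ 0ℚ
  det≢0 eq = vol≢0 (ι-injective (trans
      (ι-det3 (Δ x y i) (Δ x y j) (Δ x y k) (Δ x z i) (Δ x z j) (Δ x z k) (Δ x w i) (Δ x w j) (Δ x w k)) eq))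
  det₂≢0 : det3ℚ (Z i) (Z j) (Z k) (W i) (W j) (W k) (Y i) (Y j) (Y k) ≢ 0ℚ
  det₂≢0 eq = det≢0 (trans (det-cycle (Y i) (Y j) (Y k) (Z i) (Z j) (Z k) (W i) (W j) (W k)) eq)
  det₃≢0 : det3ℚ (W i) (W j) (W k) (Y i) (Y j) (Y k) (Z i) (Z j) (Z k) ≢ 0ℚ
  det₃≢0 eq = det₂≢0 (trans (det-cycle (Z i) (Z j) (Z k) (W i) (W j) (W k) (Y i) (Y j) (Y k)) eq)
  relation₂ : ∀ m → c₂ ℚ.* Z m ℚ.+ c₃ ℚ.* W m ℚ.+ c₁ ℚ.* Y m ≡ 0ℚ
  relation₂ m = trans (sym (rotate c₁ c₂ c₃ (Y m) (Z m) (W m))) (relation m)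
  relation₃ : ∀ m → c₃ ℚ.* W m ℚ.+ c₁ ℚ.* Y m ℚ.+ c₂ ℚ.* Z m ≡ 0ℚ
  relation₃ m = trans (sym (rotate c₂ c₃ c₁ (Z m) (W m) (Y m))) (relation₂ m)
  c₁≡0 : c₁ ≡ 0ℚ
  c₁≡0 = row-coefficient-zero c₁ c₂ c₃ (Y i) (Y j) (Y k) (Z i) (Z j) (Z k) (W i) (W j) (W k) det≢0
      (relation i) (relation j) (relation k)
  c₂≡0 : c₂ ≡ 0ℚ
  c₂≡0 = row-coefficient-zero c₂ c₃ c₁ (Z i) (Z j) (Z k) (W i) (W j) (W k) (Y i) (Y j) (Y k) det₂≢0
      (relation₂ i) (relation₂ j) (relation₂ k)
  c₃≡0 : c₃ ≡ 0ℚ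
  c₃≡0 = row-coefficient-zero c₃ c₁ c₂ (W i) (W j) (W k) (Y i) (Y j) (Y k) (Z i) (Z j) (Z k) det₃≢0
      (relation₃ i) (relation₃ j) (relation₃ k)
  result : ∀ m → c m ≡ 0ℚ
  result zero                   = begin
    c₀                                          ≡⟨ ℚP.+-identityʳ c₀ ⟨
    c₀ ℚ.+ 0ℚ                                   ≡⟨ cong (c₀ ℚ.+_)
        (cong₂ ℚ._+_ c₁≡0 (cong₂ ℚ._+_ c₂≡0 (cong (ℚ._+ 0ℚ) c₃≡0))) ⟨
    c₀ ℚ.+ (c₁ ℚ.+ (c₂ ℚ.+ (c₃ ℚ.+ 0ℚ)))        ≡⟨ Σc≡0 ⟩
    0ℚ                                          ∎
    where open ≡-Reasoning
  result (suc zero)             = c₁≡0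
  result (suc (suc zero))       = c₂≡0
  result (suc (suc (suc zero))) = c₃≡0

-- Consequences of the B-facet hypothesis

data UnitColumn (a b c d : ℕ) : Set where
  unit₁ : a ≡ 1 → b ≡ 0 → c ≡ 0 → d ≡ 0 → UnitColumn a b c d
  unit₂ : a ≡ 0 → b ≡ 1 → c ≡ 0 → d ≡ 0 → UnitColumn a b c d
  unit₃ : a ≡ 0 → b ≡ 0 → c ≡ 1 → d ≡ 0 → UnitColumn a b c d
  unit₄ : a ≡ 0 → b ≡ 0 → c ≡ 0 → d ≡ 1 → UnitColumn a b c d

module Facet {τ : Polytope 4} (F : IsBFacet τ) where
  open IsBFacet F

  opaque
    unit-column : ∀ i j k {x y z w} → x ∈ τ → y ∈ τ → z ∈ τ → w ∈ τ → vol i j k x y z w ≢ 0ℤ →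
                  ∃[ m ] UnitColumn (x ⟨ m ⟩) (y ⟨ m ⟩) (z ⟨ m ⟩) (w ⟨ m ⟩)
    unit-column i j k {x} {y} {z} {w} x∈τ y∈τ z∈τ w∈τ vol≢0 = convert (simplices-B S vertices∈τ)
      where
      S : Simplex 3 4
      S = record { vertex = lookup (x ∷ y ∷ z ∷ w ∷ [])
          ; independent = vol≢0⇒independent i j k x y z w vol≢0 }
      vertices∈τ : ∀ m → vertex S m ∈ τ
      vertices∈τ zero                   = x∈τ
      vertices∈τ (suc zero)             = y∈τ
      vertices∈τ (suc (suc zero))       = z∈τ
      vertices∈τ (suc (suc (suc zero))) = w∈τ
      convert : IsBSimplex S → ∃[ m ] UnitColumn (x ⟨ m ⟩) (y ⟨ m ⟩) (z ⟨ m ⟩) (w ⟨ m ⟩)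
      convert (m , zero , h , base) = m ,
          unit₁ h (base (suc zero) (λ ())) (base (suc (suc zero)) (λ ())) (base (suc (suc (suc zero))) (λ ()))
      convert (m , suc zero , h , base) = m ,
          unit₂ (base zero (λ ())) h (base (suc (suc zero)) (λ ())) (base (suc (suc (suc zero))) (λ ()))
      convert (m , suc (suc zero) , h , base) = m ,
          unit₃ (base zero (λ ())) (base (suc zero) (λ ())) h (base (suc (suc (suc zero))) (λ ()))
      convert (m , suc (suc (suc zero)) , h , base) = m ,
          unit₄ (base zero (λ ())) (base (suc zero) (λ ())) (base (suc (suc zero)) (λ ())) h

  -- A point of `τ` is the affine combination with all its weight at its own position in the list.
  point-on-hyperplane : ∀ {x} → x ∈ τ → sum (λ j → normal j ℚ.* coord x j) ≡ offset
  point-on-hyperplane {x} x∈τ = Equivalence.to (span-hyperplane (coord x)) (δ t , Σδ≡1 , spans)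
    where
    t : Fin (length τ)
    t = index x∈τ
    Σδ≡1 : sum (δ t) ≡ 1ℚ
    Σδ≡1 = trans (sum-cong-≗ (λ j → sym (ℚP.*-identityʳ (δ t j)))) (sum-δ t (λ _ → 1ℚ))
    spans : ∀ i → sum (λ j → δ t j ℚ.* coord (List.lookup τ j) i) ≡ coord x i
    spans i = trans (sum-δ t (λ j → coord (List.lookup τ j) i))
        (cong (λ y → coord y i) (sym (lookup-index x∈τ)))

  opaque
    -- Positive weights make every term of the weighted sum monotone, while both sums equal
    -- `offset`; so no term can grow.
    antichain : ∀ {x y} → x ∈ τ → y ∈ τ → (∀ m → x ⟨ m ⟩ ℕ.≤ y ⟨ m ⟩) → x ≡ y
    antichain {x} {y} x∈τ y∈τ x≤y = begin
      x                    ≡⟨ tabulate∘lookup x ⟨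
      tabulate (lookup x)  ≡⟨ tabulate-cong {f = lookup x} {g = lookup y} (λ m → ℤP.+-injective (ι-injective
                                (*-cancelˡ-pos (normal-positive m) (weights-≡ m)))) ⟩
      tabulate (lookup y)  ≡⟨ tabulate∘lookup y ⟩
      y                    ∎
      where
      open ≡-Reasoning
      weights-≡ : ∀ m → normal m ℚ.* coord x m ≡ normal m ℚ.* coord y m
      weights-≡ = sum-mono-≡ _ _
        (λ m → ℚP.*-monoˡ-≤-nonNeg (normal m) {{ℚP.pos⇒nonNeg (normal m) {{ℚ.positive (normal-positive m)}}}}
            (ι-mono-≤ (x≤y m)))
        (trans (point-on-hyperplane x∈τ) (sym (point-on-hyperplane y∈τ)))

  -- The weights expressing `z` through `τ` add up to 1, so they pass a constant value on to `z`.
  -- Indices may repeat, which covers functions of fewer coordinates.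
  affine-on-hyperplane : ∀ α β γ c i j k →
    (∀ y → y ∈ τ → α ℤ.* + (y ⟨ i ⟩) ℤ.+ β ℤ.* + (y ⟨ j ⟩) ℤ.+ γ ℤ.* + (y ⟨ k ⟩) ≡ c) →
    ∀ z → sum (λ m → normal m ℚ.* z m) ≡ offset →
    ι α ℚ.* z i ℚ.+ ι β ℚ.* z j ℚ.+ ι γ ℚ.* z k ≡ ι c
  affine-on-hyperplane α β γ c i j k onτ z onH with Equivalence.from (span-hyperplane z) onH
  ... | a , Σa≡1 , spans = begin
    ι α ℚ.* z i ℚ.+ ι β ℚ.* z j ℚ.+ ι γ ℚ.* z k
      ≡⟨ cong₂ ℚ._+_ (cong₂ ℚ._+_ (move α i) (move β j)) (move γ k) ⟩
    sum (term α i) ℚ.+ sum (term β j) ℚ.+ sum (term γ k)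
      ≡⟨ cong (ℚ._+ sum (term γ k)) (∑-distrib-+ (term α i) (term β j)) ⟨
    sum (λ t → term α i t ℚ.+ term β j t) ℚ.+ sum (term γ k)
      ≡⟨ ∑-distrib-+ (λ t → term α i t ℚ.+ term β j t) (term γ k) ⟨
    sum (λ t → term α i t ℚ.+ term β j t ℚ.+ term γ k t)
      ≡⟨ sum-cong-≗ constant ⟩
    sum (λ t → a t ℚ.* ι c)
      ≡⟨ *-distribʳ-sum (ι c) a ⟨
    sum a ℚ.* ι c
      ≡⟨ cong (ℚ._* ι c) Σa≡1 ⟩
    1ℚ ℚ.* ι c
      ≡⟨ ℚP.*-identityˡ (ι c) ⟩
    ι c ∎
    where
    open ≡-Reasoning
    point : Fin (length τ) → Point 4
    point = List.lookup τ
    term : ℤ → Fin 4 → Fin (length τ) → ℚ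
    term ξ m t = ι ξ ℚ.* (a t ℚ.* coord (point t) m)
    move : ∀ ξ m → ι ξ ℚ.* z m ≡ sum (term ξ m)
    move ξ m = trans (cong (ι ξ ℚ.*_) (sym (spans m)))
        (*-distribˡ-sum (ι ξ) (λ t → a t ℚ.* coord (point t) m))
    constant : ∀ t → term α i t ℚ.+ term β j t ℚ.+ term γ k t ≡ a t ℚ.* ι c
    constant t = trans (factor-out (ι α) (ι β) (ι γ) (a t) _ _ _) (cong (a t ℚ.*_) (begin
      ι α ℚ.* ι yi ℚ.+ ι β ℚ.* ι yj ℚ.+ ι γ ℚ.* ι yk
        ≡⟨ cong₂ ℚ._+_ (cong₂ ℚ._+_ (ι-* α yi) (ι-* β yj)) (ι-* γ yk) ⟨
      ι (α ℤ.* yi) ℚ.+ ι (β ℤ.* yj) ℚ.+ ι (γ ℤ.* yk)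
        ≡⟨ cong (ℚ._+ ι (γ ℤ.* yk)) (ι-+ (α ℤ.* yi) (β ℤ.* yj)) ⟨
      ι (α ℤ.* yi ℤ.+ β ℤ.* yj) ℚ.+ ι (γ ℤ.* yk)
        ≡⟨ ι-+ (α ℤ.* yi ℤ.+ β ℤ.* yj) (γ ℤ.* yk) ⟨
      ι (α ℤ.* yi ℤ.+ β ℤ.* yj ℤ.+ γ ℤ.* yk)
        ≡⟨ cong ι (onτ (point t) (∈-lookup t)) ⟩
      ι c ∎))
      where
      yi yj yk : ℤ
      yi = + (point t ⟨ i ⟩)
      yj = + (point t ⟨ j ⟩)
      yk = + (point t ⟨ k ⟩)

  opaque
    -- An affine function not involving x_l but involving x_k is not constant on τ: it takes different values
    -- at the points of the hyperplane of the forms s e_l and e_k + t e_l.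
    spread : ∀ {i j k l} → l ≢ i → l ≢ j → l ≢ k → k ≢ i → k ≢ j → ∀ α β {γ} → γ ≢ 0ℤ → ∀ c →
             ∃[ y ] (y ∈ τ × α ℤ.* + (y ⟨ i ⟩) ℤ.+ β ℤ.* + (y ⟨ j ⟩) ℤ.+ γ ℤ.* + (y ⟨ k ⟩) ≢ c)
    spread {i} {j} {k} {l} l≢i l≢j l≢k k≢i k≢j α β {γ} γ≢0 c
      with any? (λ y → ¬? (α ℤ.* + (y ⟨ i ⟩) ℤ.+ β ℤ.* + (y ⟨ j ⟩) ℤ.+ γ ℤ.* + (y ⟨ k ⟩) ℤP.≟ c)) τ
    ... | yes some = find some
    ... | no none = contradiction (ι-injective ιγ≡ι0) γ≢0
      where
      onτ : ∀ y → y ∈ τ → α ℤ.* + (y ⟨ i ⟩) ℤ.+ β ℤ.* + (y ⟨ j ⟩) ℤ.+ γ ℤ.* + (y ⟨ k ⟩) ≡ c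
      onτ y y∈τ = decidable-stable (_ ℤP.≟ _) (λ ≢c → none (lose y∈τ ≢c))
      a : ℚ
      a = normal l
      instance
        a≢0 : ℚ.NonZero a
        a≢0 = ℚP.pos⇒nonZero a {{ℚ.positive (normal-positive l)}}
      z : ℚ → ℚ → Fin 4 → ℚ
      z b r m = δ l m ℚ.* ((offset ℚ.- b) ℚ.* ℚ.1/ a) ℚ.+ δ k m ℚ.* r
      onH : ∀ r → sum (λ m → normal m ℚ.* z (r ℚ.* normal k) r m) ≡ offset
      onH r = begin
        sum (λ m → normal m ℚ.* z b r m)
          ≡⟨ sum-cong-≗ (λ m → distribute (normal m) (δ l m) q (δ k m) r) ⟩
        sum (λ m → δ l m ℚ.* (q ℚ.* normal m) ℚ.+ δ k m ℚ.* (r ℚ.* normal m))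
          ≡⟨ ∑-distrib-+ (λ m → δ l m ℚ.* (q ℚ.* normal m)) (λ m → δ k m ℚ.* (r ℚ.* normal m)) ⟩
        sum (λ m → δ l m ℚ.* (q ℚ.* normal m)) ℚ.+ sum (λ m → δ k m ℚ.* (r ℚ.* normal m))
          ≡⟨ cong₂ ℚ._+_ (sum-δ l (λ m → q ℚ.* normal m)) (sum-δ k (λ m → r ℚ.* normal m)) ⟩
        q ℚ.* a ℚ.+ b
          ≡⟨ cong (ℚ._+ b) (trans (ℚP.*-assoc (offset ℚ.- b) (ℚ.1/ a) a)
              (cong ((offset ℚ.- b) ℚ.*_) (ℚP.*-inverseˡ a))) ⟩
        (offset ℚ.- b) ℚ.* 1ℚ ℚ.+ b
          ≡⟨ cong (ℚ._+ b) (ℚP.*-identityʳ (offset ℚ.- b)) ⟩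
        offset ℚ.- b ℚ.+ b
          ≡⟨ sub-add-cancel offset b ⟩
        offset ∎
        where
        open ≡-Reasoning
        b q : ℚ
        b = r ℚ.* normal k
        q = (offset ℚ.- b) ℚ.* ℚ.1/ a
      away : ∀ {m} b r → l ≢ m → k ≢ m → z b r m ≡ 0ℚ
      away b r l≢m k≢m = trans (cong₂ (λ p q → p ℚ.* ((offset ℚ.- b) ℚ.* ℚ.1/ a) ℚ.+ q ℚ.* r) (δ-≢ l≢m)
          (δ-≢ k≢m))
                               (cong₂ ℚ._+_ (ℚP.*-zeroˡ ((offset ℚ.- b) ℚ.* ℚ.1/ a)) (ℚP.*-zeroˡ r))
      at-k : ∀ b r → z b r k ≡ r
      at-k b r = trans (cong₂ (λ p q → p ℚ.* ((offset ℚ.- b) ℚ.* ℚ.1/ a) ℚ.+ q ℚ.* r) (δ-≢ l≢k) (δ-refl k))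
                       (trans (cong₂ ℚ._+_ (ℚP.*-zeroˡ ((offset ℚ.- b) ℚ.* ℚ.1/ a)) (ℚP.*-identityˡ r))
                           (ℚP.+-identityˡ r))
      value : ∀ r → ι γ ℚ.* r ≡ ι c
      value r = begin
        ι γ ℚ.* r
          ≡⟨ ℚP.+-identityˡ (ι γ ℚ.* r) ⟨
        0ℚ ℚ.+ ι γ ℚ.* r
          ≡⟨ cong₂ ℚ._+_ (cong₂ ℚ._+_ (vanish (ι α) (away b r l≢i k≢i)) (vanish (ι β) (away b r l≢j k≢j)))
                         (cong (ι γ ℚ.*_) (at-k b r)) ⟨
        ι α ℚ.* z b r i ℚ.+ ι β ℚ.* z b r j ℚ.+ ι γ ℚ.* z b r k
          ≡⟨ affine-on-hyperplane α β γ c i j k onτ (z b r) (onH r) ⟩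
        ι c ∎
        where
        open ≡-Reasoning
        b : ℚ
        b = r ℚ.* normal k
        vanish : ∀ p {q} → q ≡ 0ℚ → p ℚ.* q ≡ 0ℚ
        vanish p refl = ℚP.*-zeroʳ p
      ιγ≡ι0 : ι γ ≡ ι 0ℤ
      ιγ≡ι0 = begin
        ι γ          ≡⟨ ℚP.*-identityʳ (ι γ) ⟨
        ι γ ℚ.* 1ℚ   ≡⟨ value 1ℚ ⟩
        ι c          ≡⟨ value 0ℚ ⟨
        ι γ ℚ.* 0ℚ   ≡⟨ ℚP.*-zeroʳ (ι γ) ⟩
        0ℚ           ∎
        where open ≡-Reasoning

-- Determinants with special rows or columns

area : (i j : Fin 4) (x y z : Point 4) → ℤ
area i j x y z = Δ x y i ℤ.* Δ x z j ℤ.- Δ x y j ℤ.* Δ x z i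

ℤ-*≢0 : ∀ {a b} → a ≢ 0ℤ → b ≢ 0ℤ → a ℤ.* b ≢ 0ℤ
ℤ-*≢0 {a} a≢0 b≢0 ab≡0 with ℤP.i*j≡0⇒i≡0∨j≡0 a ab≡0
... | inj₁ a≡0 = a≢0 a≡0
... | inj₂ b≡0 = b≢0 b≡0

+-≢ : ∀ {m n} → m ≢ n → + m ℤ.- + n ≢ 0ℤ
+-≢ {m} {n} m≢n eq = m≢n (ℤP.+-injective (ℤP.i-j≡0⇒i≡j (+ m) (+ n) eq))

cross-≢ : ∀ a b c d → a ℕ.* d ≢ b ℕ.* c → + a ℤ.* + d ℤ.- + b ℤ.* + c ≢ 0ℤ
cross-≢ a b c d ad≢bc eq = +-≢ ad≢bc (trans (cong₂ ℤ._-_ (ℤP.pos-* a d) (ℤP.pos-* b c)) eq)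

module _ where
  open ℤSolver.+-*-Solver

  private
    det3P : ∀ {n} (a b c d e f g h i : Polynomial n) → Polynomial n
    det3P a b c d e f g h i = a :* (e :* i :- f :* h) :- b :* (d :* i :- f :* g) :+ c :* (d :* h :- e :* g)

    o : ∀ {n} → Polynomial n
    o = con 0ℤ

  -- The projected edge is parallel to the i-axis, so the first row of the determinant has one
  -- nonzero entry.
  vol-edge : ∀ i j k x y z w → x ⟨ j ⟩ ≡ y ⟨ j ⟩ → x ⟨ k ⟩ ≡ y ⟨ k ⟩ →
             vol i j k x y z w ≡ Δ x y i ℤ.* area j k x z w
  vol-edge i j k x y z w ej ek rewrite sym ej | sym ek =
    solve 10 (λ a a′ b b′ c c′ x₁ x₂ x₃ y₁ →
      det3P (y₁ :- x₁) (x₂ :- x₂) (x₃ :- x₃) (a :- x₁) (b :- x₂) (c :- x₃) (a′ :- x₁) (b′ :- x₂) (c′ :- x₃)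
      := (y₁ :- x₁) :* ((b :- x₂) :* (c′ :- x₃) :- (c :- x₃) :* (b′ :- x₂))) refl
      (+ (z ⟨ i ⟩)) (+ (w ⟨ i ⟩)) (+ (z ⟨ j ⟩)) (+ (w ⟨ j ⟩)) (+ (z ⟨ k ⟩)) (+ (w ⟨ k ⟩))
      (+ (x ⟨ i ⟩)) (+ (x ⟨ j ⟩)) (+ (x ⟨ k ⟩)) (+ (y ⟨ i ⟩))

  -- Height times base: in the column of i-differences only the entry of `w` survives.
  vol-apex : ∀ i j k x y z w → x ⟨ i ⟩ ≡ 0 → y ⟨ i ⟩ ≡ 0 → z ⟨ i ⟩ ≡ 0 →
             vol i j k x y z w ≡ + (w ⟨ i ⟩) ℤ.* area j k x y z
  vol-apex i j k x y z w ex ey ez rewrite ex | ey | ez =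
    solve 9 (λ w₁ b b′ b″ c c′ c″ x₂ x₃ →
      det3P (o :- o) (b :- x₂) (c :- x₃) (o :- o) (b′ :- x₂) (c′ :- x₃) (w₁ :- o) (b″ :- x₂) (c″ :- x₃)
      := w₁ :* ((b :- x₂) :* (c′ :- x₃) :- (c :- x₃) :* (b′ :- x₂))) refl
      (+ (w ⟨ i ⟩)) (+ (y ⟨ j ⟩)) (+ (z ⟨ j ⟩)) (+ (w ⟨ j ⟩)) (+ (y ⟨ k ⟩)) (+ (z ⟨ k ⟩)) (+ (w ⟨ k ⟩))
      (+ (x ⟨ j ⟩)) (+ (x ⟨ k ⟩))

  -- For opposite edges at heights 1 and 0 the volume is the cross product of their projections; it
  -- vanishes exactly when these are parallel.
  vol-edges : ∀ i j k x y z w → x ⟨ i ⟩ ≡ 1 → y ⟨ i ⟩ ≡ 1 → z ⟨ i ⟩ ≡ 0 → w ⟨ i ⟩ ≡ 0 →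
              vol i j k x y z w ≡ Δ x y j ℤ.* Δ z w k ℤ.- Δ x y k ℤ.* Δ z w j
  vol-edges i j k x y z w ex ey ez ew rewrite ex | ey | ez | ew =
    solve 8 (λ b b′ b″ c c′ c″ x₂ x₃ →
      det3P (con (+ 1) :- con (+ 1)) (b :- x₂) (c :- x₃) (o :- con (+ 1)) (b′ :- x₂) (c′ :- x₃)
          (o :- con (+ 1)) (b″ :- x₂) (c″ :- x₃)
      := (b :- x₂) :* (c″ :- c′) :- (c :- x₃) :* (b″ :- b′)) refl
      (+ (y ⟨ j ⟩)) (+ (z ⟨ j ⟩)) (+ (w ⟨ j ⟩)) (+ (y ⟨ k ⟩)) (+ (z ⟨ k ⟩)) (+ (w ⟨ k ⟩))
      (+ (x ⟨ j ⟩)) (+ (x ⟨ k ⟩))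

  area-origin : ∀ i j x y z → x ⟨ i ⟩ ≡ 0 → x ⟨ j ⟩ ≡ 0 →
                area i j x y z ≡ + (y ⟨ i ⟩) ℤ.* + (z ⟨ j ⟩) ℤ.- + (y ⟨ j ⟩) ℤ.* + (z ⟨ i ⟩)
  area-origin i j x y z ei ej rewrite ei | ej =
    solve 4 (λ a b c d → (a :- o) :* (d :- o) :- (b :- o) :* (c :- o) := a :* d :- b :* c) refl
      (+ (y ⟨ i ⟩)) (+ (y ⟨ j ⟩)) (+ (z ⟨ i ⟩)) (+ (z ⟨ j ⟩))

  area-swap : ∀ i j x y z → area i j x y z ≡ ℤ.- area i j y x z
  area-swap i j x y z =
    solve 6 (λ a b c d e f → (c :- a) :* (f :- b) :- (d :- b) :* (e :- a) := :-
        ((a :- c) :* (f :- d) :- (b :- d) :* (e :- c))) refl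
      (+ (x ⟨ i ⟩)) (+ (x ⟨ j ⟩)) (+ (y ⟨ i ⟩)) (+ (y ⟨ j ⟩)) (+ (z ⟨ i ⟩)) (+ (z ⟨ j ⟩))

-- A nonzero determinant of the projections as vectors from the origin, split over an equation in ℕ
-- to avoid subtraction.
Independent : (i j : Fin 4) (x y : Point 4) → Set
Independent i j x y = x ⟨ i ⟩ ℕ.* y ⟨ j ⟩ ≢ x ⟨ j ⟩ ℕ.* y ⟨ i ⟩

area-origin-≢0 : ∀ i j x y z → x ⟨ i ⟩ ≡ 0 → x ⟨ j ⟩ ≡ 0 → Independent i j y z → area i j x y z ≢ 0ℤ
area-origin-≢0 i j x y z ei ej ind eq =
  cross-≢ (y ⟨ i ⟩) (y ⟨ j ⟩) (z ⟨ i ⟩) (z ⟨ j ⟩) ind (trans (sym (area-origin i j x y z ei ej)) eq)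

-- Relabelled coordinates and unit pairs

record Frame (i j k l : Fin 4) : Set where
  constructor frame
  field
    i≢j : i ≢ j
    i≢k : i ≢ k
    i≢l : i ≢ l
    j≢k : j ≢ k
    j≢l : j ≢ l
    k≢l : k ≢ l

swap-ij : ∀ {i j k l} → Frame i j k l → Frame j i k l
swap-ij (frame ij ik il jk jl kl) = frame (ij ∘ sym) jk jl ik il kl

swap-kl : ∀ {i j k l} → Frame i j k l → Frame i j l k
swap-kl (frame ij ik il jk jl kl) = frame ij il ik jl jk (kl ∘ sym)

swap-jk : ∀ {i j k l} → Frame i j k l → Frame i k j l
swap-jk (frame ij ik il jk jl kl) = frame ik ij il (jk ∘ sym) kl jl

-- Five indices in a set of four must repeat, and the frame excludes every repetition that does not
-- involve `m`.
cover : ∀ {i j k l} → Frame i j k l → ∀ m → m ≡ i ⊎ m ≡ j ⊎ m ≡ k ⊎ m ≡ l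
cover {i} {j} {k} {l} (frame ij ik il jk jl kl) m with FinP.pigeonhole ℕP.≤-refl
    (lookup (m ∷ i ∷ j ∷ k ∷ l ∷ []))
... | zero , suc zero , _ , e = inj₁ e
... | zero , suc (suc zero) , _ , e = inj₂ (inj₁ e)
... | zero , suc (suc (suc zero)) , _ , e = inj₂ (inj₂ (inj₁ e))
... | zero , suc (suc (suc (suc zero))) , _ , e = inj₂ (inj₂ (inj₂ e))
... | suc zero , suc (suc zero) , _ , e = contradiction e ij
... | suc zero , suc (suc (suc zero)) , _ , e = contradiction e ik
... | suc zero , suc (suc (suc (suc zero))) , _ , e = contradiction e il
... | suc (suc zero) , suc (suc (suc zero)) , _ , e = contradiction e jk
... | suc (suc zero) , suc (suc (suc (suc zero))) , _ , e = contradiction e jl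
... | suc (suc (suc zero)) , suc (suc (suc (suc zero))) , _ , e = contradiction e kl
... | suc zero , suc zero , s≤s () , _
... | suc (suc zero) , suc zero , s≤s () , _
... | suc (suc zero) , suc (suc zero) , s≤s (s≤s ()) , _
... | suc (suc (suc zero)) , suc zero , s≤s () , _
... | suc (suc (suc zero)) , suc (suc zero) , s≤s (s≤s ()) , _
... | suc (suc (suc zero)) , suc (suc (suc zero)) , s≤s (s≤s (s≤s ())) , _
... | suc (suc (suc (suc zero))) , suc zero , s≤s () , _
... | suc (suc (suc (suc zero))) , suc (suc zero) , s≤s (s≤s ()) , _
... | suc (suc (suc (suc zero))) , suc (suc (suc zero)) , s≤s (s≤s (s≤s ())) , _
... | suc (suc (suc (suc zero))) , suc (suc (suc (suc zero))) , s≤s (s≤s (s≤s (s≤s ()))) , _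

cover-elim : ∀ {i j k l} → Frame i j k l → (P : Fin 4 → Set) → P i → P j → P k → P l → ∀ m → P m
cover-elim F P pi pj pk pl m with cover F m
... | inj₁ refl = pi
... | inj₂ (inj₁ refl) = pj
... | inj₂ (inj₂ (inj₁ refl)) = pk
... | inj₂ (inj₂ (inj₂ refl)) = pl

_≟P_ : (x y : Point 4) → Dec (x ≡ y)
_≟P_ = ≡-dec ℕP._≟_

search : ∀ {P : Point 4 → Set} → (∀ x → Dec (P x)) → (τ : Polytope 4) →
         (∃[ x ] (x ∈ τ × P x)) ⊎ (∀ x → x ∈ τ → ¬ P x)
search P? τ with any? P? τ
... | yes some = inj₁ (find some)
... | no none  = inj₂ (λ x x∈τ px → none (lose x∈τ px))

-- What is left of a unit vector with four entries when the other two are zero.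
UnitPair : ℕ → ℕ → Set
UnitPair a b = (a ≡ 1 × b ≡ 0) ⊎ (a ≡ 0 × b ≡ 1)

unitPair? : ∀ a b → Dec (UnitPair a b)
unitPair? a b = ((a ℕP.≟ 1) ×-dec (b ℕP.≟ 0)) ⊎-dec ((a ℕP.≟ 0) ×-dec (b ℕP.≟ 1))

unitPair-swap : ∀ {a b} → UnitPair a b → UnitPair b a
unitPair-swap (inj₁ (a , b)) = inj₂ (b , a)
unitPair-swap (inj₂ (a , b)) = inj₁ (b , a)

¬unitPair : ∀ {a b} → a ≢ 0 → b ≢ 0 → ¬ UnitPair a b
¬unitPair a≢0 b≢0 (inj₁ (_ , b≡0)) = b≢0 b≡0
¬unitPair a≢0 b≢0 (inj₂ (a≡0 , _)) = a≢0 a≡0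

unitPair-≢0ˡ : ∀ {a b} → b ≡ 0 → UnitPair a b → a ≡ 1
unitPair-≢0ˡ b≡0 (inj₁ (a≡1 , _)) = a≡1
unitPair-≢0ˡ b≡0 (inj₂ (_ , b≡1)) = contradiction (trans (sym b≡0) b≡1) λ ()

0≢1 : ∀ {a} → a ≡ 0 → a ≡ 1 → ⊥
0≢1 refl ()

≡1⇒≢0 : ∀ {a} → a ≡ 1 → a ≢ 0
≡1⇒≢0 a≡1 a≡0 = 0≢1 a≡0 a≡1

<⇒≢0 : ∀ {m n} → m ℕ.< n → n ≢ 0
<⇒≢0 (s≤s _) ()

0≡⇒≤ : ∀ {a b} → a ≡ 0 → a ℕ.≤ b
0≡⇒≤ refl = z≤n

1≡⇒≤ : ∀ {a b} → a ≡ 1 → b ≢ 0 → a ℕ.≤ b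
1≡⇒≤ refl b≢0 = ℕP.n≢0⇒n>0 b≢0

independent-axis : ∀ {i j x y} → x ⟨ i ⟩ ≢ 0 → y ⟨ j ⟩ ≢ 0 → y ⟨ i ⟩ ≡ 0 → Independent i j x y
independent-axis {i} {j} {x} {y} xi≢0 yj≢0 yi≡0 eq with ℕP.m*n≡0⇒m≡0∨n≡0 (x ⟨ i ⟩)
    (trans eq (trans (cong (x ⟨ j ⟩ ℕ.*_) yi≡0) (ℕP.*-zeroʳ (x ⟨ j ⟩))))
... | inj₁ xi≡0 = xi≢0 xi≡0
... | inj₂ yj≡0 = yj≢0 yj≡0

independent-swap : ∀ {i j x y} → Independent i j x y → Independent i j y x
independent-swap {i} {j} {x} {y} ind eq =
    ind (trans (ℕP.*-comm (x ⟨ i ⟩) (y ⟨ j ⟩)) (trans (sym eq) (ℕP.*-comm (y ⟨ i ⟩) (x ⟨ j ⟩))))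

independent? : ∀ i j x y → Dec (Independent i j x y)
independent? i j x y = ¬? (_ ℕP.≟ _)

-- Comparison of points and simplices over a coordinate plane

module Classification {τ : Polytope 4} (F : IsBFacet τ) where
  open Facet F

  Result : Set
  Result = IsB₁ τ ⊎ IsB₂ τ ⊎ IsFlatBorder τ ⊎ IsCrossPolytope τ

  b₁ : IsB₁ τ → Result
  b₁ = inj₁
  b₂ : IsB₂ τ → Result
  b₂ = inj₂ ∘ inj₁
  flat : IsFlatBorder τ → Result
  flat = inj₂ ∘ inj₂ ∘ inj₁

  UnitColumns : ∀ {i j k l} → Frame i j k l → (x y z w : Point 4) → Set
  UnitColumns {i} {j} {k} {l} _ x y z w = UnitAt i ⊎ UnitAt j ⊎ UnitAt k ⊎ UnitAt l
    where
    UnitAt : Fin 4 → Set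
    UnitAt m = UnitColumn (x ⟨ m ⟩) (y ⟨ m ⟩) (z ⟨ m ⟩) (w ⟨ m ⟩)

  opaque
    unit-column′ : ∀ {i j k l} (fr : Frame i j k l) a b c {x y z w} → x ∈ τ → y ∈ τ → z ∈ τ → w ∈ τ →
        vol a b c x y z w ≢ 0ℤ → UnitColumns fr x y z w
    unit-column′ fr a b c x∈τ y∈τ z∈τ w∈τ vol≢0 with unit-column a b c x∈τ y∈τ z∈τ w∈τ vol≢0
    ... | m , u with cover fr m
    ... | inj₁ refl = inj₁ u
    ... | inj₂ (inj₁ refl) = inj₂ (inj₁ u)
    ... | inj₂ (inj₂ (inj₁ refl)) = inj₂ (inj₂ (inj₁ u))
    ... | inj₂ (inj₂ (inj₂ refl)) = inj₂ (inj₂ (inj₂ u))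

  opaque
    dominated : ∀ {i j k l x y} → Frame i j k l → x ∈ τ → y ∈ τ →
      x ⟨ i ⟩ ℕ.≤ y ⟨ i ⟩ → x ⟨ j ⟩ ℕ.≤ y ⟨ j ⟩ → x ⟨ k ⟩ ℕ.≤ y ⟨ k ⟩ → x ⟨ l ⟩ ℕ.≤ y ⟨ l ⟩ → x ≡ y
    dominated {x = x} {y} fr x∈τ y∈τ hi hj hk hl =
      antichain x∈τ y∈τ (cover-elim fr (λ m → x ⟨ m ⟩ ℕ.≤ y ⟨ m ⟩) hi hj hk hl)

  opaque
    -- The one remaining coordinate is totally ordered, so the points are comparable.
    agree : ∀ {i j k l x y} → Frame i j k l → x ∈ τ → y ∈ τ → x ⟨ j ⟩ ≡ y ⟨ j ⟩ → x ⟨ k ⟩ ≡ y ⟨ k ⟩ →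
        x ⟨ l ⟩ ≡ y ⟨ l ⟩ → x ≡ y
    agree {i = i} {x = x} {y} fr x∈τ y∈τ ej ek el with ℕP.≤-total (x ⟨ i ⟩) (y ⟨ i ⟩)
    ... | inj₁ le = dominated fr x∈τ y∈τ le (ℕP.≤-reflexive ej) (ℕP.≤-reflexive ek) (ℕP.≤-reflexive el)
    ... | inj₂ ge = sym (dominated fr y∈τ x∈τ ge (ℕP.≤-reflexive (sym ej)) (ℕP.≤-reflexive (sym ek))
        (ℕP.≤-reflexive (sym el)))

  opaque
    opposite : ∀ {i j k l x y} → Frame i j k l → x ∈ τ → y ∈ τ → x ≢ y → x ⟨ k ⟩ ≡ y ⟨ k ⟩ →
        x ⟨ l ⟩ ≡ y ⟨ l ⟩ →
      (x ⟨ i ⟩ ℕ.< y ⟨ i ⟩ × y ⟨ j ⟩ ℕ.< x ⟨ j ⟩) ⊎ (y ⟨ i ⟩ ℕ.< x ⟨ i ⟩ × x ⟨ j ⟩ ℕ.< y ⟨ j ⟩)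
    opposite {i} {j} {k} {l} {x} {y} fr x∈τ y∈τ x≢y ek el with x ⟨ i ⟩ ℕP.≤? y ⟨ i ⟩ | x ⟨ j ⟩ ℕP.≤? y ⟨ j ⟩
    ... | yes le | yes le′ = contradiction
        (dominated fr x∈τ y∈τ le le′ (ℕP.≤-reflexive ek) (ℕP.≤-reflexive el)) x≢y
    ... | no ge | yes le = inj₂ (ℕP.≰⇒> ge , ℕP.≤∧≢⇒< le (λ ej → x≢y (agree fr x∈τ y∈τ ej ek el)))
    ... | yes le | no ge = inj₁ (ℕP.≤∧≢⇒< le (λ ei → x≢y (agree (swap-ij fr) x∈τ y∈τ ei ek el)) , ℕP.≰⇒> ge)
    ... | no ge | no ge′ = contradiction
        (sym (dominated fr y∈τ x∈τ (ℕP.<⇒≤ (ℕP.≰⇒> ge)) (ℕP.<⇒≤ (ℕP.≰⇒> ge′)) (ℕP.≤-reflexive (sym ek))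
        (ℕP.≤-reflexive (sym el)))) x≢y

  opaque
    -- A single coordinate is not constant on `τ` by `spread`; in particular it is not constantly 0.
    nonempty : ∀ {i j k l} → Frame i j k l → ∃[ x ] (x ∈ τ × x ⟨ l ⟩ ≢ 0)
    nonempty {i} {j} {k} {l} fr with spread {i} {i} {l} {k} (i≢k ∘ sym) (i≢k ∘ sym) k≢l (i≢l ∘ sym)
        (i≢l ∘ sym) 0ℤ 0ℤ {+ 1} (λ ()) 0ℤ
      where open Frame fr
    ... | y , y∈τ , ≢0 = y , y∈τ , λ yl≡0 →
        ≢0 (cong (λ a → 0ℤ ℤ.* + (y ⟨ i ⟩) ℤ.+ 0ℤ ℤ.* + (y ⟨ i ⟩) ℤ.+ + 1 ℤ.* + a) yl≡0)

  record Edge (k l : Fin 4) (e e′ : Point 4) : Set where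
    field
      e∈τ  : e ∈ τ
      e′∈τ : e′ ∈ τ
      e≢e′ : e ≢ e′
      ek   : e ⟨ k ⟩ ≡ 0
      el   : e ⟨ l ⟩ ≡ 0
      e′k  : e′ ⟨ k ⟩ ≡ 0
      e′l  : e′ ⟨ l ⟩ ≡ 0

    edge-i : ∀ {i j} → Frame i j k l → e ⟨ i ⟩ ≢ e′ ⟨ i ⟩
    edge-i fr ei≡ = e≢e′ (agree (swap-ij fr) e∈τ e′∈τ ei≡ (trans ek (sym e′k)) (trans el (sym e′l)))

    edge-j : ∀ {i j} → Frame i j k l → e ⟨ j ⟩ ≢ e′ ⟨ j ⟩
    edge-j fr = edge-i (swap-ij fr)

  edge-flip : ∀ {k l e e′} → Edge k l e e′ → Edge k l e′ e
  edge-flip E = record { e∈τ = e′∈τ ; e′∈τ = e∈τ ; e≢e′ = e≢e′ ∘ sym ; ek = e′k ; el = e′l ; e′k = ek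
      ; e′l = el }
    where open Edge E

  edge-transpose : ∀ {k l e e′} → Edge k l e e′ → Edge l k e e′
  edge-transpose E = record { e∈τ = e∈τ ; e′∈τ = e′∈τ ; e≢e′ = e≢e′ ; ek = el ; el = ek ; e′k = e′l
      ; e′l = e′k }
    where open Edge E

  opaque
    -- In i and j the entries of `e` and `e′` differ, so the 1 of the unit vector is at one of them.
    -- In k and l both entries vanish, so it is at `r` or `s`.
    edge-quad : ∀ {i j k l e e′ r s} → Frame i j k l → Edge k l e e′ → r ∈ τ → s ∈ τ → Independent k l r s →
      (UnitPair (e ⟨ i ⟩) (e′ ⟨ i ⟩) × r ⟨ i ⟩ ≡ 0 × s ⟨ i ⟩ ≡ 0) ⊎
      (UnitPair (e ⟨ j ⟩) (e′ ⟨ j ⟩) × r ⟨ j ⟩ ≡ 0 × s ⟨ j ⟩ ≡ 0) ⊎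
      UnitPair (r ⟨ k ⟩) (s ⟨ k ⟩) ⊎ UnitPair (r ⟨ l ⟩) (s ⟨ l ⟩)
    edge-quad {i} {j} {k} {l} {e} {e′} {r} {s} fr E r∈τ s∈τ ind =
      Sum.map (outside (edge-i fr)) (Sum.map (outside (edge-j fr)) (Sum.map (inside ek e′k) (inside el e′l)))
        (unit-column′ fr j k l e∈τ e′∈τ r∈τ s∈τ vol≢0)
      where
      open Edge E
      vol≢0 : vol j k l e e′ r s ≢ 0ℤ
      vol≢0 = subst (_≢ 0ℤ) (sym (vol-edge j k l e e′ r s (trans ek (sym e′k)) (trans el (sym e′l))))
                (ℤ-*≢0 (+-≢ (edge-j fr ∘ sym)) (area-origin-≢0 k l e r s ek el ind))
      outside : ∀ {a b c d} → a ≢ b → UnitColumn a b c d → UnitPair a b × c ≡ 0 × d ≡ 0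
      outside a≢b (unit₁ a b c d) = inj₁ (a , b) , c , d
      outside a≢b (unit₂ a b c d) = inj₂ (a , b) , c , d
      outside a≢b (unit₃ a b c d) = contradiction (trans a (sym b)) a≢b
      outside a≢b (unit₄ a b c d) = contradiction (trans a (sym b)) a≢b
      inside : ∀ {a b c d} → a ≡ 0 → b ≡ 0 → UnitColumn a b c d → UnitPair c d
      inside a≡0 b≡0 (unit₁ a b c d) = ⊥-elim (0≢1 a≡0 a)
      inside a≡0 b≡0 (unit₂ a b c d) = ⊥-elim (0≢1 b≡0 b)
      inside a≡0 b≡0 (unit₃ a b c d) = inj₁ (c , d)
      inside a≡0 b≡0 (unit₄ a b c d) = inj₂ (c , d)

  opaque
    -- Here `r` and `r′` lie over the same point of the (k , l)-plane and `a` lies over the origin.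
    -- In k and l the entries of `r` and `r′` agree, so the 1 could only be at `p`; the two negated
    -- hypotheses exclude this. In i and j they differ, so the 1 is at one of them.
    fibre-quad : ∀ {i j k l a r r′ p} → Frame i j k l → a ∈ τ → a ⟨ k ⟩ ≡ 0 → a ⟨ l ⟩ ≡ 0 → r ∈ τ → r′ ∈ τ →
        p ∈ τ →
      r ≢ r′ → r ⟨ k ⟩ ≡ r′ ⟨ k ⟩ → r ⟨ l ⟩ ≡ r′ ⟨ l ⟩ → Independent k l r p →
      ¬ (r ⟨ k ⟩ ≡ 0 × p ⟨ k ⟩ ≡ 1) → ¬ (r ⟨ l ⟩ ≡ 0 × p ⟨ l ⟩ ≡ 1) →
      (a ⟨ i ⟩ ≡ 0 × p ⟨ i ⟩ ≡ 0 × UnitPair (r ⟨ i ⟩) (r′ ⟨ i ⟩)) ⊎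
      (a ⟨ j ⟩ ≡ 0 × p ⟨ j ⟩ ≡ 0 × UnitPair (r ⟨ j ⟩) (r′ ⟨ j ⟩))
    fibre-quad {i} {j} {k} {l} {a} {r} {r′} {p} fr a∈τ ak al r∈τ r′∈τ p∈τ r≢r′ rk rl ind ¬k ¬l =
      Sum.map (outside ri≢)
        ([ outside rj≢ , ⊥-elim ∘ [ inside rk ak ¬k , inside rl al ¬l ] ])
        (unit-column′ fr j k l r∈τ r′∈τ a∈τ p∈τ vol≢0)
      where
      ri≢ : r ⟨ i ⟩ ≢ r′ ⟨ i ⟩
      ri≢ ri = r≢r′ (agree (swap-ij fr) r∈τ r′∈τ ri rk rl)
      rj≢ : r ⟨ j ⟩ ≢ r′ ⟨ j ⟩
      rj≢ rj = r≢r′ (agree fr r∈τ r′∈τ rj rk rl)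
      vol≢0 : vol j k l r r′ a p ≢ 0ℤ
      vol≢0 = subst (_≢ 0ℤ) (sym (vol-edge j k l r r′ a p rk rl))
                (ℤ-*≢0 (+-≢ (rj≢ ∘ sym)) (subst (_≢ 0ℤ) (sym (area-swap k l r a p))
                  (λ eq → area-origin-≢0 k l a r p ak al ind (ℤP.neg-injective eq))))
      outside : ∀ {a b c d} → a ≢ b → UnitColumn a b c d → c ≡ 0 × d ≡ 0 × UnitPair a b
      outside a≢b (unit₁ a b c d) = c , d , inj₁ (a , b)
      outside a≢b (unit₂ a b c d) = c , d , inj₂ (a , b)
      outside a≢b (unit₃ a b c d) = contradiction (trans a (sym b)) a≢b
      outside a≢b (unit₄ a b c d) = contradiction (trans a (sym b)) a≢b
      inside : ∀ {a b c d} → a ≡ b → c ≡ 0 → ¬ (a ≡ 0 × d ≡ 1) → ¬ UnitColumn a b c d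
      inside a≡b c≡0 ¬q (unit₁ a b c d) = 0≢1 b (trans (sym a≡b) a)
      inside a≡b c≡0 ¬q (unit₂ a b c d) = 0≢1 a (trans a≡b b)
      inside a≡b c≡0 ¬q (unit₃ a b c d) = 0≢1 c≡0 c
      inside a≡b c≡0 ¬q (unit₄ a b c d) = ¬q (a , d)

  opaque
    -- `fibre-quad` holds for `e` and for `e′`. These differ in i and in j, so they cannot vanish in
    -- the same one: one application yields i and the other j.
    edge-fibre : ∀ {i j k l e e′ r r′ p} → Frame i j k l → Edge k l e e′ → r ∈ τ → r′ ∈ τ → p ∈ τ →
      r ≢ r′ → r ⟨ k ⟩ ≡ r′ ⟨ k ⟩ → r ⟨ l ⟩ ≡ r′ ⟨ l ⟩ → Independent k l r p →
      ¬ (r ⟨ k ⟩ ≡ 0 × p ⟨ k ⟩ ≡ 1) → ¬ (r ⟨ l ⟩ ≡ 0 × p ⟨ l ⟩ ≡ 1) →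
      p ⟨ i ⟩ ≡ 0 × p ⟨ j ⟩ ≡ 0 × UnitPair (r ⟨ i ⟩) (r′ ⟨ i ⟩) × (e ⟨ i ⟩ ≡ 0 ⊎ e′ ⟨ i ⟩ ≡ 0)
    edge-fibre {i} {j} {k} {l} {e} {e′} {r} {r′} {p} fr E r∈τ r′∈τ p∈τ r≢r′ rk rl ind ¬k ¬l = combine
      (fibre-quad fr e∈τ ek el r∈τ r′∈τ p∈τ r≢r′ rk rl ind ¬k ¬l)
      (fibre-quad fr e′∈τ e′k e′l r∈τ r′∈τ p∈τ r≢r′ rk rl ind ¬k ¬l)
      where
      open Edge E
      combine :
        (e ⟨ i ⟩ ≡ 0 × p ⟨ i ⟩ ≡ 0 × UnitPair (r ⟨ i ⟩) (r′ ⟨ i ⟩)) ⊎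
            (e ⟨ j ⟩ ≡ 0 × p ⟨ j ⟩ ≡ 0 × UnitPair (r ⟨ j ⟩) (r′ ⟨ j ⟩)) →
        (e′ ⟨ i ⟩ ≡ 0 × p ⟨ i ⟩ ≡ 0 × UnitPair (r ⟨ i ⟩) (r′ ⟨ i ⟩)) ⊎
            (e′ ⟨ j ⟩ ≡ 0 × p ⟨ j ⟩ ≡ 0 × UnitPair (r ⟨ j ⟩) (r′ ⟨ j ⟩)) →
        p ⟨ i ⟩ ≡ 0 × p ⟨ j ⟩ ≡ 0 × UnitPair (r ⟨ i ⟩) (r′ ⟨ i ⟩) × (e ⟨ i ⟩ ≡ 0 ⊎ e′ ⟨ i ⟩ ≡ 0)
      combine (inj₁ (ei , _)) (inj₁ (e′i , _)) = contradiction (trans ei (sym e′i)) (edge-i fr)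
      combine (inj₁ (ei , pi , ui)) (inj₂ (e′j , pj , uj)) = pi , pj , ui , inj₁ ei
      combine (inj₂ (ej , pj , uj)) (inj₁ (e′i , pi , ui)) = pi , pj , ui , inj₂ e′i
      combine (inj₂ (ej , _)) (inj₂ (e′j , _)) = contradiction (trans ej (sym e′j)) (edge-j fr)

    -- All points off x_k = 0 lie over one point of the (k , l)-plane. If there is only one, it is
    -- the apex of a B₁-facet. Of two, one has i-coordinate 1; comparison with it puts all the
    -- others off x_k = 0 into x_i = 0. It is then the apex of a flat border for i and k, with base
    -- points `p` and the end of the edge that lies in x_i = 0.
    constant-fibre : ∀ {i j k l e e′ p c} → Frame i j k l → Edge k l e e′ →
      (∀ x → x ∈ τ → x ⟨ k ⟩ ≢ 0 → x ⟨ k ⟩ ≡ 1 × x ⟨ l ⟩ ≡ c) →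
      p ∈ τ → p ⟨ k ⟩ ≡ 0 → p ⟨ l ⟩ ≢ 0 → ¬ (c ≡ 0 × p ⟨ l ⟩ ≡ 1) → Result
    constant-fibre {i} {j} {k} {l} {e} {e′} {p} {c} fr E const p∈τ pk pl ¬cp = go
      where
      open Edge E
      open Frame fr
      compare : ∀ {r x} → r ∈ τ → x ∈ τ → r ⟨ k ⟩ ≢ 0 → x ⟨ k ⟩ ≢ 0 → r ≢ x →
        p ⟨ i ⟩ ≡ 0 × p ⟨ j ⟩ ≡ 0 × UnitPair (r ⟨ i ⟩) (x ⟨ i ⟩) × (e ⟨ i ⟩ ≡ 0 ⊎ e′ ⟨ i ⟩ ≡ 0)
      compare {r} {x} r∈τ x∈τ rk≢0 xk≢0 r≢x with const r r∈τ rk≢0 | const x x∈τ xk≢0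
      ... | rk , rl | xk , xl =
        edge-fibre fr E r∈τ x∈τ p∈τ r≢x (trans rk (sym xk)) (trans rl (sym xl))
          (independent-axis {x = r} {y = p} rk≢0 pl pk) (λ (z , _) → rk≢0 z)
              (λ (z , q) → ¬cp (trans (sym rl) z , q))
      border : ∀ {C x A} → C ∈ τ → x ∈ τ → C ⟨ k ⟩ ≢ 0 → x ⟨ k ⟩ ≢ 0 → C ≢ x → C ⟨ i ⟩ ≡ 1 → p ⟨ i ⟩ ≡ 0 →
        A ∈ τ → A ⟨ i ⟩ ≡ 0 → A ⟨ k ⟩ ≡ 0 → A ⟨ l ⟩ ≡ 0 → Result
      border {C} {x} {A} C∈τ x∈τ Ck xk C≢x Ci pi A∈τ Ai Ak Al = flat
        (i , k , C , i≢k , C∈τ , Ci , proj₁ (const C C∈τ Ck) ,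
         (A , p , (λ A≡p → pl (trans (sym (cong (_⟨ l ⟩) A≡p)) Al)) , A∈τ , Ai , Ak , p∈τ , pi , pk) , others)
        where
        others : ∀ y → y ∈ τ → y ≢ C → y ⟨ i ⟩ ≡ 0 ⊎ y ⟨ k ⟩ ≡ 0
        others y y∈τ y≢C with y ⟨ k ⟩ ℕP.≟ 0
        ... | yes yk≡0 = inj₂ yk≡0
        ... | no yk≢0 with compare C∈τ y∈τ Ck yk≢0 (y≢C ∘ sym)
        ... | _ , _ , inj₁ (_ , yi≡0) , _ = inj₁ yi≡0
        ... | _ , _ , inj₂ (Ci≡0 , _) , _ = ⊥-elim (0≢1 Ci≡0 Ci)
      finish : ∀ {r x} → r ∈ τ → x ∈ τ → r ⟨ k ⟩ ≢ 0 → x ⟨ k ⟩ ≢ 0 → r ≢ x → Result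
      finish r∈τ x∈τ rk xk r≢x with compare r∈τ x∈τ rk xk r≢x
      ... | pi , _ , inj₁ (ri , _) , inj₁ ei = border r∈τ x∈τ rk xk r≢x ri pi e∈τ ei ek el
      ... | pi , _ , inj₁ (ri , _) , inj₂ e′i = border r∈τ x∈τ rk xk r≢x ri pi e′∈τ e′i e′k e′l
      ... | pi , _ , inj₂ (_ , xi) , inj₁ ei = border x∈τ r∈τ xk rk (r≢x ∘ sym) xi pi e∈τ ei ek el
      ... | pi , _ , inj₂ (_ , xi) , inj₂ e′i = border x∈τ r∈τ xk rk (r≢x ∘ sym) xi pi e′∈τ e′i e′k e′l
      go : Result
      go with nonempty (swap-kl fr)
      ... | r , r∈τ , rk with search (λ x → ¬? (x ⟨ k ⟩ ℕP.≟ 0) ×-dec ¬? (r ≟P x)) τ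
      ... | inj₁ (x , x∈τ , xk , r≢x) = finish r∈τ x∈τ rk xk r≢x
      ... | inj₂ none = b₁ (k , r , r∈τ , proj₁ (const r r∈τ rk) ,
                             λ y y∈τ yk → sym (decidable-stable (r ≟P y) (λ r≢y → none y y∈τ (yk , r≢y))))

-- Edges in a coordinate plane

module FullyUnitEdges {τ : Polytope 4} (F : IsBFacet τ) where
  open Facet F
  open Classification F

  AllUnit : (k l : Fin 4) → Set
  AllUnit k l = ∀ r s → r ∈ τ → s ∈ τ → Independent k l r s →
                UnitPair (r ⟨ k ⟩) (s ⟨ k ⟩) ⊎ UnitPair (r ⟨ l ⟩) (s ⟨ l ⟩)

  allUnit-transpose : ∀ {k l} → AllUnit k l → AllUnit l k
  allUnit-transpose U r s r∈τ s∈τ ind = Sum.swap (U r s r∈τ s∈τ (ind ∘ sym))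

  -- Both l-entries are nonzero, so the unit vector is in k, where `s` vanishes.
  interior-unit : ∀ {k l w s} → AllUnit k l → w ∈ τ → s ∈ τ → w ⟨ k ⟩ ≢ 0 → w ⟨ l ⟩ ≢ 0 →
                  s ⟨ k ⟩ ≡ 0 → s ⟨ l ⟩ ≢ 0 → w ⟨ k ⟩ ≡ 1
  interior-unit {w = w} {s} U w∈τ s∈τ wk wl sk sl with U w s w∈τ s∈τ (independent-axis {x = w} {s} wk sl sk)
  ... | inj₁ u = unitPair-≢0ˡ sk u
  ... | inj₂ u = contradiction u (¬unitPair wl sl)

  axis-unit : ∀ {k l x p} → AllUnit k l → x ∈ τ → p ∈ τ → x ⟨ k ⟩ ≢ 0 → x ⟨ l ⟩ ≡ 0 →
              p ⟨ k ⟩ ≡ 0 → p ⟨ l ⟩ ≢ 0 → p ⟨ l ⟩ ≢ 1 → x ⟨ k ⟩ ≡ 1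
  axis-unit {x = x} {p} U x∈τ p∈τ xk xl pk pl pl≢1 with U x p x∈τ p∈τ (independent-axis {x = x} {p} xk pl pk)
  ... | inj₁ u = unitPair-≢0ˡ pk u
  ... | inj₂ (inj₁ (xl≡1 , _)) = ⊥-elim (0≢1 xl xl≡1)
  ... | inj₂ (inj₂ (_ , pl≡1)) = contradiction pl≡1 pl≢1

  -- Call a point interior if its k- and l-coordinates are nonzero. Two interior points never form a
  -- unit pair, so their projections are parallel. The point `s` makes their l-coordinates 1, and
  -- the projections coincide.
  one-axis : ∀ {i j k l e e′ w s} → Frame i j k l → Edge k l e e′ → AllUnit k l →
    w ∈ τ → w ⟨ k ⟩ ≢ 0 → w ⟨ l ⟩ ≢ 0 → s ∈ τ → s ⟨ k ⟩ ≢ 0 → s ⟨ l ⟩ ≡ 0 →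
    (∀ x → x ∈ τ → x ⟨ l ⟩ ≢ 0 → x ⟨ k ⟩ ≢ 0) → Result
  one-axis {k = k} {l} {w = w} {s} fr E U w∈τ wk wl s∈τ sk sl interior =
    constant-fibre (swap-kl fr) (edge-transpose E) const s∈τ sl sk (λ (wk≡0 , _) → wk wk≡0)
    where
    const : ∀ x → x ∈ τ → x ⟨ l ⟩ ≢ 0 → x ⟨ l ⟩ ≡ 1 × x ⟨ k ⟩ ≡ w ⟨ k ⟩
    const x x∈τ xl = xl≡1 , (begin
      x ⟨ k ⟩               ≡⟨ ℕP.*-identityʳ (x ⟨ k ⟩) ⟨
      x ⟨ k ⟩ ℕ.* 1         ≡⟨ cong (x ⟨ k ⟩ ℕ.*_) wl≡1 ⟨
      x ⟨ k ⟩ ℕ.* w ⟨ l ⟩   ≡⟨ parallel ⟩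
      x ⟨ l ⟩ ℕ.* w ⟨ k ⟩   ≡⟨ cong (ℕ._* w ⟨ k ⟩) xl≡1 ⟩
      1 ℕ.* w ⟨ k ⟩         ≡⟨ ℕP.*-identityˡ (w ⟨ k ⟩) ⟩
      w ⟨ k ⟩               ∎)
      where
      open ≡-Reasoning
      xk : x ⟨ k ⟩ ≢ 0
      xk = interior x x∈τ xl
      xl≡1 : x ⟨ l ⟩ ≡ 1
      xl≡1 = interior-unit (allUnit-transpose U) x∈τ s∈τ xl xk sl sk
      wl≡1 : w ⟨ l ⟩ ≡ 1
      wl≡1 = interior-unit (allUnit-transpose U) w∈τ s∈τ wl wk sl sk
      parallel : x ⟨ k ⟩ ℕ.* w ⟨ l ⟩ ≡ x ⟨ l ⟩ ℕ.* w ⟨ k ⟩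
      parallel = decidable-stable (_ ℕP.≟ _)
          (λ ind → [ ¬unitPair xk wk , ¬unitPair xl wl ] (U x w x∈τ w∈τ ind))

  -- The axis points force the projection (1 , 1) on every interior point. A single interior point
  -- is the apex of a flat border. Two of them would confine `s` and `s′` to x_i = x_j = 0 by
  -- `edge-fibre`, and the unit pair of `s` and `s′` would make one of these a standard basis vector
  -- below `w`.
  both-axes : ∀ {i j k l e e′ w s s′} → Frame i j k l → Edge k l e e′ → AllUnit k l →
    w ∈ τ → w ⟨ k ⟩ ≢ 0 → w ⟨ l ⟩ ≢ 0 → s ∈ τ → s ⟨ k ⟩ ≢ 0 → s ⟨ l ⟩ ≡ 0 → s′ ∈ τ → s′ ⟨ k ⟩ ≡ 0 →
        s′ ⟨ l ⟩ ≢ 0 → Result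
  both-axes {i} {j} {k} {l} {e} {e′} {w} {s} {s′} fr E U w∈τ wk wl s∈τ sk sl s′∈τ s′k s′l
    with search (λ x → ¬? (x ⟨ k ⟩ ℕP.≟ 0) ×-dec ¬? (x ⟨ l ⟩ ℕP.≟ 0) ×-dec ¬? (w ≟P x)) τ
  ... | inj₂ none = flat (k , l , w , Frame.k≢l fr , w∈τ , unit-k w∈τ wk wl , unit-l w∈τ wk wl ,
                          (e , e′ , e≢e′ , e∈τ , ek , el , e′∈τ , e′k , e′l) , others)
    where
    open Edge E
    unit-k : ∀ {x} → x ∈ τ → x ⟨ k ⟩ ≢ 0 → x ⟨ l ⟩ ≢ 0 → x ⟨ k ⟩ ≡ 1
    unit-k x∈τ xk xl = interior-unit U x∈τ s′∈τ xk xl s′k s′l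
    unit-l : ∀ {x} → x ∈ τ → x ⟨ k ⟩ ≢ 0 → x ⟨ l ⟩ ≢ 0 → x ⟨ l ⟩ ≡ 1
    unit-l x∈τ xk xl = interior-unit (allUnit-transpose U) x∈τ s∈τ xl xk sl sk
    others : ∀ x → x ∈ τ → x ≢ w → x ⟨ k ⟩ ≡ 0 ⊎ x ⟨ l ⟩ ≡ 0
    others x x∈τ x≢w with x ⟨ k ⟩ ℕP.≟ 0 | x ⟨ l ⟩ ℕP.≟ 0
    ... | yes xk | _ = inj₁ xk
    ... | no _ | yes xl = inj₂ xl
    ... | no xk | no xl = contradiction (xk , xl , x≢w ∘ sym) (none x x∈τ)
  ... | inj₁ (w′ , w′∈τ , w′k , w′l , w≢w′) = ⊥-elim (impossible
      (U s s′ s∈τ s′∈τ (independent-axis {x = s} {s′} sk s′l s′k)))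
    where
    unit-k : ∀ {x} → x ∈ τ → x ⟨ k ⟩ ≢ 0 → x ⟨ l ⟩ ≢ 0 → x ⟨ k ⟩ ≡ 1
    unit-k x∈τ xk xl = interior-unit U x∈τ s′∈τ xk xl s′k s′l
    unit-l : ∀ {x} → x ∈ τ → x ⟨ k ⟩ ≢ 0 → x ⟨ l ⟩ ≢ 0 → x ⟨ l ⟩ ≡ 1
    unit-l x∈τ xk xl = interior-unit (allUnit-transpose U) x∈τ s∈τ xl xk sl sk
    on-plane : ∀ {p} → p ∈ τ → Independent k l w p → p ⟨ i ⟩ ≡ 0 × p ⟨ j ⟩ ≡ 0
    on-plane p∈τ ind with edge-fibre fr E w∈τ w′∈τ p∈τ w≢w′
      (trans (unit-k w∈τ wk wl) (sym (unit-k w′∈τ w′k w′l)))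
          (trans (unit-l w∈τ wk wl) (sym (unit-l w′∈τ w′k w′l)))
      ind (wk ∘ proj₁) (wl ∘ proj₁)
    ... | pi , pj , _ = pi , pj
    s-plane : s ⟨ i ⟩ ≡ 0 × s ⟨ j ⟩ ≡ 0
    s-plane = on-plane s∈τ (independent-swap {x = s} {w} (λ eq → independent-axis {i = l} {k} {w} {s} wl sk sl
                (sym (trans (ℕP.*-comm (w ⟨ k ⟩) (s ⟨ l ⟩))
                    (trans (sym eq) (ℕP.*-comm (s ⟨ k ⟩) (w ⟨ l ⟩)))))))
    s′-plane : s′ ⟨ i ⟩ ≡ 0 × s′ ⟨ j ⟩ ≡ 0
    s′-plane = on-plane s′∈τ (independent-axis {x = w} {s′} wk s′l s′k)
    impossible : UnitPair (s ⟨ k ⟩) (s′ ⟨ k ⟩) ⊎ UnitPair (s ⟨ l ⟩) (s′ ⟨ l ⟩) → ⊥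
    impossible (inj₁ u) = wl (trans
        (cong (_⟨ l ⟩) (sym (dominated fr s∈τ w∈τ (0≡⇒≤ (proj₁ s-plane)) (0≡⇒≤ (proj₂ s-plane))
      (1≡⇒≤ (unitPair-≢0ˡ s′k u) wk) (0≡⇒≤ sl)))) sl)
    impossible (inj₂ u) = wk (trans
        (cong (_⟨ k ⟩) (sym (dominated fr s′∈τ w∈τ (0≡⇒≤ (proj₁ s′-plane)) (0≡⇒≤ (proj₂ s′-plane))
      (0≡⇒≤ s′k) (1≡⇒≤ (unitPair-≢0ˡ sl (unitPair-swap u)) wl)))) s′k)

  -- Otherwise the (k , l)-projection of τ would lie on a line through the origin.
  some-axis : ∀ {i j k l w} → Frame i j k l → AllUnit k l → w ∈ τ → w ⟨ k ⟩ ≢ 0 → w ⟨ l ⟩ ≢ 0 →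
    ∃[ s ] (s ∈ τ × (s ⟨ k ⟩ ≢ 0 × s ⟨ l ⟩ ≡ 0 ⊎ s ⟨ k ⟩ ≡ 0 × s ⟨ l ⟩ ≢ 0))
  some-axis {i} {j} {k} {l} {w} fr U w∈τ wk wl
    with spread {l} {l} {k} {i} i≢l i≢l i≢k k≢l k≢l (ℤ.- + (w ⟨ k ⟩)) 0ℤ {+ (w ⟨ l ⟩)} (wl ∘ ℤP.+-injective)
        0ℤ
    where open Frame fr
  ... | y , y∈τ , ≢0 = y , y∈τ , classify
    where
    y-w-ind : Independent k l y w
    y-w-ind eq = ≢0 (begin
      ℤ.- + (w ⟨ k ⟩) ℤ.* + (y ⟨ l ⟩) ℤ.+ 0ℤ ℤ.* + (y ⟨ l ⟩) ℤ.+ + (w ⟨ l ⟩) ℤ.* + (y ⟨ k ⟩)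
        ≡⟨ rearrange (+ (w ⟨ k ⟩)) (+ (y ⟨ l ⟩)) (+ (w ⟨ l ⟩)) (+ (y ⟨ k ⟩)) ⟩
      + (y ⟨ k ⟩) ℤ.* + (w ⟨ l ⟩) ℤ.- + (y ⟨ l ⟩) ℤ.* + (w ⟨ k ⟩)
        ≡⟨ cong₂ ℤ._-_ (ℤP.pos-* (y ⟨ k ⟩) (w ⟨ l ⟩)) (ℤP.pos-* (y ⟨ l ⟩) (w ⟨ k ⟩)) ⟨
      + (y ⟨ k ⟩ ℕ.* w ⟨ l ⟩) ℤ.- + (y ⟨ l ⟩ ℕ.* w ⟨ k ⟩)
        ≡⟨ ℤP.i≡j⇒i-j≡0 (cong +_ eq) ⟩
      0ℤ ∎)
      where
      open ≡-Reasoning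
      rearrange : ∀ a b c d → ℤ.- a ℤ.* b ℤ.+ 0ℤ ℤ.* b ℤ.+ c ℤ.* d ≡ d ℤ.* c ℤ.- b ℤ.* a
      rearrange = solve 4 (λ a b c d → :- a :* b :+ con 0ℤ :* b :+ c :* d := d :* c :- b :* a) refl
        where open ℤSolver.+-*-Solver
    classify : y ⟨ k ⟩ ≢ 0 × y ⟨ l ⟩ ≡ 0 ⊎ y ⟨ k ⟩ ≡ 0 × y ⟨ l ⟩ ≢ 0
    classify with y ⟨ k ⟩ ℕP.≟ 0 | y ⟨ l ⟩ ℕP.≟ 0
    ... | no yk  | yes yl = inj₁ (yk , yl)
    ... | yes yk | no yl  = inj₂ (yk , yl)
    ... | yes yk | yes yl = contradiction (trans (cong (ℕ._* w ⟨ l ⟩) yk) (sym (cong (ℕ._* w ⟨ k ⟩) yl)))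
        y-w-ind
    ... | no yk  | no yl  = ⊥-elim ([ ¬unitPair yk wk , ¬unitPair yl wl ] (U y w y∈τ w∈τ y-w-ind))

  with-interior : ∀ {i j k l e e′ w} → Frame i j k l → Edge k l e e′ → AllUnit k l →
    w ∈ τ → w ⟨ k ⟩ ≢ 0 → w ⟨ l ⟩ ≢ 0 → Result
  with-interior {k = k} {l} fr E U w∈τ wk wl with some-axis fr U w∈τ wk wl
  ... | s , s∈τ , inj₁ (sk , sl) with search (λ x → (x ⟨ k ⟩ ℕP.≟ 0) ×-dec ¬? (x ⟨ l ⟩ ℕP.≟ 0)) τ
  ... | inj₁ (s′ , s′∈τ , s′k , s′l) = both-axes fr E U w∈τ wk wl s∈τ sk sl s′∈τ s′k s′l
  ... | inj₂ none = one-axis fr E U w∈τ wk wl s∈τ sk sl (λ x x∈τ xl xk → none x x∈τ (xk , xl))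
  with-interior {k = k} {l} fr E U w∈τ wk wl | s , s∈τ , inj₂ (sk , sl)
    with search (λ x → (x ⟨ l ⟩ ℕP.≟ 0) ×-dec ¬? (x ⟨ k ⟩ ℕP.≟ 0)) τ
  ... | inj₁ (s′ , s′∈τ , s′l , s′k) = both-axes fr E U w∈τ wk wl s′∈τ s′k s′l s∈τ sk sl
  ... | inj₂ none = one-axis (swap-kl fr) (edge-transpose E) (allUnit-transpose U) w∈τ wl wk s∈τ sl sk
                      (λ x x∈τ xk xl → none x x∈τ (xl , xk))

  -- A value of at least 2 on the l-axis rules out a unit pair in l, so every point on the k-axis
  -- has value 1 there. As no point is interior, the fibre is constant.
  large-value : ∀ {i j k l e e′ p} → Frame i j k l → Edge k l e e′ → AllUnit k l →
    (∀ x → x ∈ τ → ¬ (x ⟨ k ⟩ ≢ 0 × x ⟨ l ⟩ ≢ 0)) → p ∈ τ → p ⟨ l ⟩ ≢ 0 → p ⟨ l ⟩ ≢ 1 → Result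
  large-value {k = k} {l} {p = p} fr E U empty p∈τ pl pl≢1 =
    constant-fibre fr E const p∈τ pk pl (pl≢1 ∘ proj₂)
    where
    pk : p ⟨ k ⟩ ≡ 0
    pk = decidable-stable (_ ℕP.≟ 0) (λ pk → empty p p∈τ (pk , pl))
    const : ∀ x → x ∈ τ → x ⟨ k ⟩ ≢ 0 → x ⟨ k ⟩ ≡ 1 × x ⟨ l ⟩ ≡ 0
    const x x∈τ xk = axis-unit U x∈τ p∈τ xk xl pk pl pl≢1 , xl
      where
      xl : x ⟨ l ⟩ ≡ 0
      xl = decidable-stable (_ ℕP.≟ 0) (λ xl → empty x x∈τ (xk , xl))

  all-unit : ∀ {i j k l e e′} → Frame i j k l → Edge k l e e′ → AllUnit k l → Result
  all-unit {k = k} {l} fr E U with search (λ x → ¬? (x ⟨ k ⟩ ℕP.≟ 0) ×-dec ¬? (x ⟨ l ⟩ ℕP.≟ 0)) τ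
  ... | inj₁ (w , w∈τ , wk , wl) = with-interior fr E U w∈τ wk wl
  ... | inj₂ empty with search (λ x → ¬? (x ⟨ l ⟩ ℕP.≟ 0) ×-dec ¬? (x ⟨ l ⟩ ℕP.≟ 1)) τ
  ... | inj₁ (p , p∈τ , pl , pl≢1) = large-value fr E U empty p∈τ pl pl≢1
  ... | inj₂ small-l with search (λ x → ¬? (x ⟨ k ⟩ ℕP.≟ 0) ×-dec ¬? (x ⟨ k ⟩ ℕP.≟ 1)) τ
  ... | inj₁ (p , p∈τ , pk , pk≢1) = large-value (swap-kl fr) (edge-transpose E) (allUnit-transpose U)
                                       (λ x x∈τ (xl , xk) → empty x x∈τ (xk , xl)) p∈τ pk pk≢1
  ... | inj₂ small-k = b₂ (k , l , Frame.k≢l fr , values)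
    where
    values : ∀ x → x ∈ τ → (x ⟨ k ⟩ , x ⟨ l ⟩) ∈ (0 , 0) ∷ (1 , 0) ∷ (0 , 1) ∷ []
    values x x∈τ with x ⟨ k ⟩ | x ⟨ l ⟩ | empty x x∈τ | small-k x x∈τ | small-l x x∈τ
    ... | 0 | 0 | _ | _ | _ = here refl
    ... | 1 | 0 | _ | _ | _ = there (here refl)
    ... | 0 | 1 | _ | _ | _ = there (there (here refl))
    ... | 0 | suc (suc _) | _ | _ | h = contradiction ((λ ()) , (λ ())) h
    ... | suc (suc _) | _ | _ | h | _ = contradiction ((λ ()) , (λ ())) h
    ... | 1 | suc _ | h | _ | _ = contradiction ((λ ()) , (λ ())) h

-- Edges with a pair that violates the unit condition

cross-zero : ∀ a b c c′ d d′ → (+ a ℤ.- 0ℤ) ℤ.* (+ c′ ℤ.- + c) ℤ.- (+ b ℤ.- 0ℤ) ℤ.* (+ d′ ℤ.- + d) ≡ 0ℤ →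
             a ℕ.* c′ ℕ.+ b ℕ.* d ≡ a ℕ.* c ℕ.+ b ℕ.* d′
cross-zero a b c c′ d d′ eq = ℤP.+-injective (ℤP.i-j≡0⇒i≡j _ _ (begin
  + (a ℕ.* c′ ℕ.+ b ℕ.* d) ℤ.- + (a ℕ.* c ℕ.+ b ℕ.* d′)
    ≡⟨ cong₂ ℤ._-_ (expand a c′ b d) (expand a c b d′) ⟩
  (+ a ℤ.* + c′ ℤ.+ + b ℤ.* + d) ℤ.- (+ a ℤ.* + c ℤ.+ + b ℤ.* + d′)
    ≡⟨ rearrange (+ a) (+ b) (+ c) (+ c′) (+ d) (+ d′) ⟩
  (+ a ℤ.- 0ℤ) ℤ.* (+ c′ ℤ.- + c) ℤ.- (+ b ℤ.- 0ℤ) ℤ.* (+ d′ ℤ.- + d)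
    ≡⟨ eq ⟩
  0ℤ ∎))
  where
  open ≡-Reasoning
  expand : ∀ m n p q → + (m ℕ.* n ℕ.+ p ℕ.* q) ≡ + m ℤ.* + n ℤ.+ + p ℤ.* + q
  expand m n p q = trans (ℤP.pos-+ (m ℕ.* n) (p ℕ.* q)) (cong₂ ℤ._+_ (ℤP.pos-* m n) (ℤP.pos-* p q))
  rearrange : ∀ a b c c′ d d′ → (a ℤ.* c′ ℤ.+ b ℤ.* d) ℤ.- (a ℤ.* c ℤ.+ b ℤ.* d′) ≡
              (a ℤ.- 0ℤ) ℤ.* (c′ ℤ.- c) ℤ.- (b ℤ.- 0ℤ) ℤ.* (d′ ℤ.- d)
  rearrange = solve 6 (λ a b c c′ d d′ → (a :* c′ :+ b :* d) :- (a :* c :+ b :* d′) :=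
              (a :- con 0ℤ) :* (c′ :- c) :- (b :- con 0ℤ) :* (d′ :- d)) refl
    where open ℤSolver.+-*-Solver

*-cancelˡ-≢0 : ∀ a {b c} → a ≢ 0 → a ℕ.* b ≡ a ℕ.* c → b ≡ c
*-cancelˡ-≢0 a a≢0 eq = ℕP.*-cancelˡ-≡ _ _ a {{ℕ.≢-nonZero a≢0}} eq

unitColumn-≢0 : ∀ {a b c d} → a ≢ 0 → UnitColumn a b c d → a ≡ 1 × b ≡ 0 × c ≡ 0 × d ≡ 0
unitColumn-≢0 a≢0 (unit₁ a b c d) = a , b , c , d
unitColumn-≢0 a≢0 (unit₂ a b c d) = contradiction a a≢0
unitColumn-≢0 a≢0 (unit₃ a b c d) = contradiction a a≢0
unitColumn-≢0 a≢0 (unit₄ a b c d) = contradiction a a≢0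

module Edges {τ : Polytope 4} (F : IsBFacet τ) where
  open Facet F
  open Classification F
  open FullyUnitEdges F

  record NonUnit (k l : Fin 4) (h h′ : Point 4) : Set where
    field
      h∈τ  : h ∈ τ
      h′∈τ : h′ ∈ τ
      ind  : Independent k l h h′
      ¬uk  : ¬ UnitPair (h ⟨ k ⟩) (h′ ⟨ k ⟩)
      ¬ul  : ¬ UnitPair (h ⟨ l ⟩) (h′ ⟨ l ⟩)

  nonUnit-flip : ∀ {k l h h′} → NonUnit k l h h′ → NonUnit k l h′ h
  nonUnit-flip {h = h} {h′} N = record { h∈τ = h′∈τ ; h′∈τ = h∈τ ; ind = independent-swap {x = h} {h′} ind
      ; ¬uk = ¬uk ∘ unitPair-swap ; ¬ul = ¬ul ∘ unitPair-swap }
    where open NonUnit N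

  nonUnit-transpose : ∀ {k l h h′} → NonUnit k l h h′ → NonUnit l k h h′
  nonUnit-transpose N = record { h∈τ = h∈τ ; h′∈τ = h′∈τ ; ind = ind ∘ sym ; ¬uk = ¬ul ; ¬ul = ¬uk }
    where open NonUnit N

  opaque
    find-nonUnit : ∀ {i j k l e e′} → Frame i j k l → Edge k l e e′ → Result ⊎ ∃[ h ] ∃[ h′ ] NonUnit k l h h′
    find-nonUnit {k = k} {l} fr E
      with any? (λ r → any? (λ s → independent? k l r s ×-dec
          ¬? (unitPair? (r ⟨ k ⟩) (s ⟨ k ⟩) ⊎-dec unitPair? (r ⟨ l ⟩) (s ⟨ l ⟩))) τ) τ
    ... | no none = inj₁ (all-unit fr E (λ r s r∈τ s∈τ ind →
                      decidable-stable (unitPair? _ _ ⊎-dec unitPair? _ _)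
                          (λ ¬u → none (lose r∈τ (lose s∈τ (ind , ¬u))))))
    ... | yes some with find some
    ... | h , h∈τ , some′ with find some′
    ... | h′ , h′∈τ , ind , ¬u =
      inj₂ (h , h′ , record { h∈τ = h∈τ ; h′∈τ = h′∈τ ; ind = ind ; ¬uk = ¬u ∘ inj₁ ; ¬ul = ¬u ∘ inj₂ })

    -- A violating pair leaves only i and j for the unit vector, and there its 1 is at an end of the
    -- edge.
    edge-unit : ∀ {i j k l e e′} → Frame i j k l → Edge k l e e′ →
                Result ⊎ UnitPair (e ⟨ i ⟩) (e′ ⟨ i ⟩) ⊎ UnitPair (e ⟨ j ⟩) (e′ ⟨ j ⟩)
    edge-unit fr E with find-nonUnit fr E
    ... | inj₁ result = inj₁ result
    ... | inj₂ (h , h′ , N) with edge-quad fr E h∈τ h′∈τ ind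
      where open NonUnit N
    ... | inj₁ (u , _) = inj₂ (inj₁ u)
    ... | inj₂ (inj₁ (u , _)) = inj₂ (inj₂ u)
    ... | inj₂ (inj₂ (inj₁ u)) = contradiction u (NonUnit.¬uk N)
    ... | inj₂ (inj₂ (inj₂ u)) = contradiction u (NonUnit.¬ul N)

  -- The point `f` is what prevents `τ` from being a B₁-facet with apex `e`.
  record Corner (i j k l : Fin 4) (e e′ f : Point 4) : Set where
    field
      fr  : Frame i j k l
      E   : Edge k l e e′
      ei  : e ⟨ i ⟩ ≡ 1
      e′i : e′ ⟨ i ⟩ ≡ 0
      f∈τ : f ∈ τ
      fi≢0 : f ⟨ i ⟩ ≢ 0
      f≢e : f ≢ e
    open Edge E public

    opaque
      ej<e′j : e ⟨ j ⟩ ℕ.< e′ ⟨ j ⟩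
      ej<e′j with opposite fr e∈τ e′∈τ e≢e′ (trans ek (sym e′k)) (trans el (sym e′l))
      ... | inj₁ (lt , _) = contradiction e′i (<⇒≢0 lt)
      ... | inj₂ (_ , lt) = lt

      -- Otherwise `e` would be a standard basis vector below `f`. With `ej<e′j` it follows that
      -- `e′` is at least 2 in j, so no simplex with vertex `e′` has its unit vector there.
      ej≢0 : e ⟨ j ⟩ ≢ 0
      ej≢0 ej = f≢e (sym (dominated fr e∈τ f∈τ (1≡⇒≤ ei fi≢0) (0≡⇒≤ ej) (0≡⇒≤ ek) (0≡⇒≤ el)))

    e′j≢0 : e′ ⟨ j ⟩ ≢ 0
    e′j≢0 = <⇒≢0 ej<e′j

    e′j≢1 : e′ ⟨ j ⟩ ≢ 1
    e′j≢1 e′j = ej≢0 (ℕP.n<1⇒n≡0 (subst (e ⟨ j ⟩ ℕ.<_) e′j ej<e′j))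

    opaque
      star : ∀ {r s} → r ∈ τ → s ∈ τ → Independent k l r s →
        (r ⟨ i ⟩ ≡ 0 × s ⟨ i ⟩ ≡ 0) ⊎ UnitPair (r ⟨ k ⟩) (s ⟨ k ⟩) ⊎ UnitPair (r ⟨ l ⟩) (s ⟨ l ⟩)
      star r∈τ s∈τ ind with edge-quad fr E r∈τ s∈τ ind
      ... | inj₁ (_ , z) = inj₁ z
      ... | inj₂ (inj₁ (inj₁ (_ , e′j) , _)) = contradiction e′j e′j≢0
      ... | inj₂ (inj₁ (inj₂ (_ , e′j) , _)) = contradiction e′j e′j≢1
      ... | inj₂ (inj₂ u) = inj₂ u

    opaque
      star-f : ∀ {h} → h ∈ τ → ¬ UnitPair (f ⟨ k ⟩) (h ⟨ k ⟩) → ¬ UnitPair (f ⟨ l ⟩) (h ⟨ l ⟩) →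
               f ⟨ k ⟩ ℕ.* h ⟨ l ⟩ ≡ f ⟨ l ⟩ ℕ.* h ⟨ k ⟩
      star-f h∈τ ¬k ¬l = decidable-stable (_ ℕP.≟ _) λ ind →
        [ fi≢0 ∘ proj₁ , [ ¬k , ¬l ] ] (star f∈τ h∈τ ind)

    opaque
      nonUnit-zero : ∀ {h h′} → NonUnit k l h h′ → h ⟨ i ⟩ ≡ 0 × h′ ⟨ i ⟩ ≡ 0
      nonUnit-zero N with star h∈τ h′∈τ ind
        where open NonUnit N
      ... | inj₁ z = z
      ... | inj₂ (inj₁ u) = contradiction u (NonUnit.¬uk N)
      ... | inj₂ (inj₂ u) = contradiction u (NonUnit.¬ul N)

    opaque
      -- The first three vertices of `e′ h h′ f` lie in x_i = 0. A unit vector in j is excluded by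
      -- `e′`. In k or l its 1 would be at `h` or `h′`, which form no unit pair, or at `f`, which
      -- makes `h` and `h′` dependent. So it is in i.
      fi≡1 : ∀ {h h′} → NonUnit k l h h′ → f ⟨ i ⟩ ≡ 1
      fi≡1 {h} {h′} N = [ column-i , ⊥-elim ∘ [ column-j , [ column-k ,
          column-l ] ] ] (unit-column′ fr i k l e′∈τ h∈τ h′∈τ f∈τ vol≢0)
        where
        open NonUnit N
        hi : h ⟨ i ⟩ ≡ 0
        hi = proj₁ (nonUnit-zero N)
        h′i : h′ ⟨ i ⟩ ≡ 0
        h′i = proj₂ (nonUnit-zero N)
        vol≢0 : vol i k l e′ h h′ f ≢ 0ℤ
        vol≢0 = subst (_≢ 0ℤ) (sym (vol-apex i k l e′ h h′ f e′i hi h′i))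
                  (ℤ-*≢0 (fi≢0 ∘ ℤP.+-injective) (area-origin-≢0 k l e′ h h′ e′k e′l ind))
        column-i : UnitColumn (e′ ⟨ i ⟩) (h ⟨ i ⟩) (h′ ⟨ i ⟩) (f ⟨ i ⟩) → f ⟨ i ⟩ ≡ 1
        column-i (unit₁ a b c d) = ⊥-elim (0≢1 e′i a)
        column-i (unit₂ a b c d) = ⊥-elim (0≢1 hi b)
        column-i (unit₃ a b c d) = ⊥-elim (0≢1 h′i c)
        column-i (unit₄ a b c d) = d
        column-j : ¬ UnitColumn (e′ ⟨ j ⟩) (h ⟨ j ⟩) (h′ ⟨ j ⟩) (f ⟨ j ⟩)
        column-j u = e′j≢1 (proj₁ (unitColumn-≢0 e′j≢0 u))
        column-k : ¬ UnitColumn (e′ ⟨ k ⟩) (h ⟨ k ⟩) (h′ ⟨ k ⟩) (f ⟨ k ⟩)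
        column-k (unit₁ a b c d) = 0≢1 e′k a
        column-k (unit₂ a b c d) = ¬uk (inj₁ (b , c))
        column-k (unit₃ a b c d) = ¬uk (inj₂ (b , c))
        column-k (unit₄ a b c d) = ind
            (trans (cong (ℕ._* h′ ⟨ l ⟩) b) (sym (trans (cong (h ⟨ l ⟩ ℕ.*_) c) (ℕP.*-zeroʳ (h ⟨ l ⟩)))))
        column-l : ¬ UnitColumn (e′ ⟨ l ⟩) (h ⟨ l ⟩) (h′ ⟨ l ⟩) (f ⟨ l ⟩)
        column-l (unit₁ a b c d) = 0≢1 e′l a
        column-l (unit₂ a b c d) = ¬ul (inj₁ (b , c))
        column-l (unit₃ a b c d) = ¬ul (inj₂ (b , c))
        column-l (unit₄ a b c d) = ind
            (trans (cong (h ⟨ k ⟩ ℕ.*_) c) (trans (ℕP.*-zeroʳ (h ⟨ k ⟩)) (sym (cong (ℕ._* h′ ⟨ k ⟩) b))))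

    Degenerate : Point 4 → Point 4 → Set
    Degenerate h h′ = e ⟨ j ⟩ ≡ 1 × f ⟨ j ⟩ ≡ 0 × h ⟨ j ⟩ ≡ 0 × h′ ⟨ j ⟩ ≡ 0

    -- f − e and h − h′ have parallel (k , l)-projections; both sides moved so that no subtraction occurs.
    Parallel : Point 4 → Point 4 → Set
    Parallel h h′ = f ⟨ k ⟩ ℕ.* h′ ⟨ l ⟩ ℕ.+ f ⟨ l ⟩ ℕ.* h ⟨ k ⟩ ≡ f ⟨ k ⟩ ℕ.* h ⟨ l ⟩ ℕ.+
        f ⟨ l ⟩ ℕ.* h′ ⟨ k ⟩

    opaque
      -- The edges `e f` and `h h′` lie at heights 1 and 0 over i. If their projections are not
      -- parallel, the simplex has a unit vector, only j is possible, and the nonzero j-entry of `e`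
      -- must be its 1.
      edges : ∀ {h h′} → NonUnit k l h h′ → Degenerate h h′ ⊎ Parallel h h′
      edges {h} {h′} N = decide (vol i k l e f h h′ ℤP.≟ 0ℤ)
        where
        open NonUnit N
        column-i : ¬ UnitColumn (e ⟨ i ⟩) (f ⟨ i ⟩) (h ⟨ i ⟩) (h′ ⟨ i ⟩)
        column-i (unit₁ a b c d) = fi≢0 b
        column-i (unit₂ a b c d) = 0≢1 a ei
        column-i (unit₃ a b c d) = fi≢0 b
        column-i (unit₄ a b c d) = fi≢0 b
        column-k : ¬ UnitColumn (e ⟨ k ⟩) (f ⟨ k ⟩) (h ⟨ k ⟩) (h′ ⟨ k ⟩)
        column-k (unit₁ a b c d) = 0≢1 ek a
        column-k (unit₂ a b c d) = ind
            (trans (cong (ℕ._* h′ ⟨ l ⟩) c) (sym (trans (cong (h ⟨ l ⟩ ℕ.*_) d) (ℕP.*-zeroʳ (h ⟨ l ⟩)))))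
        column-k (unit₃ a b c d) = ¬uk (inj₁ (c , d))
        column-k (unit₄ a b c d) = ¬uk (inj₂ (c , d))
        column-l : ¬ UnitColumn (e ⟨ l ⟩) (f ⟨ l ⟩) (h ⟨ l ⟩) (h′ ⟨ l ⟩)
        column-l (unit₁ a b c d) = 0≢1 el a
        column-l (unit₂ a b c d) = ind
            (trans (cong (h ⟨ k ⟩ ℕ.*_) d) (trans (ℕP.*-zeroʳ (h ⟨ k ⟩)) (sym (cong (ℕ._* h′ ⟨ k ⟩) c))))
        column-l (unit₃ a b c d) = ¬ul (inj₁ (c , d))
        column-l (unit₄ a b c d) = ¬ul (inj₂ (c , d))
        decide : Dec (vol i k l e f h h′ ≡ 0ℤ) → Degenerate h h′ ⊎ Parallel h h′
        decide (no vol≢0) = inj₁ ([ ⊥-elim ∘ column-i , [ unitColumn-≢0 ej≢0 , ⊥-elim ∘ [ column-k ,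
            column-l ] ] ]
                              (unit-column′ fr i k l e∈τ f∈τ h∈τ h′∈τ vol≢0))
        decide (yes vol≡0) = inj₂ (cross-zero (f ⟨ k ⟩) (f ⟨ l ⟩) (h ⟨ l ⟩) (h′ ⟨ l ⟩) (h ⟨ k ⟩) (h′ ⟨ k ⟩)
          (trans (sym (trans (vol-edges i k l e f h h′ ei (fi≡1 N) (proj₁ (nonUnit-zero N))
              (proj₂ (nonUnit-zero N)))
            (cong₂ (λ a b → (+ (f ⟨ k ⟩) ℤ.- + a) ℤ.* Δ h h′ l ℤ.- (+ (f ⟨ l ⟩) ℤ.- + b) ℤ.* Δ h h′ k) ek
                el))) vol≡0))

    opaque
      off-Q : f ⟨ i ⟩ ≡ 1 → f ⟨ k ⟩ ≡ 0 → f ⟨ l ⟩ ≢ 0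
      off-Q fi fk fl = f≢e (agree (swap-ij fr) f∈τ e∈τ (trans fi (sym ei)) (trans fk (sym ek))
          (trans fl (sym el)))

    opaque
      -- The direction of `f` has positive slope, so `h′` exceeds `h` in l too. Hence `h′` is
      -- interior and parallel to `f` by `star-f`. Since h′ - h is also parallel to `f`, so is `h`,
      -- against independence.
      not-interior-< : ∀ {h h′} → NonUnit k l h h′ → Parallel h h′ → f ⟨ k ⟩ ≢ 0 → f ⟨ l ⟩ ≢ 0 →
          ¬ h ⟨ k ⟩ ℕ.< h′ ⟨ k ⟩
      not-interior-< {h} {h′} N par fk fl hk<h′k = NonUnit.ind N (*-cancelˡ-≢0 (f ⟨ k ⟩) fk (begin
        f ⟨ k ⟩ ℕ.* (h ⟨ k ⟩ ℕ.* h′ ⟨ l ⟩)   ≡⟨ x∙yz≈y∙xz (f ⟨ k ⟩) (h ⟨ k ⟩) (h′ ⟨ l ⟩) ⟩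
        h ⟨ k ⟩ ℕ.* (f ⟨ k ⟩ ℕ.* h′ ⟨ l ⟩)   ≡⟨ cong (h ⟨ k ⟩ ℕ.*_) f∥h′ ⟩
        h ⟨ k ⟩ ℕ.* (f ⟨ l ⟩ ℕ.* h′ ⟨ k ⟩)   ≡⟨ x∙yz≈yx∙z (h ⟨ k ⟩) (f ⟨ l ⟩) (h′ ⟨ k ⟩) ⟩
        f ⟨ l ⟩ ℕ.* h ⟨ k ⟩ ℕ.* h′ ⟨ k ⟩     ≡⟨ cong (ℕ._* h′ ⟨ k ⟩) f∥h ⟩
        f ⟨ k ⟩ ℕ.* h ⟨ l ⟩ ℕ.* h′ ⟨ k ⟩     ≡⟨ ℕP.*-assoc (f ⟨ k ⟩) (h ⟨ l ⟩) (h′ ⟨ k ⟩) ⟩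
        f ⟨ k ⟩ ℕ.* (h ⟨ l ⟩ ℕ.* h′ ⟨ k ⟩)   ∎))
        where
        open ≡-Reasoning
        hl<h′l : h ⟨ l ⟩ ℕ.< h′ ⟨ l ⟩
        hl<h′l = ℕP.≰⇒> λ h′l≤hl → ℕP.<-irrefl par
          (ℕP.+-mono-≤-< (ℕP.*-monoʳ-≤ (f ⟨ k ⟩) h′l≤hl) (ℕP.*-monoʳ-< (f ⟨ l ⟩) {{ℕ.≢-nonZero fl}} hk<h′k))
        f∥h′ : f ⟨ k ⟩ ℕ.* h′ ⟨ l ⟩ ≡ f ⟨ l ⟩ ℕ.* h′ ⟨ k ⟩
        f∥h′ = star-f (NonUnit.h′∈τ N) (¬unitPair fk (<⇒≢0 hk<h′k)) (¬unitPair fl (<⇒≢0 hl<h′l))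
        f∥h : f ⟨ l ⟩ ℕ.* h ⟨ k ⟩ ≡ f ⟨ k ⟩ ℕ.* h ⟨ l ⟩
        f∥h = ℕP.+-cancelˡ-≡ (f ⟨ k ⟩ ℕ.* h′ ⟨ l ⟩) _ _
          (trans par (trans (cong (f ⟨ k ⟩ ℕ.* h ⟨ l ⟩ ℕ.+_) (sym f∥h′)) (ℕP.+-comm (f ⟨ k ⟩ ℕ.* h ⟨ l ⟩) _)))

    opaque
      not-interior : ∀ {h h′} → NonUnit k l h h′ → Parallel h h′ → f ⟨ k ⟩ ≢ 0 → f ⟨ l ⟩ ≢ 0 → ⊥
      not-interior {h} {h′} N par fk fl with ℕP.<-cmp (h ⟨ k ⟩) (h′ ⟨ k ⟩)
      ... | tri≈ _ hk≡h′k _ = NonUnit.ind N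
          (trans (cong₂ ℕ._*_ hk≡h′k (sym hl≡h′l)) (ℕP.*-comm (h′ ⟨ k ⟩) (h ⟨ l ⟩)))
        where
        hl≡h′l : h ⟨ l ⟩ ≡ h′ ⟨ l ⟩
        hl≡h′l = sym (*-cancelˡ-≢0 (f ⟨ k ⟩) fk (ℕP.+-cancelʳ-≡ (f ⟨ l ⟩ ℕ.* h ⟨ k ⟩) _ _
                   (trans par (cong (λ a → f ⟨ k ⟩ ℕ.* h ⟨ l ⟩ ℕ.+ f ⟨ l ⟩ ℕ.* a) (sym hk≡h′k)))))
      ... | tri< hk<h′k _ _ = not-interior-< N par fk fl hk<h′k
      ... | tri> _ _ h′k<hk = not-interior-< (nonUnit-flip N) (sym par) fk fl h′k<hk

    opaque
      -- Parallelism to the k-axis gives `h` and `h′` a common l-coordinate, nonzero by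
      -- independence. One of them is nonzero in k as well; with `f` it can form a unit pair only in
      -- l, so the common value is 1.
      on-axis : ∀ {h h′} → NonUnit k l h h′ → Parallel h h′ → f ⟨ k ⟩ ≢ 0 → f ⟨ l ⟩ ≡ 0 →
          h ⟨ l ⟩ ≡ 1 × h′ ⟨ l ⟩ ≡ 1
      on-axis {h} {h′} N par fk fl = hl≡1 , trans h′l≡hl hl≡1
        where
        open NonUnit N
        h′l≡hl : h′ ⟨ l ⟩ ≡ h ⟨ l ⟩
        h′l≡hl = *-cancelˡ-≢0 (f ⟨ k ⟩) fk (begin
          f ⟨ k ⟩ ℕ.* h′ ⟨ l ⟩                          ≡⟨ ℕP.+-identityʳ _ ⟨
          f ⟨ k ⟩ ℕ.* h′ ⟨ l ⟩ ℕ.+ 0                    ≡⟨ cong (λ a → f ⟨ k ⟩ ℕ.* h′ ⟨ l ⟩ ℕ.+ a ℕ.* h ⟨ k ⟩)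
              fl ⟨
          f ⟨ k ⟩ ℕ.* h′ ⟨ l ⟩ ℕ.+ f ⟨ l ⟩ ℕ.* h ⟨ k ⟩  ≡⟨ par ⟩
          f ⟨ k ⟩ ℕ.* h ⟨ l ⟩ ℕ.+ f ⟨ l ⟩ ℕ.* h′ ⟨ k ⟩  ≡⟨ cong (λ a → f ⟨ k ⟩ ℕ.* h ⟨ l ⟩ ℕ.+ a ℕ.* h′ ⟨ k ⟩)
              fl ⟩
          f ⟨ k ⟩ ℕ.* h ⟨ l ⟩ ℕ.+ 0                     ≡⟨ ℕP.+-identityʳ _ ⟩
          f ⟨ k ⟩ ℕ.* h ⟨ l ⟩                           ∎)
          where open ≡-Reasoning
        hl≢0 : h ⟨ l ⟩ ≢ 0
        hl≢0 hl = ind (trans (cong (h ⟨ k ⟩ ℕ.*_) (trans h′l≡hl hl))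
            (trans (ℕP.*-zeroʳ (h ⟨ k ⟩)) (sym (cong (ℕ._* h′ ⟨ k ⟩) hl))))
        unit : ∀ {g} → g ∈ τ → g ⟨ k ⟩ ≢ 0 → g ⟨ l ⟩ ≢ 0 → g ⟨ l ⟩ ≡ 1
        unit {g} g∈τ gk gl with star f∈τ g∈τ (λ eq → independent-axis {i = l} {k} {g} {f} gl fk fl
                                  (trans (ℕP.*-comm (g ⟨ l ⟩) (f ⟨ k ⟩))
                                      (trans eq (ℕP.*-comm (f ⟨ l ⟩) (g ⟨ k ⟩)))))
        ... | inj₁ (fi , _) = contradiction fi fi≢0
        ... | inj₂ (inj₁ u) = contradiction u (¬unitPair fk gk)
        ... | inj₂ (inj₂ u) = unitPair-≢0ˡ fl (unitPair-swap u)
        hl≡1 : h ⟨ l ⟩ ≡ 1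
        hl≡1 with h ⟨ k ⟩ ℕP.≟ 0
        ... | no hk = unit h∈τ hk hl≢0
        ... | yes hk = trans (sym h′l≡hl) (unit h′∈τ
                         (λ h′k → ind (trans (cong (ℕ._* h′ ⟨ l ⟩) hk)
                             (sym (trans (cong (h ⟨ l ⟩ ℕ.*_) h′k) (ℕP.*-zeroʳ (h ⟨ l ⟩))))))
                         (hl≢0 ∘ trans (sym h′l≡hl)))

  corner-transpose : ∀ {i j k l e e′ f} → Corner i j k l e e′ f → Corner i j l k e e′ f
  corner-transpose K = record { fr = swap-kl fr ; E = edge-transpose E ; ei = ei ; e′i = e′i ; f∈τ = f∈τ
      ; fi≢0 = fi≢0 ; f≢e = f≢e }
    where open Corner K

  opaque
    -- A second edge appears: `e′` and `h` lie in x_i = x_l = 0. They are no unit pair in j, where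
    -- `e′` is at least 2; a unit pair in k would give `h` and `h′` the k-coordinates 1 and 0. So
    -- `edge-unit` must return the result.
    degenerate-axis : ∀ {i j k l e e′ f h h′} (K : Corner i j k l e e′ f) → NonUnit k l h h′ →
        Corner.Degenerate K h h′ →
      h′ ⟨ k ⟩ ℕ.< h ⟨ k ⟩ → h ⟨ l ⟩ ≡ 0 → Result
    degenerate-axis {i} {j} {k} {l} {e} {e′} {f} {h} {h′} K N (ej , fj , hj , h′j) h′k<hk hl =
        conclude (edge-unit (swap-jk (swap-ij fr)) E′)
      where
      open Corner K
      open NonUnit N
      E′ : Edge i l e′ h
      E′ = record { e∈τ = e′∈τ ; e′∈τ = h∈τ ; e≢e′ = λ eq → <⇒≢0 h′k<hk (trans (cong (_⟨ k ⟩) (sym eq)) e′k)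
                  ; ek = e′i ; el = e′l ; e′k = proj₁ (nonUnit-zero N) ; e′l = hl }
      conclude : Result ⊎ UnitPair (e′ ⟨ j ⟩) (h ⟨ j ⟩) ⊎ UnitPair (e′ ⟨ k ⟩) (h ⟨ k ⟩) → Result
      conclude (inj₁ result) = result
      conclude (inj₂ (inj₁ u)) = contradiction (unitPair-≢0ˡ hj u) e′j≢1
      conclude (inj₂ (inj₂ u)) = contradiction (inj₁ (hk≡1 , ℕP.n<1⇒n≡0 (subst (h′ ⟨ k ⟩ ℕ.<_) hk≡1 h′k<hk)))
          ¬uk
        where
        hk≡1 : h ⟨ k ⟩ ≡ 1
        hk≡1 = unitPair-≢0ˡ e′k (unitPair-swap u)

  opaque
    -- If the four coordinates of `h` and `h′` in k and l are positive, `star-f` refutes every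
    -- position of `f`. On an axis, `f` would be parallel to an interior vector. In the interior it
    -- would be parallel to both `h` and `h′`, which are ordered oppositely in k and l.
    degenerate-ordered : ∀ {i j k l e e′ f h h′} (K : Corner i j k l e e′ f) → NonUnit k l h h′ →
        Corner.Degenerate K h h′ →
      h′ ⟨ k ⟩ ℕ.< h ⟨ k ⟩ → h ⟨ l ⟩ ℕ.< h′ ⟨ l ⟩ → Result
    degenerate-ordered {i} {j} {k} {l} {e} {e′} {f} {h} {h′} K N D@(ej , fj , hj , h′j) h′k<hk hl<h′l
      with h ⟨ l ⟩ ℕP.≟ 0 | h′ ⟨ k ⟩ ℕP.≟ 0
    ... | yes hl | _ = degenerate-axis K N D h′k<hk hl
    ... | no _ | yes h′k = degenerate-axis (corner-transpose K) (nonUnit-flip (nonUnit-transpose N))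
        (ej , fj , h′j , hj) hl<h′l h′k
    ... | no hl | no h′k = ⊥-elim contra
      where
      open Corner K
      open NonUnit N
      hk : h ⟨ k ⟩ ≢ 0
      hk = <⇒≢0 h′k<hk
      h′l : h′ ⟨ l ⟩ ≢ 0
      h′l = <⇒≢0 hl<h′l
      contra : ⊥
      contra with f ⟨ k ⟩ ℕP.≟ 0 | f ⟨ l ⟩ ℕP.≟ 0
      ... | yes fk | yes fl = off-Q (fi≡1 N) fk fl
      ... | yes fk | no fl = fl (ℕP.m*n≡0⇒m≡0 (f ⟨ l ⟩) (h ⟨ k ⟩) {{ℕ.≢-nonZero hk}}
          (sym (trans (sym (cong (ℕ._* h ⟨ l ⟩) fk))
              (star-f h∈τ (λ u → h′k (ℕP.n<1⇒n≡0
                  (subst (h′ ⟨ k ⟩ ℕ.<_) (unitPair-≢0ˡ fk (unitPair-swap u)) h′k<hk))) (¬unitPair fl hl)))))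
      ... | no fk | yes fl = fk (ℕP.m*n≡0⇒m≡0 (f ⟨ k ⟩) (h′ ⟨ l ⟩) {{ℕ.≢-nonZero h′l}} (trans
              (star-f h′∈τ (¬unitPair fk h′k)
                  (λ u → hl (ℕP.n<1⇒n≡0 (subst (h ⟨ l ⟩ ℕ.<_) (unitPair-≢0ˡ fl (unitPair-swap u)) hl<h′l))))
              (cong (ℕ._* h′ ⟨ k ⟩) fl)))
      ... | no fk | no fl = ℕP.<-irrefl refl (begin-strict
          f ⟨ l ⟩ ℕ.* h′ ⟨ k ⟩   <⟨ ℕP.*-monoʳ-< (f ⟨ l ⟩) {{ℕ.≢-nonZero fl}} h′k<hk ⟩
          f ⟨ l ⟩ ℕ.* h ⟨ k ⟩    ≡⟨ star-f h∈τ (¬unitPair fk hk) (¬unitPair fl hl) ⟨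
          f ⟨ k ⟩ ℕ.* h ⟨ l ⟩    <⟨ ℕP.*-monoʳ-< (f ⟨ k ⟩) {{ℕ.≢-nonZero fk}} hl<h′l ⟩
          f ⟨ k ⟩ ℕ.* h′ ⟨ l ⟩   ≡⟨ star-f h′∈τ (¬unitPair fk h′k) (¬unitPair fl h′l) ⟩
          f ⟨ l ⟩ ℕ.* h′ ⟨ k ⟩   ∎)
        where open ℕP.≤-Reasoning

  opaque
    degenerate : ∀ {i j k l e e′ f h h′} (K : Corner i j k l e e′ f) → NonUnit k l h h′ →
        Corner.Degenerate K h h′ → Result
    degenerate {i} {j} {k} {l} {h = h} {h′} K N D@(ej , fj , hj , h′j) = conclude
      (opposite {k} {l} {i} {j} (swap-ij-kl fr) h∈τ h′∈τ h≢h′ (trans hi (sym h′i)) (trans hj (sym h′j)))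
      where
      open Corner K
      open NonUnit N
      swap-ij-kl : ∀ {i j k l} → Frame i j k l → Frame k l i j
      swap-ij-kl fr = swap-jk (swap-kl (swap-ij (swap-jk fr)))
      hi : h ⟨ i ⟩ ≡ 0
      hi = proj₁ (nonUnit-zero N)
      h′i : h′ ⟨ i ⟩ ≡ 0
      h′i = proj₂ (nonUnit-zero N)
      h≢h′ : h ≢ h′
      h≢h′ eq = ind (trans (cong (λ x → h ⟨ k ⟩ ℕ.* x ⟨ l ⟩) (sym eq))
          (trans (ℕP.*-comm (h ⟨ k ⟩) (h ⟨ l ⟩)) (cong (λ x → h ⟨ l ⟩ ℕ.* x ⟨ k ⟩) eq)))
      conclude : (h ⟨ k ⟩ ℕ.< h′ ⟨ k ⟩ × h′ ⟨ l ⟩ ℕ.< h ⟨ l ⟩) ⊎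
          (h′ ⟨ k ⟩ ℕ.< h ⟨ k ⟩ × h ⟨ l ⟩ ℕ.< h′ ⟨ l ⟩) → Result
      conclude (inj₁ (lt , gt)) = degenerate-ordered K (nonUnit-flip N) (ej , fj , h′j , hj) lt gt
      conclude (inj₂ (lt , gt)) = degenerate-ordered K N D lt gt

  OnAxis : (k l : Fin 4) (f h h′ : Point 4) → Set
  OnAxis k l f h h′ = f ⟨ k ⟩ ≢ 0 × f ⟨ l ⟩ ≡ 0 × h ⟨ l ⟩ ≡ 1 × h′ ⟨ l ⟩ ≡ 1

  opaque
    claim : ∀ {i j k l e e′ f h h′} → Corner i j k l e e′ f → NonUnit k l h h′ → Result ⊎ OnAxis k l f h h′ ⊎
        OnAxis l k f h h′
    claim {k = k} {l} {f = f} {h} {h′} K N with Corner.edges K N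
    ... | inj₁ D = inj₁ (degenerate K N D)
    ... | inj₂ par with f ⟨ k ⟩ ℕP.≟ 0 | f ⟨ l ⟩ ℕP.≟ 0
    ... | yes fk | yes fl = contradiction fl (Corner.off-Q K (Corner.fi≡1 K N) fk)
    ... | no fk | no fl = ⊥-elim (Corner.not-interior K N par fk fl)
    ... | no fk | yes fl = inj₂ (inj₁ (fk , fl , Corner.on-axis K N par fk fl))
    ... | yes fk | no fl = inj₂ (inj₂
        (fl , fk , Corner.on-axis (corner-transpose K) (nonUnit-transpose N) par′ fl fk))
      where
      par′ : Corner.Parallel (corner-transpose K) h h′
      par′ = trans (ℕP.+-comm (f ⟨ l ⟩ ℕ.* h′ ⟨ k ⟩) _) (trans (sym par) (ℕP.+-comm (f ⟨ k ⟩ ℕ.* h′ ⟨ l ⟩) _))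

  opaque
    -- If `x` and `h` or `h′` violated the unit condition, `claim` would make the l-coordinate of
    -- `x` equal to 1, unless it returned the result. So `x` is parallel to each of them or forms a
    -- unit pair with it in k. Parallel to both contradicts their different k-coordinates; the other
    -- combinations contradict `¬uk`, h_k > 0 or x_l > 1.
    large-impossible : ∀ {i j k l e e′ f h h′ x} → Corner i j k l e e′ f → NonUnit k l h h′ →
        OnAxis k l f h h′ →
      h′ ⟨ k ⟩ ℕ.< h ⟨ k ⟩ → x ∈ τ → x ⟨ l ⟩ ≢ 0 → x ⟨ l ⟩ ≢ 1 → Result
    large-impossible {k = k} {l} {f = f} {h} {h′} {x} K N (fk , fl , hl , h′l) h′k<hk x∈τ xl≢0 xl≢1
      = conclude (related h∈τ hl) (related h′∈τ h′l)
      where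
      open NonUnit N
      Related : Point 4 → Set
      Related g = Result ⊎ x ⟨ k ⟩ ≡ x ⟨ l ⟩ ℕ.* g ⟨ k ⟩ ⊎ UnitPair (x ⟨ k ⟩) (g ⟨ k ⟩)
      related : ∀ {g} → g ∈ τ → g ⟨ l ⟩ ≡ 1 → Related g
      related {g} g∈τ gl with independent? k l x g | unitPair? (x ⟨ k ⟩) (g ⟨ k ⟩)
      ... | no dep | _ = inj₂ (inj₁ (trans (trans (sym (ℕP.*-identityʳ _)) (cong (x ⟨ k ⟩ ℕ.*_) (sym gl)))
          (decidable-stable (_ ℕP.≟ _) dep)))
      ... | yes _ | yes u = inj₂ (inj₂ u)
      ... | yes ind | no ¬u with claim K (record { h∈τ = x∈τ ; h′∈τ = g∈τ ; ind = ind ; ¬uk = ¬u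
                                                ; ¬ul = ¬unitPair xl≢0 (≡1⇒≢0 gl) })
      ... | inj₁ result = inj₁ result
      ... | inj₂ (inj₁ (_ , _ , xl≡1 , _)) = contradiction xl≡1 xl≢1
      ... | inj₂ (inj₂ (fl≢0 , _)) = contradiction fl fl≢0
      hk≢0 : h ⟨ k ⟩ ≢ 0
      hk≢0 = <⇒≢0 h′k<hk
      conclude : Related h → Related h′ → Result
      conclude (inj₁ result) _ = result
      conclude (inj₂ (inj₂ (inj₁ (_ , hk≡0)))) _ = contradiction hk≡0 hk≢0
      conclude (inj₂ (inj₂ (inj₂ (_ , hk≡1)))) _ =
        contradiction (inj₁ (hk≡1 , ℕP.n<1⇒n≡0 (subst (h′ ⟨ k ⟩ ℕ.<_) hk≡1 h′k<hk))) ¬uk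
      conclude (inj₂ (inj₁ dep)) (inj₁ result) = result
      conclude (inj₂ (inj₁ dep)) (inj₂ (inj₁ dep′)) =
        ⊥-elim (ℕP.<-irrefl (*-cancelˡ-≢0 (x ⟨ l ⟩) xl≢0 (trans (sym dep′) dep)) h′k<hk)
      conclude (inj₂ (inj₁ dep)) (inj₂ (inj₂ (inj₁ (xk≡1 , _)))) =
        contradiction (ℕP.m*n≡1⇒m≡1 (x ⟨ l ⟩) (h ⟨ k ⟩) (trans (sym dep) xk≡1)) xl≢1
      conclude (inj₂ (inj₁ dep)) (inj₂ (inj₂ (inj₂ (xk≡0 , _)))) with ℕP.m*n≡0⇒m≡0∨n≡0 (x ⟨ l ⟩)
          (trans (sym dep) xk≡0)
      ... | inj₁ xl≡0 = contradiction xl≡0 xl≢0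
      ... | inj₂ hk≡0 = contradiction hk≡0 hk≢0

  -- `Result` is derived and not decided, so a pass through the list moves the alternative out of
  -- the quantifier.
  sequence : ∀ {R : Set} {P : Point 4 → Set} (σ : Polytope 4) → (∀ x → x ∈ σ → R ⊎ P x) → R ⊎
      (∀ x → x ∈ σ → P x)
  sequence [] f = inj₂ (λ x ())
  sequence (y ∷ σ) f with f y (here refl) | sequence σ (λ x → f x ∘ there)
  ... | inj₁ r | _ = inj₁ r
  ... | inj₂ _ | inj₁ r = inj₁ r
  ... | inj₂ p | inj₂ ps = inj₂ λ { x (here refl) → p ; x (there x∈σ) → ps x x∈σ }

  opaque
    -- Any point off x_i = 0 other than `e` can replace `f` in `claim`, with the same `h` and `h′`.
    -- The alternative with k and l exchanged would make h_k = h′_k, but `h` and `h′` are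
    -- independent and already agree in l.
    finish : ∀ {i j k l e e′ f h h′} → Corner i j k l e e′ f → NonUnit k l h h′ → OnAxis k l f h h′ → Result
    finish {i} {j} {k} {l} {e} {e′} {f} {h} {h′} K N A@(fk , fl , hl , h′l) =
      [ id , (λ values → b₂ (i , l , Frame.i≢l fr , values)) ] (sequence τ value)
      where
      open Corner K
      open NonUnit N
      hk≢h′k : h ⟨ k ⟩ ≢ h′ ⟨ k ⟩
      hk≢h′k eq = ind (trans (cong₂ ℕ._*_ eq (trans h′l (sym hl))) (ℕP.*-comm (h′ ⟨ k ⟩) (h ⟨ l ⟩)))
      large : ∀ {x} → x ∈ τ → x ⟨ l ⟩ ≢ 0 → x ⟨ l ⟩ ≢ 1 → Result
      large x∈τ xl≢0 xl≢1 with ℕP.<-cmp (h ⟨ k ⟩) (h′ ⟨ k ⟩)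
      ... | tri< lt _ _ = large-impossible K (nonUnit-flip N) (fk , fl , h′l , hl) lt x∈τ xl≢0 xl≢1
      ... | tri≈ _ eq _ = contradiction eq hk≢h′k
      ... | tri> _ _ gt = large-impossible K N A gt x∈τ xl≢0 xl≢1
      Value : Point 4 → Set
      Value x = (x ⟨ i ⟩ , x ⟨ l ⟩) ∈ (0 , 0) ∷ (1 , 0) ∷ (0 , 1) ∷ []
      value : ∀ x → x ∈ τ → Result ⊎ Value x
      value x x∈τ with x ⟨ i ⟩ ℕP.≟ 0
      ... | yes xi with x ⟨ l ⟩ ℕP.≟ 0 | x ⟨ l ⟩ ℕP.≟ 1
      ... | yes xl | _ = inj₂ (here (cong₂ _,_ xi xl))
      ... | no _ | yes xl = inj₂ (there (there (here (cong₂ _,_ xi xl))))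
      ... | no xl≢0 | no xl≢1 = inj₁ (large x∈τ xl≢0 xl≢1)
      value x x∈τ | no xi with x ≟P e
      ... | yes x≡e = inj₂ (there (here
          (cong₂ _,_ (trans (cong (_⟨ i ⟩) x≡e) ei) (trans (cong (_⟨ l ⟩) x≡e) el))))
      ... | no x≢e = other (claim Kx N)
        where
        Kx : Corner i j k l e e′ x
        Kx = record { fr = fr ; E = E ; ei = ei ; e′i = e′i ; f∈τ = x∈τ ; fi≢0 = xi ; f≢e = x≢e }
        other : Result ⊎ OnAxis k l x h h′ ⊎ OnAxis l k x h h′ → Result ⊎ Value x
        other (inj₁ result) = inj₁ result
        other (inj₂ (inj₁ (_ , xl , _))) = inj₂ (there (here (cong₂ _,_ (Corner.fi≡1 Kx N) xl)))
        other (inj₂ (inj₂ (_ , _ , hk , h′k))) = contradiction (trans hk (sym h′k)) hk≢h′k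

  opaque
    corner-result : ∀ {i j k l e e′ h h′} → Frame i j k l → Edge k l e e′ → e ⟨ i ⟩ ≡ 1 → e′ ⟨ i ⟩ ≡ 0 →
        NonUnit k l h h′ → Result
    corner-result {i} {j} {k} {l} {e} {e′} {h} {h′} fr E ei e′i N with search
        (λ x → ¬? (x ⟨ i ⟩ ℕP.≟ 0) ×-dec ¬? (x ≟P e)) τ
    ... | inj₂ none = b₁ (i , e , Edge.e∈τ E , ei , λ y y∈τ yi →
        decidable-stable (y ≟P e) (λ y≢e → none y y∈τ (yi , y≢e)))
    ... | inj₁ (f , f∈τ , fi≢0 , f≢e) = conclude (claim K N)
      where
      K : Corner i j k l e e′ f
      K = record { fr = fr ; E = E ; ei = ei ; e′i = e′i ; f∈τ = f∈τ ; fi≢0 = fi≢0 ; f≢e = f≢e }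
      conclude : Result ⊎ OnAxis k l f h h′ ⊎ OnAxis l k f h h′ → Result
      conclude (inj₁ result) = result
      conclude (inj₂ (inj₁ A)) = finish K N A
      conclude (inj₂ (inj₂ A)) = finish (corner-transpose K) (nonUnit-transpose N) A

  opaque
    edge-result : ∀ {i j k l e e′} → Frame i j k l → Edge k l e e′ → Result
    edge-result fr E with find-nonUnit fr E
    ... | inj₁ result = result
    ... | inj₂ (h , h′ , N) with edge-quad fr E (NonUnit.h∈τ N) (NonUnit.h′∈τ N) (NonUnit.ind N)
    ... | inj₁ (inj₁ (ei , e′i) , _) = corner-result fr E ei e′i N
    ... | inj₁ (inj₂ (ei , e′i) , _) = corner-result fr (edge-flip E) e′i ei N
    ... | inj₂ (inj₁ (inj₁ (ej , e′j) , _)) = corner-result (swap-ij fr) E ej e′j N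
    ... | inj₂ (inj₁ (inj₂ (ej , e′j) , _)) = corner-result (swap-ij fr) (edge-flip E) e′j ej N
    ... | inj₂ (inj₂ (inj₁ u)) = contradiction u (NonUnit.¬uk N)
    ... | inj₂ (inj₂ (inj₂ u)) = contradiction u (NonUnit.¬ul N)

-- At most one point in each coordinate plane

opaque
  fresh : ∀ (a b c : Fin 4) → ∃[ m ] (m ≢ a × m ≢ b × m ≢ c)
  fresh = from-yes (FinP.all? {n = 4} λ a → FinP.all? {n = 4} λ b → FinP.all? {n = 4} λ c →
      FinP.any? {n = 4} λ m →
            ¬? (m FinP.≟ a) ×-dec ¬? (m FinP.≟ b) ×-dec ¬? (m FinP.≟ c))

frame-of-three : ∀ {i j l} → i ≢ j → i ≢ l → j ≢ l → ∃[ k ] Frame i j k l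
frame-of-three {i} {j} {l} i≢j i≢l j≢l with fresh i j l
... | k , k≢i , k≢j , k≢l = k , frame i≢j (k≢i ∘ sym) i≢l (k≢j ∘ sym) j≢l k≢l

frame-of-two : ∀ {k l} → k ≢ l → ∃[ i ] ∃[ j ] Frame i j k l
frame-of-two {k} {l} k≢l with fresh k l l
... | i , i≢k , i≢l , _ with fresh i k l
... | j , j≢i , j≢k , j≢l = i , j , frame (j≢i ∘ sym) i≢k i≢l j≢k j≢l k≢l

edgeCross : (i j : Fin 4) (p p′ t t′ : Point 4) → ℤ
edgeCross i j p p′ t t′ = Δ p p′ i ℤ.* Δ t t′ j ℤ.- Δ p p′ j ℤ.* Δ t t′ i

module _ where
  open ℤSolver.+-*-Solver

  vol-expand : ∀ i j k x y z w →
    vol i j k x y z w ≡ Δ x w i ℤ.* area j k x y z ℤ.- Δ x w j ℤ.* area i k x y z ℤ.+ Δ x w k ℤ.* area i j x y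
        z
  vol-expand i j k x y z w =
    solve 9 (λ a b c d e f g h i →
      a :* (e :* i :- f :* h) :- b :* (d :* i :- f :* g) :+ c :* (d :* h :- e :* g) :=
      g :* (b :* f :- c :* e) :- h :* (a :* f :- c :* d) :+ i :* (a :* e :- b :* d)) refl
      (Δ x y i) (Δ x y j) (Δ x y k) (Δ x z i) (Δ x z j) (Δ x z k) (Δ x w i) (Δ x w j) (Δ x w k)

  vol-cycle : ∀ i j k x y z w → vol i j k x y z w ≡ ℤ.- vol i j k y z w x
  vol-cycle i j k x y z w =
    solve 12 (λ x₁ x₂ x₃ y₁ y₂ y₃ z₁ z₂ z₃ w₁ w₂ w₃ →
      det3P (y₁ :- x₁) (y₂ :- x₂) (y₃ :- x₃) (z₁ :- x₁) (z₂ :- x₂) (z₃ :- x₃) (w₁ :- x₁) (w₂ :- x₂)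
          (w₃ :- x₃) :=
      :- det3P (z₁ :- y₁) (z₂ :- y₂) (z₃ :- y₃) (w₁ :- y₁) (w₂ :- y₂) (w₃ :- y₃) (x₁ :- y₁) (x₂ :- y₂)
          (x₃ :- y₃)) refl
      (+ (x ⟨ i ⟩)) (+ (x ⟨ j ⟩)) (+ (x ⟨ k ⟩)) (+ (y ⟨ i ⟩)) (+ (y ⟨ j ⟩)) (+ (y ⟨ k ⟩))
      (+ (z ⟨ i ⟩)) (+ (z ⟨ j ⟩)) (+ (z ⟨ k ⟩)) (+ (w ⟨ i ⟩)) (+ (w ⟨ j ⟩)) (+ (w ⟨ k ⟩))
    where
    det3P : ∀ {n} (a b c d e f g h i : Polynomial n) → Polynomial n
    det3P a b c d e f g h i = a :* (e :* i :- f :* h) :- b :* (d :* i :- f :* g) :+ c :* (d :* h :- e :* g)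

  area-cycle : ∀ i j x y z → area i j x y z ≡ area i j y z x
  area-cycle i j x y z =
    solve 6 (λ a b c d e f → (c :- a) :* (f :- b) :- (d :- b) :* (e :- a) :=
        (e :- c) :* (b :- d) :- (f :- d) :* (a :- c)) refl
      (+ (x ⟨ i ⟩)) (+ (x ⟨ j ⟩)) (+ (y ⟨ i ⟩)) (+ (y ⟨ j ⟩)) (+ (z ⟨ i ⟩)) (+ (z ⟨ j ⟩))

  area-degenerate : ∀ i j x z → area i j x x z ≡ 0ℤ
  area-degenerate i j x z =
    solve 4 (λ a b c d → (a :- a) :* (d :- b) :- (b :- b) :* (c :- a) := con 0ℤ) refl
      (+ (x ⟨ i ⟩)) (+ (x ⟨ j ⟩)) (+ (z ⟨ i ⟩)) (+ (z ⟨ j ⟩))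

  -- The left side is the affine function of `z` to which `spread` applies; the last summand on the
  -- right is its value where the area vanishes.
  area-as-functional : ∀ i j x y z →
    ℤ.- Δ x y j ℤ.* + (z ⟨ i ⟩) ℤ.+ 0ℤ ℤ.* + (z ⟨ i ⟩) ℤ.+ Δ x y i ℤ.* + (z ⟨ j ⟩) ≡
    area i j x y z ℤ.+ (Δ x y i ℤ.* + (x ⟨ j ⟩) ℤ.- Δ x y j ℤ.* + (x ⟨ i ⟩))
  area-as-functional i j x y z =
    solve 6 (λ a b c d z₁ z₂ → :- b :* z₁ :+ con 0ℤ :* z₁ :+ a :* z₂ :=
      (a :* (z₂ :- d) :- b :* (z₁ :- c)) :+ (a :* d :- b :* c)) refl
      (Δ x y i) (Δ x y j) (+ (x ⟨ i ⟩)) (+ (x ⟨ j ⟩)) (+ (z ⟨ i ⟩)) (+ (z ⟨ j ⟩))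

  vol-as-functional : ∀ i j k x y z w →
    area j k x y z ℤ.* + (w ⟨ i ⟩) ℤ.+ (ℤ.- area i k x y z) ℤ.* + (w ⟨ j ⟩) ℤ.+ area i j x y z ℤ.* +
        (w ⟨ k ⟩) ≡
    vol i j k x y z w ℤ.+ (area j k x y z ℤ.* + (x ⟨ i ⟩) ℤ.- area i k x y z ℤ.* + (x ⟨ j ⟩) ℤ.+ area i j x y
        z ℤ.* + (x ⟨ k ⟩))
  vol-as-functional i j k x y z w = trans
    (solve 9 (λ a b c x₁ x₂ x₃ w₁ w₂ w₃ → a :* w₁ :+ (:- b) :* w₂ :+ c :* w₃ :=
      ((w₁ :- x₁) :* a :- (w₂ :- x₂) :* b :+ (w₃ :- x₃) :* c) :+ (a :* x₁ :- b :* x₂ :+ c :* x₃)) refl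
      (area j k x y z) (area i k x y z) (area i j x y z) (+ (x ⟨ i ⟩)) (+ (x ⟨ j ⟩)) (+ (x ⟨ k ⟩))
          (+ (w ⟨ i ⟩)) (+ (w ⟨ j ⟩)) (+ (w ⟨ k ⟩)))
    (cong (ℤ._+ (area j k x y z ℤ.* + (x ⟨ i ⟩) ℤ.- area i k x y z ℤ.* + (x ⟨ j ⟩) ℤ.+ area i j x y z ℤ.* +
        (x ⟨ k ⟩))) (sym (vol-expand i j k x y z w)))

  edgeCross-split : ∀ i j p p′ t₁ t₂ t₃ →
      edgeCross i j p p′ t₂ t₃ ≡ edgeCross i j p p′ t₁ t₃ ℤ.- edgeCross i j p p′ t₁ t₂
  edgeCross-split i j p p′ t₁ t₂ t₃ =
    solve 8 (λ a b c d e f g h → a :* (h :- f) :- b :* (g :- e) :=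
      (a :* (h :- d) :- b :* (g :- c)) :- (a :* (f :- d) :- b :* (e :- c))) refl
      (Δ p p′ i) (Δ p p′ j) (+ (t₁ ⟨ i ⟩)) (+ (t₁ ⟨ j ⟩)) (+ (t₂ ⟨ i ⟩)) (+ (t₂ ⟨ j ⟩)) (+ (t₃ ⟨ i ⟩))
          (+ (t₃ ⟨ j ⟩))

  edgeCross-flip : ∀ i j p p′ t t′ → edgeCross i j p p′ t t′ ≡ ℤ.- edgeCross i j p p′ t′ t
  edgeCross-flip i j p p′ t t′ =
    solve 6 (λ a b c d e f → a :* (f :- d) :- b :* (e :- c) := :- (a :* (d :- f) :- b :* (c :- e))) refl
      (Δ p p′ i) (Δ p p′ j) (+ (t ⟨ i ⟩)) (+ (t ⟨ j ⟩)) (+ (t′ ⟨ i ⟩)) (+ (t′ ⟨ j ⟩))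

  edgeCross-degenerate : ∀ i j p p′ t → edgeCross i j p p′ t t ≡ 0ℤ
  edgeCross-degenerate i j p p′ t =
    solve 4 (λ a b c d → a :* (d :- d) :- b :* (c :- c) := con 0ℤ) refl (Δ p p′ i) (Δ p p′ j) (+ (t ⟨ i ⟩))
        (+ (t ⟨ j ⟩))

  -- Cramer's rule: p′ − p is determined by its cross products with two sides of the triangle.
  cramer-i : ∀ i j p p′ t₁ t₂ t₃ → Δ p p′ i ℤ.* area i j t₁ t₂ t₃ ≡
    Δ t₁ t₂ i ℤ.* edgeCross i j p p′ t₁ t₃ ℤ.- Δ t₁ t₃ i ℤ.* edgeCross i j p p′ t₁ t₂
  cramer-i i j p p′ t₁ t₂ t₃ =
    solve 6 (λ a b c d e f → a :* (c :* f :- d :* e) := c :* (a :* f :- b :* e) :- e :* (a :* d :- b :* c))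
        refl
      (Δ p p′ i) (Δ p p′ j) (Δ t₁ t₂ i) (Δ t₁ t₂ j) (Δ t₁ t₃ i) (Δ t₁ t₃ j)

  cramer-j : ∀ i j p p′ t₁ t₂ t₃ → Δ p p′ j ℤ.* area i j t₁ t₂ t₃ ≡
    Δ t₁ t₂ j ℤ.* edgeCross i j p p′ t₁ t₃ ℤ.- Δ t₁ t₃ j ℤ.* edgeCross i j p p′ t₁ t₂
  cramer-j i j p p′ t₁ t₂ t₃ =
    solve 6 (λ a b c d e f → b :* (c :* f :- d :* e) := d :* (a :* f :- b :* e) :- f :* (a :* d :- b :* c))
        refl
      (Δ p p′ i) (Δ p p′ j) (Δ t₁ t₂ i) (Δ t₁ t₂ j) (Δ t₁ t₃ i) (Δ t₁ t₃ j)

module Sparse {τ : Polytope 4} (F : IsBFacet τ) where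
  open Facet F
  open Classification F

  NoEdges : Set
  NoEdges = ∀ {i j k l e e′} → Frame i j k l → ¬ Edge k l e e′

  module _ (no-edges : NoEdges) where

    opaque
      coplanar : ∀ {i j k l x y} → Frame i j k l → x ∈ τ → y ∈ τ →
        x ⟨ k ⟩ ≡ 0 → x ⟨ l ⟩ ≡ 0 → y ⟨ k ⟩ ≡ 0 → y ⟨ l ⟩ ≡ 0 → x ≡ y
      coplanar {x = x} {y} fr x∈τ y∈τ xk xl yk yl = decidable-stable (x ≟P y) λ x≢y →
        no-edges fr (record { e∈τ = x∈τ ; e′∈τ = y∈τ ; e≢e′ = x≢y ; ek = xk ; el = xl ; e′k = yk ; e′l = yl })

    record Triangle (i j l : Fin 4) (t₁ t₂ t₃ : Point 4) : Set where
      field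
        t₁∈τ : t₁ ∈ τ
        t₂∈τ : t₂ ∈ τ
        t₃∈τ : t₃ ∈ τ
        t₁l : t₁ ⟨ l ⟩ ≡ 0
        t₂l : t₂ ⟨ l ⟩ ≡ 0
        t₃l : t₃ ⟨ l ⟩ ≡ 0
        area≢0 : area i j t₁ t₂ t₃ ≢ 0ℤ

      t₁≢t₂ : t₁ ≢ t₂
      t₁≢t₂ refl = area≢0 (area-degenerate i j t₁ t₃)
      t₂≢t₃ : t₂ ≢ t₃
      t₂≢t₃ refl = area≢0 (trans (area-cycle i j t₁ t₂ t₂) (area-degenerate i j t₂ t₁))
      t₁≢t₃ : t₁ ≢ t₃
      t₁≢t₃ refl = area≢0 (trans (area-cycle i j t₁ t₂ t₁)
          (trans (area-cycle i j t₂ t₁ t₁) (area-degenerate i j t₁ t₂)))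

    opaque
      -- A unit vector in a coordinate m other than l would vanish at two vertices of the triangle,
      -- putting both into x_m = x_l = 0. So it is in l, with its 1 at `p`.
      apex-unit : ∀ {i j k l t₁ t₂ t₃ p} → Frame i j k l → Triangle i j l t₁ t₂ t₃ → p ∈ τ → p ⟨ l ⟩ ≢ 0 →
          p ⟨ l ⟩ ≡ 1
      apex-unit {i} {j} {k} {l} {t₁} {t₂} {t₃} {p} fr T p∈τ pl =
        [ ⊥-elim ∘ side (swap-jk (swap-ij fr)) , [ ⊥-elim ∘ side (swap-jk fr) , [ ⊥-elim ∘ side fr ,
            base ] ] ]
          (unit-column′ fr l i j t₁∈τ t₂∈τ t₃∈τ p∈τ vol≢0)
        where
        open Triangle T
        vol≢0 : vol l i j t₁ t₂ t₃ p ≢ 0ℤ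
        vol≢0 = subst (_≢ 0ℤ) (sym (vol-apex l i j t₁ t₂ t₃ p t₁l t₂l t₃l))
            (ℤ-*≢0 (pl ∘ ℤP.+-injective) area≢0)
        side : ∀ {a b m} → Frame a b m l → ¬ UnitColumn (t₁ ⟨ m ⟩) (t₂ ⟨ m ⟩) (t₃ ⟨ m ⟩) (p ⟨ m ⟩)
        side fr (unit₁ _ t₂m t₃m _) = t₂≢t₃ (coplanar fr t₂∈τ t₃∈τ t₂m t₂l t₃m t₃l)
        side fr (unit₂ t₁m _ t₃m _) = t₁≢t₃ (coplanar fr t₁∈τ t₃∈τ t₁m t₁l t₃m t₃l)
        side fr (unit₃ t₁m t₂m _ _) = t₁≢t₂ (coplanar fr t₁∈τ t₂∈τ t₁m t₁l t₂m t₂l)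
        side fr (unit₄ t₁m t₂m _ _) = t₁≢t₂ (coplanar fr t₁∈τ t₂∈τ t₁m t₁l t₂m t₂l)
        base : UnitColumn (t₁ ⟨ l ⟩) (t₂ ⟨ l ⟩) (t₃ ⟨ l ⟩) (p ⟨ l ⟩) → p ⟨ l ⟩ ≡ 1
        base (unit₁ a _ _ _) = ⊥-elim (0≢1 t₁l a)
        base (unit₂ _ b _ _) = ⊥-elim (0≢1 t₂l b)
        base (unit₃ _ _ c _) = ⊥-elim (0≢1 t₃l c)
        base (unit₄ _ _ _ d) = d

    Crossing : (p p′ t t′ : Point 4) → Fin 4 → Set
    Crossing p p′ t t′ m = p ⟨ m ⟩ ≡ 0 × p′ ⟨ m ⟩ ≡ 0 × UnitPair (t ⟨ m ⟩) (t′ ⟨ m ⟩)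

    OneOf : (i j k : Fin 4) → (Fin 4 → Set) → Set
    OneOf i j k P = P i ⊎ P j ⊎ P k

    opaque
      -- The nonzero cross product is the volume of `p p′ t t′`. The column of l has two entries 1.
      -- In another coordinate m the 1 is not at `p` or `p′`, since `t` and `t′` would both lie in
      -- x_m = x_l = 0.
      crossing : ∀ {i j k l p p′ t t′} → Frame i j k l → p ∈ τ → p′ ∈ τ → t ∈ τ → t′ ∈ τ →
        p ⟨ l ⟩ ≡ 1 → p′ ⟨ l ⟩ ≡ 1 → t ⟨ l ⟩ ≡ 0 → t′ ⟨ l ⟩ ≡ 0 → edgeCross i j p p′ t t′ ≢ 0ℤ →
        OneOf i j k (Crossing p p′ t t′)
      crossing {i} {j} {k} {l} {p} {p′} {t} {t′} fr p∈τ p′∈τ t∈τ t′∈τ pl p′l tl t′l cross≢0 =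
        Sum.map (side (swap-jk (swap-ij fr))) (Sum.map (side (swap-jk fr)) [ side fr , ⊥-elim ∘ base ])
          (unit-column′ fr l i j p∈τ p′∈τ t∈τ t′∈τ
              (subst (_≢ 0ℤ) (sym (vol-edges l i j p p′ t t′ pl p′l tl t′l)) cross≢0))
        where
        t≢t′ : t ≢ t′
        t≢t′ refl = cross≢0 (edgeCross-degenerate i j p p′ t)
        side : ∀ {a b m} → Frame a b m l → UnitColumn (p ⟨ m ⟩) (p′ ⟨ m ⟩) (t ⟨ m ⟩) (t′ ⟨ m ⟩) →
            Crossing p p′ t t′ m
        side fr (unit₁ _ _ tm t′m) = contradiction (coplanar fr t∈τ t′∈τ tm tl t′m t′l) t≢t′
        side fr (unit₂ _ _ tm t′m) = contradiction (coplanar fr t∈τ t′∈τ tm tl t′m t′l) t≢t′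
        side fr (unit₃ pm p′m tm t′m) = pm , p′m , inj₁ (tm , t′m)
        side fr (unit₄ pm p′m tm t′m) = pm , p′m , inj₂ (tm , t′m)
        base : ¬ UnitColumn (p ⟨ l ⟩) (p′ ⟨ l ⟩) (t ⟨ l ⟩) (t′ ⟨ l ⟩)
        base (unit₁ _ b _ _) = 0≢1 b p′l
        base (unit₂ a _ _ _) = 0≢1 a pl
        base (unit₃ a _ _ _) = 0≢1 a pl
        base (unit₄ a _ _ _) = 0≢1 a pl

    Fork : (p p′ t₁ t₂ t₃ : Point 4) → Fin 4 → Set
    Fork p p′ t₁ t₂ t₃ m = p ⟨ m ⟩ ≡ 0 × p′ ⟨ m ⟩ ≡ 0 × t₁ ⟨ m ⟩ ≡ 0 × t₂ ⟨ m ⟩ ≡ 1 × t₃ ⟨ m ⟩ ≡ 1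

    opaque
      -- If the two sides were crossed in different coordinates, `p` and `p′` would vanish in both
      -- and coincide. In the common coordinate `t₂` and `t₃` cannot both be 0, as they already
      -- share a zero in l.
      fork : ∀ {i j k l p p′ t₁ t₂ t₃} → Frame i j k l → p ∈ τ → p′ ∈ τ → t₁ ∈ τ → t₂ ∈ τ → t₃ ∈ τ →
        p ⟨ l ⟩ ≡ 1 → p′ ⟨ l ⟩ ≡ 1 → t₁ ⟨ l ⟩ ≡ 0 → t₂ ⟨ l ⟩ ≡ 0 → t₃ ⟨ l ⟩ ≡ 0 → p ≢ p′ → t₂ ≢ t₃ →
        edgeCross i j p p′ t₁ t₂ ≢ 0ℤ → edgeCross i j p p′ t₁ t₃ ≢ 0ℤ → OneOf i j k (Fork p p′ t₁ t₂ t₃)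
      fork {i} {j} {k} {l} {p} {p′} {t₁} {t₂} {t₃} fr p∈τ p′∈τ t₁∈τ t₂∈τ t₃∈τ pl p′l t₁l t₂l t₃l p≢p′ t₂≢t₃
          c₁₂ c₁₃ =
        combine (crossing fr p∈τ p′∈τ t₁∈τ t₂∈τ pl p′l t₁l t₂l c₁₂)
            (crossing fr p∈τ p′∈τ t₁∈τ t₃∈τ pl p′l t₁l t₃l c₁₃)
        where
        same : ∀ {a b m} → Frame a b m l → Crossing p p′ t₁ t₂ m → Crossing p p′ t₁ t₃ m →
            Fork p p′ t₁ t₂ t₃ m
        same fr (pm , p′m , inj₂ (t₁m , t₂m)) (_ , _ , inj₂ (_ , t₃m)) = pm , p′m , t₁m , t₂m , t₃m
        same fr (_ , _ , inj₁ (_ , t₂m)) (_ , _ , inj₁ (_ , t₃m)) =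
            contradiction (coplanar fr t₂∈τ t₃∈τ t₂m t₂l t₃m t₃l) t₂≢t₃
        same fr (_ , _ , inj₁ (t₁m , _)) (_ , _ , inj₂ (t₁m′ , _)) = ⊥-elim (0≢1 t₁m′ t₁m)
        same fr (_ , _ , inj₂ (t₁m , _)) (_ , _ , inj₁ (t₁m′ , _)) = ⊥-elim (0≢1 t₁m t₁m′)
        different : ∀ {a b m n} → Frame a b m n → Crossing p p′ t₁ t₂ m → Crossing p p′ t₁ t₃ n → ⊥
        different fr (pm , p′m , _) (pn , p′n , _) = p≢p′ (coplanar fr p∈τ p′∈τ pm pn p′m p′n)
        fr-ik : Frame j l i k
        fr-ik = swap-jk (swap-kl (swap-ij fr))
        fr-ij : Frame k l i j
        fr-ij = swap-jk (swap-kl (swap-ij (swap-jk fr)))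
        fr-jk : Frame i l j k
        fr-jk = swap-jk (swap-kl fr)
        combine : OneOf i j k (Crossing p p′ t₁ t₂) → OneOf i j k (Crossing p p′ t₁ t₃) →
            OneOf i j k (Fork p p′ t₁ t₂ t₃)
        combine (inj₁ a) (inj₁ b) = inj₁ (same (swap-jk (swap-ij fr)) a b)
        combine (inj₁ a) (inj₂ (inj₁ b)) = ⊥-elim (different fr-ij a b)
        combine (inj₁ a) (inj₂ (inj₂ b)) = ⊥-elim (different fr-ik a b)
        combine (inj₂ (inj₁ a)) (inj₁ b) = ⊥-elim (different (swap-kl fr-ij) a b)
        combine (inj₂ (inj₁ a)) (inj₂ (inj₁ b)) = inj₂ (inj₁ (same (swap-jk fr) a b))
        combine (inj₂ (inj₁ a)) (inj₂ (inj₂ b)) = ⊥-elim (different fr-jk a b)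
        combine (inj₂ (inj₂ a)) (inj₁ b) = ⊥-elim (different (swap-kl fr-ik) a b)
        combine (inj₂ (inj₂ a)) (inj₂ (inj₁ b)) = ⊥-elim (different (swap-kl fr-jk) a b)
        combine (inj₂ (inj₂ a)) (inj₂ (inj₂ b)) = inj₂ (inj₂ (same fr a b))

    OneZero : ℕ → ℕ → ℕ → Set
    OneZero a b c = (a ≡ 0 × b ≡ 1 × c ≡ 1) ⊎ (a ≡ 1 × b ≡ 0 × c ≡ 1) ⊎ (a ≡ 1 × b ≡ 1 × c ≡ 0)

    Trident : (p p′ t₁ t₂ t₃ : Point 4) → Fin 4 → Set
    Trident p p′ t₁ t₂ t₃ m = p ⟨ m ⟩ ≡ 0 × p′ ⟨ m ⟩ ≡ 0 × OneZero (t₁ ⟨ m ⟩) (t₂ ⟨ m ⟩) (t₃ ⟨ m ⟩)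

    opaque
      -- By Cramer's rule p′ - p is parallel to at most one side of the triangle. `fork` applies at
      -- a vertex where two other sides meet, and this vertex receives the 0.
      trident : ∀ {i j k l p p′ t₁ t₂ t₃} → Frame i j k l → Triangle i j l t₁ t₂ t₃ → p ∈ τ → p′ ∈ τ →
        p ⟨ l ⟩ ≢ 0 → p′ ⟨ l ⟩ ≢ 0 → p ≢ p′ → OneOf i j k (Trident p p′ t₁ t₂ t₃)
      trident {i} {j} {k} {l} {p} {p′} {t₁} {t₂} {t₃} fr T p∈τ p′∈τ pl≢0 p′l≢0 p≢p′ =
        decide (edgeCross i j p p′ t₁ t₂ ℤP.≟ 0ℤ) (edgeCross i j p p′ t₁ t₃ ℤP.≟ 0ℤ)
        where
        open Triangle T
        pl : p ⟨ l ⟩ ≡ 1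
        pl = apex-unit fr T p∈τ pl≢0
        p′l : p′ ⟨ l ⟩ ≡ 1
        p′l = apex-unit fr T p′∈τ p′l≢0
        mapOneOf : ∀ {P Q : Fin 4 → Set} → (∀ m → P m → Q m) → OneOf i j k P → OneOf i j k Q
        mapOneOf f = Sum.map (f i) (Sum.map (f j) (f k))
        coordinate-≡ : ∀ {m} → Δ p p′ m ℤ.* area i j t₁ t₂ t₃ ≡ 0ℤ → p ⟨ m ⟩ ≡ p′ ⟨ m ⟩
        coordinate-≡ {m} eq = decidable-stable (_ ℕP.≟ _) (λ ≢ → ℤ-*≢0 (+-≢ (≢ ∘ sym)) area≢0 eq)
        vanish : ∀ a b {x y} → x ≡ 0ℤ → y ≡ 0ℤ → a ℤ.* x ℤ.- b ℤ.* y ≡ 0ℤ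
        vanish a b refl refl = cong₂ ℤ._-_ (ℤP.*-zeroʳ a) (ℤP.*-zeroʳ b)
        neg≢0 : ∀ {a b} → a ≡ ℤ.- b → b ≢ 0ℤ → a ≢ 0ℤ
        neg≢0 a≡-b b≢0 a≡0 = b≢0 (ℤP.neg-injective (trans (sym a≡-b) a≡0))
        decide : Dec (edgeCross i j p p′ t₁ t₂ ≡ 0ℤ) → Dec (edgeCross i j p p′ t₁ t₃ ≡ 0ℤ) →
            OneOf i j k (Trident p p′ t₁ t₂ t₃)
        decide (no c₁₂) (no c₁₃) = mapOneOf (λ { m (pm , p′m , a , b , c) → pm , p′m , inj₁ (a , b , c) })
          (fork fr p∈τ p′∈τ t₁∈τ t₂∈τ t₃∈τ pl p′l t₁l t₂l t₃l p≢p′ t₂≢t₃ c₁₂ c₁₃)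
        decide (yes c₁₂) (yes c₁₃) = contradiction
          (agree (swap-kl (swap-jk (swap-ij (swap-jk fr)))) p∈τ p′∈τ
            (coordinate-≡ (trans (cramer-j i j p p′ t₁ t₂ t₃) (vanish (Δ t₁ t₂ j) (Δ t₁ t₃ j) c₁₃ c₁₂)))
            (trans pl (sym p′l))
            (coordinate-≡ (trans (cramer-i i j p p′ t₁ t₂ t₃) (vanish (Δ t₁ t₂ i) (Δ t₁ t₃ i) c₁₃ c₁₂)))) p≢p′
        decide (yes c₁₂) (no c₁₃) = mapOneOf
            (λ { m (pm , p′m , c , a , b) → pm , p′m , inj₂ (inj₂ (a , b , c)) })
          (fork fr p∈τ p′∈τ t₃∈τ t₁∈τ t₂∈τ pl p′l t₃l t₁l t₂l p≢p′ t₁≢t₂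
            (neg≢0 (edgeCross-flip i j p p′ t₃ t₁) c₁₃)
            (neg≢0 (edgeCross-flip i j p p′ t₃ t₂) (λ c₂₃ → c₁₃ (begin
              edgeCross i j p p′ t₁ t₃ ≡⟨ ℤP.+-identityʳ _ ⟨
              edgeCross i j p p′ t₁ t₃ ℤ.- 0ℤ ≡⟨ cong (λ a → edgeCross i j p p′ t₁ t₃ ℤ.- a) c₁₂ ⟨
              edgeCross i j p p′ t₁ t₃ ℤ.- edgeCross i j p p′ t₁ t₂ ≡⟨ edgeCross-split i j p p′ t₁ t₂ t₃ ⟨
              edgeCross i j p p′ t₂ t₃ ≡⟨ c₂₃ ⟩
              0ℤ ∎))))
          where open ≡-Reasoning
        decide (no c₁₂) (yes c₁₃) = mapOneOf
            (λ { m (pm , p′m , b , a , c) → pm , p′m , inj₂ (inj₁ (a , b , c)) })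
          (fork fr p∈τ p′∈τ t₂∈τ t₁∈τ t₃∈τ pl p′l t₂l t₁l t₃l p≢p′ t₁≢t₃
            (neg≢0 (edgeCross-flip i j p p′ t₂ t₁) c₁₂)
            (λ c₂₃ → c₁₂ (ℤP.neg-injective (begin
              ℤ.- edgeCross i j p p′ t₁ t₂ ≡⟨ ℤP.+-identityˡ _ ⟨
              0ℤ ℤ.- edgeCross i j p p′ t₁ t₂ ≡⟨ cong (ℤ._- edgeCross i j p p′ t₁ t₂) c₁₃ ⟨
              edgeCross i j p p′ t₁ t₃ ℤ.- edgeCross i j p p′ t₁ t₂ ≡⟨ edgeCross-split i j p p′ t₁ t₂ t₃ ⟨
              edgeCross i j p p′ t₂ t₃ ≡⟨ c₂₃ ⟩
              0ℤ ∎))))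
          where open ≡-Reasoning

-- Recognition of the cross-polytope

pairPoint : Fin 4 → Fin 4 → Point 4
pairPoint a b = tabulate (λ m → if does (m FinP.≟ a) ∨ does (m FinP.≟ b) then 1 else 0)

IsPair : Fin 4 → Fin 4 → Point 4 → Set
IsPair a b y = y ⟨ a ⟩ ≡ 1 × y ⟨ b ⟩ ≡ 1 × (∀ m → m ≢ a → m ≢ b → y ⟨ m ⟩ ≡ 0)

isPair-swap : ∀ {a b} y → IsPair a b y → IsPair b a y
isPair-swap y (ya , yb , rest) = yb , ya , λ m m≢b m≢a → rest m m≢a m≢b

isPair⇒≡ : ∀ {a b} y → IsPair a b y → y ≡ pairPoint a b
isPair⇒≡ {a} {b} y (ya , yb , rest) = trans (sym (tabulate∘lookup y)) (tabulate-cong value)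
  where
  value : ∀ m → y ⟨ m ⟩ ≡ (if does (m FinP.≟ a) ∨ does (m FinP.≟ b) then 1 else 0)
  value m with m FinP.≟ a | m FinP.≟ b
  ... | yes refl | _        = ya
  ... | no _     | yes refl = yb
  ... | no m≢a   | no m≢b   = rest m m≢a m≢b

frame⇒isPair : ∀ {a b c d} y → Frame a b c d → y ⟨ a ⟩ ≡ 1 → y ⟨ b ⟩ ≡ 1 → y ⟨ c ⟩ ≡ 0 → y ⟨ d ⟩ ≡ 0 →
    IsPair a b y
frame⇒isPair {a} {b} {c} {d} y fr ya yb yc yd = ya , yb , cover-elim fr (λ m → m ≢ a → m ≢ b → y ⟨ m ⟩ ≡ 0)
  (λ a≢a → contradiction refl a≢a) (λ _ b≢b → contradiction refl b≢b) (λ _ _ → yc) (λ _ _ → yd)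

opaque
  pairPoint∈cross : ∀ a b → a ≡ b ⊎ pairPoint a b ∈ crossPolytope
  pairPoint∈cross = from-yes (FinP.all? {n = 4} λ a → FinP.all? {n = 4} λ b →
    (a FinP.≟ b) ⊎-dec member? _≟P_ (pairPoint a b) crossPolytope)

∈cross⇒pairPoint : ∀ {y} → y ∈ crossPolytope → ∃[ a ] ∃[ b ] (a ≢ b × y ≡ pairPoint a b)
∈cross⇒pairPoint (here refl) = zero , suc zero , (λ ()) , refl
∈cross⇒pairPoint (there (here refl)) = zero , suc (suc zero) , (λ ()) , refl
∈cross⇒pairPoint (there (there (here refl))) = zero , suc (suc (suc zero)) , (λ ()) , refl
∈cross⇒pairPoint (there (there (there (here refl)))) = suc zero , suc (suc zero) , (λ ()) , refl
∈cross⇒pairPoint (there (there (there (there (here refl))))) = suc zero , suc (suc (suc zero)) , (λ ()) , refl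
∈cross⇒pairPoint (there (there (there (there (there (here refl)))))) = suc (suc zero) , suc (suc (suc zero)) ,
    (λ ()) , refl

module Cross {τ : Polytope 4} (F : IsBFacet τ) where
  open Facet F

  opaque
    -- A point with two nonzero coordinates lies above a pair point; a point with at most one lies
    -- below a pair point, its value being at most 1. The antichain property turns both into
    -- equalities.
    isCross : (∀ a b → a ≢ b → ∃[ y ] (y ∈ τ × IsPair a b y)) →
              (∀ x → x ∈ τ → ∀ m → x ⟨ m ⟩ ≢ 0 → x ⟨ m ⟩ ≡ 1) → IsCrossPolytope τ
    isCross pair unit = mk⇔ to from
      where
      from : ∀ {y} → y ∈ crossPolytope → y ∈ τ
      from y∈cross with ∈cross⇒pairPoint y∈cross
      ... | a , b , a≢b , refl with pair a b a≢b
      ... | y , y∈τ , isPair = subst (_∈ τ) (isPair⇒≡ y isPair) y∈τ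
      into : ∀ {a b} y → a ≢ b → IsPair a b y → y ∈ crossPolytope
      into {a} {b} y a≢b isPair with pairPoint∈cross a b
      ... | inj₁ a≡b = contradiction a≡b a≢b
      ... | inj₂ ∈cross = subst (_∈ crossPolytope) (sym (isPair⇒≡ y isPair)) ∈cross
      two : ∀ {a b x} → a ≢ b → x ∈ τ → x ⟨ a ⟩ ≢ 0 → x ⟨ b ⟩ ≢ 0 → x ∈ crossPolytope
      two {a} {b} {x} a≢b x∈τ xa xb with pair a b a≢b
      ... | y , y∈τ , isPair@(ya , yb , rest) =
          subst (_∈ crossPolytope) (antichain y∈τ x∈τ below) (into y a≢b isPair)
        where
        below : ∀ m → y ⟨ m ⟩ ℕ.≤ x ⟨ m ⟩
        below m with m FinP.≟ a | m FinP.≟ b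
        ... | yes refl | _        = 1≡⇒≤ ya xa
        ... | no _     | yes refl = 1≡⇒≤ yb xb
        ... | no m≢a   | no m≢b   = 0≡⇒≤ (rest m m≢a m≢b)
      one : ∀ {x} a → x ∈ τ → (∀ m → m ≢ a → x ⟨ m ⟩ ≡ 0) → x ∈ crossPolytope
      one {x} a x∈τ rest with fresh a a a
      ... | b , b≢a , _ with pair a b (b≢a ∘ sym)
      ... | y , y∈τ , isPair@(ya , _) =
          subst (_∈ crossPolytope) (sym (antichain x∈τ y∈τ below)) (into y (b≢a ∘ sym) isPair)
        where
        below : ∀ m → x ⟨ m ⟩ ℕ.≤ y ⟨ m ⟩
        below m with m FinP.≟ a
        ... | no m≢a = 0≡⇒≤ (rest m m≢a)
        ... | yes refl with x ⟨ m ⟩ ℕP.≟ 0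
        ... | yes xm≡0 = 0≡⇒≤ xm≡0
        ... | no xm≢0 = ℕP.≤-reflexive (trans (unit x x∈τ m xm≢0) (sym ya))
      to : ∀ {x} → x ∈ τ → x ∈ crossPolytope
      to {x} x∈τ with FinP.any? (λ a → ¬? (x ⟨ a ⟩ ℕP.≟ 0))
      ... | no none = one zero x∈τ (λ m _ → decidable-stable (_ ℕP.≟ 0) (λ xm → none (m , xm)))
      ... | yes (a , xa) with FinP.any? (λ b → ¬? (a FinP.≟ b) ×-dec ¬? (x ⟨ b ⟩ ℕP.≟ 0))
      ... | yes (b , a≢b , xb) = two a≢b x∈τ xa xb
      ... | no none = one a x∈τ (λ m m≢a → decidable-stable (_ ℕP.≟ 0) (λ xm → none (m , m≢a ∘ sym , xm)))

-- Prisms and octahedra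

module Prisms {τ : Polytope 4} (F : IsBFacet τ) (no-edges : Sparse.NoEdges F) where
  open Facet F
  open Classification F
  open Sparse F

  -- In the (k , l)-plane, `p p′` lies over (0 , 1), `t₂ t₃` over (1 , 0) and `t₁` over the origin.
  -- Exchanging k and l exchanges the two edges, so facts about l transfer to k.
  record Prism (i j k l : Fin 4) (p p′ t₁ t₂ t₃ : Point 4) : Set where
    field
      fr   : Frame i j k l
      p∈τ  : p ∈ τ
      p′∈τ : p′ ∈ τ
      t₁∈τ : t₁ ∈ τ
      t₂∈τ : t₂ ∈ τ
      t₃∈τ : t₃ ∈ τ
      p≢p′ : p ≢ p′
      t₂≢t₃ : t₂ ≢ t₃
      pk   : p ⟨ k ⟩ ≡ 0
      p′k  : p′ ⟨ k ⟩ ≡ 0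
      pl   : p ⟨ l ⟩ ≡ 1
      p′l  : p′ ⟨ l ⟩ ≡ 1
      t₁k  : t₁ ⟨ k ⟩ ≡ 0
      t₂k  : t₂ ⟨ k ⟩ ≡ 1
      t₃k  : t₃ ⟨ k ⟩ ≡ 1
      t₁l  : t₁ ⟨ l ⟩ ≡ 0
      t₂l  : t₂ ⟨ l ⟩ ≡ 0
      t₃l  : t₃ ⟨ l ⟩ ≡ 0

    opaque
      triangle : Triangle no-edges k i l t₁ t₂ t₃
      triangle = record { t₁∈τ = t₁∈τ ; t₂∈τ = t₂∈τ ; t₃∈τ = t₃∈τ ; t₁l = t₁l ; t₂l = t₂l ; t₃l = t₃l
          ; area≢0 = area≢0 }
        where
        reduce : ∀ a b c → (+ 1 ℤ.- 0ℤ) ℤ.* (c ℤ.- a) ℤ.- (b ℤ.- a) ℤ.* (+ 1 ℤ.- 0ℤ) ≡ c ℤ.- b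
        reduce = solve 3 (λ a b c → (con (+ 1) :- con 0ℤ) :* (c :- a) :- (b :- a) :* (con (+ 1) :- con 0ℤ) :=
            c :- b) refl
          where open ℤSolver.+-*-Solver
        area≡ : area k i t₁ t₂ t₃ ≡ + (t₃ ⟨ i ⟩) ℤ.- + (t₂ ⟨ i ⟩)
        area≡ rewrite t₁k | t₂k | t₃k = reduce (+ (t₁ ⟨ i ⟩)) (+ (t₂ ⟨ i ⟩)) (+ (t₃ ⟨ i ⟩))
        area≢0 : area k i t₁ t₂ t₃ ≢ 0ℤ
        area≢0 = subst (_≢ 0ℤ) (sym area≡) (+-≢ λ t₃i≡t₂i → t₂≢t₃ (agree (swap-ij fr) t₂∈τ t₃∈τ
                   (sym t₃i≡t₂i) (trans t₂k (sym t₃k)) (trans t₂l (sym t₃l))))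

    fr-kijl : Frame k i j l
    fr-kijl = swap-ij (swap-jk fr)

    unit-l : ∀ {x} → x ∈ τ → x ⟨ l ⟩ ≢ 0 → x ⟨ l ⟩ ≡ 1
    unit-l = apex-unit no-edges fr-kijl triangle

  prism-transpose : ∀ {i j k l p p′ t₁ t₂ t₃} → Prism i j k l p p′ t₁ t₂ t₃ → Prism i j l k t₂ t₃ t₁ p p′
  prism-transpose P = record
    { fr = swap-kl fr ; p∈τ = t₂∈τ ; p′∈τ = t₃∈τ ; t₁∈τ = t₁∈τ ; t₂∈τ = p∈τ ; t₃∈τ = p′∈τ ; p≢p′ = t₂≢t₃
        ; t₂≢t₃ = p≢p′
    ; pk = t₂l ; p′k = t₃l ; pl = t₂k ; p′l = t₃k ; t₁k = t₁l ; t₂k = pl ; t₃k = p′l ; t₁l = t₁k ; t₂l = pk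
        ; t₃l = p′k }
    where open Prism P

  prism-swap-t : ∀ {i j k l p p′ t₁ t₂ t₃} → Prism i j k l p p′ t₁ t₂ t₃ → Prism i j k l p p′ t₁ t₃ t₂
  prism-swap-t P = record
    { fr = fr ; p∈τ = p∈τ ; p′∈τ = p′∈τ ; t₁∈τ = t₁∈τ ; t₂∈τ = t₃∈τ ; t₃∈τ = t₂∈τ ; p≢p′ = p≢p′
        ; t₂≢t₃ = t₂≢t₃ ∘ sym
    ; pk = pk ; p′k = p′k ; pl = pl ; p′l = p′l ; t₁k = t₁k ; t₂k = t₃k ; t₃k = t₂k ; t₁l = t₁l ; t₂l = t₃l
        ; t₃l = t₂l }
    where open Prism P

  prism-swap-ij : ∀ {i j k l p p′ t₁ t₂ t₃} → Prism i j k l p p′ t₁ t₂ t₃ → Prism j i k l p p′ t₁ t₂ t₃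
  prism-swap-ij P = record
    { fr = swap-ij fr ; p∈τ = p∈τ ; p′∈τ = p′∈τ ; t₁∈τ = t₁∈τ ; t₂∈τ = t₂∈τ ; t₃∈τ = t₃∈τ ; p≢p′ = p≢p′
        ; t₂≢t₃ = t₂≢t₃
    ; pk = pk ; p′k = p′k ; pl = pl ; p′l = p′l ; t₁k = t₁k ; t₂k = t₂k ; t₃k = t₃k ; t₁l = t₁l ; t₂l = t₂l
        ; t₃l = t₃l }
    where open Prism P

  record Octahedron (i j k l : Fin 4) (p p′ t₁ t₂ t₃ r : Point 4) : Set where
    field
      prism : Prism i j k l p p′ t₁ t₂ t₃
      r∈τ : r ∈ τ
      rk : r ⟨ k ⟩ ≡ 1
      rl : r ⟨ l ⟩ ≡ 1
      ri : r ⟨ i ⟩ ≡ 0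
      rj : r ⟨ j ⟩ ≡ 0
      pi : p ⟨ i ⟩ ≡ 0
      p′j : p′ ⟨ j ⟩ ≡ 0
    open Prism prism public

  opaque
    -- The triangles `t₃ r p′` in x_j = 0 and `t₂ r p` in x_i = 0 extend `apex-unit` to j and i. The
    -- last coordinates of `p` and `p′` are then 1, since with 0 these points would lie below `r`.
    regular : ∀ {i j k l p p′ t₁ t₂ t₃ r} → Octahedron i j k l p p′ t₁ t₂ t₃ r →
      t₁ ⟨ i ⟩ ≡ 1 → t₁ ⟨ j ⟩ ≡ 1 → t₂ ⟨ i ⟩ ≡ 0 → t₂ ⟨ j ⟩ ≡ 1 → t₃ ⟨ i ⟩ ≡ 1 → t₃ ⟨ j ⟩ ≡ 0 →
          IsCrossPolytope τ
    regular {i} {j} {k} {l} {p} {p′} {t₁} {t₂} {t₃} {r} O t₁i t₁j t₂i t₂j t₃i t₃j = Cross.isCross F pair unit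
      where
      open Octahedron O
      fr-klij : Frame k l i j
      fr-klij = swap-jk (swap-kl (swap-ij (swap-jk fr)))
      unit-j : ∀ {x} → x ∈ τ → x ⟨ j ⟩ ≢ 0 → x ⟨ j ⟩ ≡ 1
      unit-j = apex-unit no-edges fr-klij
          (record { t₁∈τ = t₃∈τ ; t₂∈τ = r∈τ ; t₃∈τ = p′∈τ ; t₁l = t₃j ; t₂l = rj ; t₃l = p′j
          ; area≢0 = area≢0 })
        where
        area≢0 : area k l t₃ r p′ ≢ 0ℤ
        area≢0 rewrite t₃k | rk | p′k | t₃l | rl = λ ()
      unit-i : ∀ {x} → x ∈ τ → x ⟨ i ⟩ ≢ 0 → x ⟨ i ⟩ ≡ 1
      unit-i = apex-unit no-edges (swap-kl fr-klij)
          (record { t₁∈τ = t₂∈τ ; t₂∈τ = r∈τ ; t₃∈τ = p∈τ ; t₁l = t₂i ; t₂l = ri ; t₃l = pi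
          ; area≢0 = area≢0 })
        where
        area≢0 : area k l t₂ r p ≢ 0ℤ
        area≢0 rewrite t₂k | rk | pk | t₂l | rl = λ ()
      unit : ∀ x → x ∈ τ → ∀ m → x ⟨ m ⟩ ≢ 0 → x ⟨ m ⟩ ≡ 1
      unit x x∈τ = cover-elim fr (λ m → x ⟨ m ⟩ ≢ 0 → x ⟨ m ⟩ ≡ 1) (unit-i x∈τ) (unit-j x∈τ)
                     (Prism.unit-l (prism-transpose prism) x∈τ) (unit-l x∈τ)
      pj : p ⟨ j ⟩ ≡ 1
      pj = unit-j p∈τ λ pj → 0≢1 (trans
          (cong (_⟨ k ⟩) (sym (dominated fr p∈τ r∈τ (0≡⇒≤ pi) (0≡⇒≤ pj) (0≡⇒≤ pk)
          (ℕP.≤-reflexive (trans pl (sym rl)))))) pk) rk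
      p′i : p′ ⟨ i ⟩ ≡ 1
      p′i = unit-i p′∈τ λ p′i → 0≢1 (trans
          (cong (_⟨ k ⟩) (sym (dominated fr p′∈τ r∈τ (0≡⇒≤ p′i) (0≡⇒≤ p′j) (0≡⇒≤ p′k)
          (ℕP.≤-reflexive (trans p′l (sym rl)))))) p′k) rk
      Pair : Fin 4 → Fin 4 → Set
      Pair a b = ∃[ y ] (y ∈ τ × IsPair a b y)
      flip : ∀ {a b} → Pair a b → Pair b a
      flip (y , y∈τ , isPair) = y , y∈τ , isPair-swap y isPair
      ij : Pair i j
      ij = t₁ , t₁∈τ , frame⇒isPair t₁ fr t₁i t₁j t₁k t₁l
      ik : Pair i k
      ik = t₃ , t₃∈τ , frame⇒isPair t₃ (swap-jk fr) t₃i t₃k t₃j t₃l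
      jk : Pair j k
      jk = t₂ , t₂∈τ , frame⇒isPair t₂ (swap-jk (swap-ij fr)) t₂j t₂k t₂i t₂l
      jl : Pair j l
      jl = p , p∈τ , frame⇒isPair p (swap-jk (swap-kl (swap-ij fr))) pj pl pi pk
      il : Pair i l
      il = p′ , p′∈τ , frame⇒isPair p′ (swap-jk (swap-kl fr)) p′i p′l p′j p′k
      kl : Pair k l
      kl = r , r∈τ , frame⇒isPair r fr-klij rk rl ri rj
      pair : ∀ a b → a ≢ b → Pair a b
      pair a b = cover-elim fr (λ a → a ≢ b → Pair a b)
        (cover-elim fr (λ b → i ≢ b → Pair i b) (contradiction refl) (λ _ → ij) (λ _ → ik) (λ _ → il) b)
        (cover-elim fr (λ b → j ≢ b → Pair j b) (λ _ → flip ij) (contradiction refl) (λ _ → jk) (λ _ → jl) b)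
        (cover-elim fr (λ b → k ≢ b → Pair k b) (λ _ → flip ik) (λ _ → flip jk) (contradiction refl)
            (λ _ → kl) b)
        (cover-elim fr (λ b → l ≢ b → Pair l b) (λ _ → flip il) (λ _ → flip jl) (λ _ → flip kl)
            (contradiction refl) b)
        a

  opaque
    -- `t₂` and `t₃` agree in k and l, so they must be incomparable in i and j: one vanishes in i,
    -- the other in j. Zeros of `t₁` in both would make it the origin.
    octahedron-cross : ∀ {i j k l p p′ t₁ t₂ t₃ r} → Octahedron i j k l p p′ t₁ t₂ t₃ r →
      OneZero no-edges (t₁ ⟨ i ⟩) (t₂ ⟨ i ⟩) (t₃ ⟨ i ⟩) → OneZero no-edges (t₁ ⟨ j ⟩) (t₂ ⟨ j ⟩) (t₃ ⟨ j ⟩) →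
          IsCrossPolytope τ
    octahedron-cross {i} {j} {k} {l} {p} {p′} {t₁} {t₂} {t₃} {r} O = go
      where
      open Octahedron O
      apart : ∀ {x y : Point 4} {m} → x ⟨ m ⟩ ≡ 0 → y ⟨ m ⟩ ≡ 1 → x ≢ y
      apart {m = m} xm ym x≡y = 0≢1 (trans (cong (_⟨ m ⟩) (sym x≡y)) xm) ym
      ≤-eq : ∀ {a b c} → a ≡ c → b ≡ c → a ℕ.≤ b
      ≤-eq a≡c b≡c = ℕP.≤-reflexive (trans a≡c (sym b≡c))
      t₂≤t₃ : t₂ ⟨ i ⟩ ℕ.≤ t₃ ⟨ i ⟩ → t₂ ⟨ j ⟩ ℕ.≤ t₃ ⟨ j ⟩ → ⊥
      t₂≤t₃ li lj = t₂≢t₃ (dominated fr t₂∈τ t₃∈τ li lj (≤-eq t₂k t₃k) (≤-eq t₂l t₃l))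
      t₃≤t₂ : t₃ ⟨ i ⟩ ℕ.≤ t₂ ⟨ i ⟩ → t₃ ⟨ j ⟩ ℕ.≤ t₂ ⟨ j ⟩ → ⊥
      t₃≤t₂ li lj = t₂≢t₃ (sym (dominated fr t₃∈τ t₂∈τ li lj (≤-eq t₃k t₂k) (≤-eq t₃l t₂l)))
      go : OneZero no-edges (t₁ ⟨ i ⟩) (t₂ ⟨ i ⟩) (t₃ ⟨ i ⟩) →
          OneZero no-edges (t₁ ⟨ j ⟩) (t₂ ⟨ j ⟩) (t₃ ⟨ j ⟩) → IsCrossPolytope τ
      go (inj₁ (t₁i , _)) (inj₁ (t₁j , _)) =
        contradiction (dominated fr t₁∈τ t₂∈τ (0≡⇒≤ t₁i) (0≡⇒≤ t₁j) (0≡⇒≤ t₁k) (0≡⇒≤ t₁l))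
            (apart {m = k} t₁k t₂k)
      go (inj₁ (_ , t₂i , t₃i)) (inj₂ (inj₁ (_ , t₂j , _))) = ⊥-elim (t₂≤t₃ (≤-eq t₂i t₃i) (0≡⇒≤ t₂j))
      go (inj₁ (_ , t₂i , t₃i)) (inj₂ (inj₂ (_ , _ , t₃j))) = ⊥-elim (t₃≤t₂ (≤-eq t₃i t₂i) (0≡⇒≤ t₃j))
      go (inj₂ (inj₁ (_ , t₂i , _))) (inj₁ (_ , t₂j , t₃j)) = ⊥-elim (t₂≤t₃ (0≡⇒≤ t₂i) (≤-eq t₂j t₃j))
      go (inj₂ (inj₂ (_ , _ , t₃i))) (inj₁ (_ , t₂j , t₃j)) = ⊥-elim (t₃≤t₂ (0≡⇒≤ t₃i) (≤-eq t₃j t₂j))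
      go (inj₂ (inj₁ (_ , t₂i , _))) (inj₂ (inj₁ (_ , t₂j , _))) = ⊥-elim (t₂≤t₃ (0≡⇒≤ t₂i) (0≡⇒≤ t₂j))
      go (inj₂ (inj₂ (_ , _ , t₃i))) (inj₂ (inj₂ (_ , _ , t₃j))) = ⊥-elim (t₃≤t₂ (0≡⇒≤ t₃i) (0≡⇒≤ t₃j))
      go (inj₂ (inj₁ (t₁i , t₂i , t₃i))) (inj₂ (inj₂ (t₁j , t₂j , t₃j))) = regular O t₁i t₁j t₂i t₂j t₃i t₃j
      go (inj₂ (inj₂ (t₁i , t₂i , t₃i))) (inj₂ (inj₁ (t₁j , t₂j , t₃j))) = regular O′ t₁i t₁j t₃i t₃j t₂i t₂j
        where
        O′ : Octahedron i j k l p p′ t₁ t₃ t₂ r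
        O′ = record { prism = prism-swap-t prism ; r∈τ = r∈τ ; rk = rk ; rl = rl ; ri = ri ; rj = rj ; pi = pi
            ; p′j = p′j }

  opaque
    -- For a point `r` over (1 , 1), `trident` applies to `p`, `r` and to `p′`, `r`. Each yields a
    -- coordinate in which both points vanish, hence i or j. The two differ, since `p` and `p′`
    -- already share a zero in k; so `r` vanishes in i and in j.
    prism-result : ∀ {i j k l p p′ t₁ t₂ t₃} → Prism i j k l p p′ t₁ t₂ t₃ → Result
    prism-result {i} {j} {k} {l} {p} {p′} {t₁} {t₂} {t₃} P
      with search (λ x → ¬? (x ⟨ k ⟩ ℕP.≟ 0) ×-dec ¬? (x ⟨ l ⟩ ℕP.≟ 0)) τ
    ... | inj₂ none = b₂ (k , l , Frame.k≢l fr , values)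
      where
      open Prism P
      values : ∀ x → x ∈ τ → (x ⟨ k ⟩ , x ⟨ l ⟩) ∈ (0 , 0) ∷ (1 , 0) ∷ (0 , 1) ∷ []
      values x x∈τ with x ⟨ k ⟩ ℕP.≟ 0 | x ⟨ l ⟩ ℕP.≟ 0
      ... | yes xk | yes xl = here (cong₂ _,_ xk xl)
      ... | no xk | yes xl = there (here (cong₂ _,_ (Prism.unit-l (prism-transpose P) x∈τ xk) xl))
      ... | yes xk | no xl = there (there (here (cong₂ _,_ xk (unit-l x∈τ xl))))
      ... | no xk | no xl = contradiction (xk , xl) (none x x∈τ)
    ... | inj₁ (r , r∈τ , rk≢0 , rl≢0) =
        combine (trident no-edges fr-kijl triangle p∈τ r∈τ (≡1⇒≢0 pl) rl≢0 p≢r)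
                                                  (trident no-edges fr-kijl triangle p′∈τ r∈τ (≡1⇒≢0 p′l) rl≢0
                                                      p′≢r)
      where
      open Prism P
      p≢r : p ≢ r
      p≢r p≡r = rk≢0 (trans (cong (_⟨ k ⟩) (sym p≡r)) pk)
      p′≢r : p′ ≢ r
      p′≢r p′≡r = rk≢0 (trans (cong (_⟨ k ⟩) (sym p′≡r)) p′k)
      rk : r ⟨ k ⟩ ≡ 1
      rk = Prism.unit-l (prism-transpose P) r∈τ rk≢0
      rl : r ⟨ l ⟩ ≡ 1
      rl = unit-l r∈τ rl≢0
      T : Point 4 → Fin 4 → Set
      T q = Trident no-edges q r t₁ t₂ t₃
      same : ∀ {a b m} → Frame a b k m → T p m → T p′ m → ⊥
      same fr (pm , _) (p′m , _) = p≢p′ (coplanar no-edges fr p∈τ p′∈τ pk pm p′k p′m)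
      combine : OneOf no-edges k i j (T p) → OneOf no-edges k i j (T p′) → Result
      combine (inj₁ (_ , rk≡0 , _)) _ = contradiction rk≡0 rk≢0
      combine (inj₂ _) (inj₁ (_ , rk≡0 , _)) = contradiction rk≡0 rk≢0
      combine (inj₂ (inj₁ a)) (inj₂ (inj₁ b)) = ⊥-elim (same (swap-jk (swap-kl (swap-jk (swap-ij fr)))) a b)
      combine (inj₂ (inj₂ a)) (inj₂ (inj₂ b)) = ⊥-elim (same (swap-kl (swap-jk (swap-kl fr))) a b)
      combine (inj₂ (inj₁ (pi , ri , zi))) (inj₂ (inj₂ (p′j , rj , zj))) =
          inj₂ (inj₂ (inj₂ (octahedron-cross O zi zj)))
        where
        O : Octahedron i j k l p p′ t₁ t₂ t₃ r
        O = record { prism = P ; r∈τ = r∈τ ; rk = rk ; rl = rl ; ri = ri ; rj = rj ; pi = pi ; p′j = p′j }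
      combine (inj₂ (inj₂ (pj , rj , zj))) (inj₂ (inj₁ (p′i , ri , zi))) =
          inj₂ (inj₂ (inj₂ (octahedron-cross O zj zi)))
        where
        O : Octahedron j i k l p p′ t₁ t₂ t₃ r
        O = record { prism = prism-swap-ij P ; r∈τ = r∈τ ; rk = rk ; rl = rl ; ri = rj ; rj = ri ; pi = pj
            ; p′j = p′i }

-- Existence of a pyramid over a coordinate hyperplane

module Existence {τ : Polytope 4} (F : IsBFacet τ) where
  open Facet F

  opaque
    -- Vertices are added one at a time: the determinant found so far is the nonzero leading
    -- coefficient of the affine function given to `spread`.
    nondegenerate-simplex : ∃[ x ] ∃[ y ] ∃[ z ] ∃[ w ]
        (x ∈ τ × y ∈ τ × z ∈ τ × w ∈ τ × vol zero (suc zero) (suc (suc zero)) x y z w ≢ 0ℤ)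
    nondegenerate-simplex
      -- No coordinate equals -1, so this call only produces some point of `τ`.
      with spread {suc zero} {suc zero} {zero} {suc (suc zero)} (λ ()) (λ ()) (λ ()) (λ ()) (λ ()) 0ℤ 0ℤ {+ 1}
          (λ ()) (ℤ.- + 1)
    ... | x , x∈τ , _
      with spread {suc zero} {suc zero} {zero} {suc (suc zero)} (λ ()) (λ ()) (λ ()) (λ ()) (λ ()) 0ℤ 0ℤ {+ 1}
          (λ ()) (+ (x ⟨ zero ⟩))
    ... | y , y∈τ , y≢
      with spread {zero} {zero} {suc zero} {suc (suc zero)} (λ ()) (λ ()) (λ ()) (λ ()) (λ ())
             (ℤ.- Δ x y (suc zero)) 0ℤ {Δ x y zero} Δ≢0
                 (Δ x y zero ℤ.* + (x ⟨ suc zero ⟩) ℤ.- Δ x y (suc zero) ℤ.* + (x ⟨ zero ⟩))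
      where
      Δ≢0 : Δ x y zero ≢ 0ℤ
      Δ≢0 eq = y≢ (trans (drop (+ (y ⟨ suc zero ⟩)) (+ (y ⟨ zero ⟩)))
          (ℤP.i-j≡0⇒i≡j (+ (y ⟨ zero ⟩)) (+ (x ⟨ zero ⟩)) eq))
        where
        drop : ∀ a b → 0ℤ ℤ.* a ℤ.+ 0ℤ ℤ.* a ℤ.+ + 1 ℤ.* b ≡ b
        drop = solve 2 (λ a b → con 0ℤ :* a :+ con 0ℤ :* a :+ con (+ 1) :* b := b) refl
          where open ℤSolver.+-*-Solver
    ... | z , z∈τ , z≢
      with spread {zero} {suc zero} {suc (suc zero)} {suc (suc (suc zero))} (λ ()) (λ ()) (λ ()) (λ ()) (λ ())
             (area (suc zero) (suc (suc zero)) x y z) (ℤ.- area zero (suc (suc zero)) x y z)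
                 {area zero (suc zero) x y z} area≢0
             (area (suc zero) (suc (suc zero)) x y z ℤ.* + (x ⟨ zero ⟩) ℤ.- area zero (suc (suc zero)) x y
                 z ℤ.* + (x ⟨ suc zero ⟩)
               ℤ.+ area zero (suc zero) x y z ℤ.* + (x ⟨ suc (suc zero) ⟩))
      where
      area≢0 : area zero (suc zero) x y z ≢ 0ℤ
      area≢0 eq = z≢ (trans (area-as-functional zero (suc zero) x y z)
          (trans (cong (ℤ._+ _) eq) (ℤP.+-identityˡ _)))
    ... | w , w∈τ , w≢ = x , y , z , w , x∈τ , y∈τ , z∈τ , w∈τ ,
      λ eq → w≢ (trans (vol-as-functional zero (suc zero) (suc (suc zero)) x y z w)
          (trans (cong (ℤ._+ _) eq) (ℤP.+-identityˡ _)))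

  module _ (no-edges : Sparse.NoEdges F) where
    open Sparse F

    Pyramid : Set
    Pyramid = ∃[ i ] ∃[ j ] ∃[ k ] ∃[ l ] ∃[ t₁ ] ∃[ t₂ ] ∃[ t₃ ] ∃[ p ]
      (Frame i j k l × Triangle no-edges i j l t₁ t₂ t₃ × p ∈ τ × p ⟨ l ⟩ ≡ 1)

    opaque
      -- Expanding the volume along the row of `p` shows that some area of the base is nonzero.
      -- Areas that involve m vanish, as the base lies in x_m = 0; so the surviving pair of
      -- coordinates avoids m.
      base-pyramid : ∀ {i j k m t₁ t₂ t₃ p} → i ≢ j → i ≢ k → j ≢ k → vol i j k t₁ t₂ t₃ p ≢ 0ℤ →
        t₁ ∈ τ → t₂ ∈ τ → t₃ ∈ τ → p ∈ τ → t₁ ⟨ m ⟩ ≡ 0 → t₂ ⟨ m ⟩ ≡ 0 → t₃ ⟨ m ⟩ ≡ 0 → p ⟨ m ⟩ ≡ 1 → Pyramid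
      base-pyramid {i} {j} {k} {m} {t₁} {t₂} {t₃} {p} i≢j i≢k j≢k vol≢0 t₁∈τ t₂∈τ t₃∈τ p∈τ t₁m t₂m t₃m pm
        = decide (area j k t₁ t₂ t₃ ℤP.≟ 0ℤ) (area i k t₁ t₂ t₃ ℤP.≟ 0ℤ) (area i j t₁ t₂ t₃ ℤP.≟ 0ℤ)
        where
        area-flatˡ : ∀ b → area m b t₁ t₂ t₃ ≡ 0ℤ
        area-flatˡ b rewrite t₁m | t₂m | t₃m = cong (λ a → 0ℤ ℤ.- a) (ℤP.*-zeroʳ (Δ t₁ t₂ b))
        area-flatʳ : ∀ a → area a m t₁ t₂ t₃ ≡ 0ℤ
        area-flatʳ a rewrite t₁m | t₂m | t₃m = cong (ℤ._- 0ℤ) (ℤP.*-zeroʳ (Δ t₁ t₂ a))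
        from-area : ∀ {a b} → a ≢ b → area a b t₁ t₂ t₃ ≢ 0ℤ → Pyramid
        from-area {a} {b} a≢b area≢0 with frame-of-three {a} {b} {m} a≢b (λ { refl → area≢0 (area-flatˡ b) })
            (λ { refl → area≢0 (area-flatʳ a) })
        ... | c , fr = a , b , c , m , t₁ , t₂ , t₃ , p , fr , T , p∈τ , pm
          where
          T : Triangle no-edges a b m t₁ t₂ t₃
          T = record { t₁∈τ = t₁∈τ ; t₂∈τ = t₂∈τ ; t₃∈τ = t₃∈τ ; t₁l = t₁m ; t₂l = t₂m ; t₃l = t₃m
              ; area≢0 = area≢0 }
        decide : Dec (area j k t₁ t₂ t₃ ≡ 0ℤ) → Dec (area i k t₁ t₂ t₃ ≡ 0ℤ) → Dec (area i j t₁ t₂ t₃ ≡ 0ℤ) →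
            Pyramid
        decide (no a) _ _ = from-area j≢k a
        decide _ (no a) _ = from-area i≢k a
        decide _ _ (no a) = from-area i≢j a
        decide (yes a) (yes b) (yes c) = contradiction (trans (vol-expand i j k t₁ t₂ t₃ p) (begin
          Δ t₁ p i ℤ.* area j k t₁ t₂ t₃ ℤ.- Δ t₁ p j ℤ.* area i k t₁ t₂ t₃ ℤ.+ Δ t₁ p k ℤ.* area i j t₁ t₂ t₃
            ≡⟨ cong₂ ℤ._+_ (cong₂ ℤ._-_ (vanish (Δ t₁ p i) a) (vanish (Δ t₁ p j) b)) (vanish (Δ t₁ p k) c) ⟩
          0ℤ ∎)) vol≢0
          where
          open ≡-Reasoning
          vanish : ∀ n {q} → q ≡ 0ℤ → n ℤ.* q ≡ 0ℤ
          vanish n refl = ℤP.*-zeroʳ n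

    opaque
      pyramid : Pyramid
      pyramid with nondegenerate-simplex
      ... | x , y , z , w , x∈τ , y∈τ , z∈τ , w∈τ , vol≢0 =
        orient (unit-column zero (suc zero) (suc (suc zero)) x∈τ y∈τ z∈τ w∈τ vol≢0)
        where
        -- Rotations only change the sign of the volume; they serve to bring the vertex with the 1
        -- into the last place.
        cycle≢0 : ∀ {x y z w} → vol zero (suc zero) (suc (suc zero)) x y z w ≢ 0ℤ →
            vol zero (suc zero) (suc (suc zero)) y z w x ≢ 0ℤ
        cycle≢0 {x} {y} {z} {w} vol≢0 eq =
            vol≢0 (trans (vol-cycle zero (suc zero) (suc (suc zero)) x y z w) (cong ℤ.-_ eq))
        build : ∀ {m t₁ t₂ t₃ p} → vol zero (suc zero) (suc (suc zero)) t₁ t₂ t₃ p ≢ 0ℤ → t₁ ∈ τ → t₂ ∈ τ →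
            t₃ ∈ τ → p ∈ τ →
          t₁ ⟨ m ⟩ ≡ 0 → t₂ ⟨ m ⟩ ≡ 0 → t₃ ⟨ m ⟩ ≡ 0 → p ⟨ m ⟩ ≡ 1 → Pyramid
        build = base-pyramid (λ ()) (λ ()) (λ ())
        v₁ : vol zero (suc zero) (suc (suc zero)) y z w x ≢ 0ℤ
        v₁ = cycle≢0 {x} {y} {z} {w} vol≢0
        v₂ : vol zero (suc zero) (suc (suc zero)) z w x y ≢ 0ℤ
        v₂ = cycle≢0 {y} {z} {w} {x} v₁
        v₃ : vol zero (suc zero) (suc (suc zero)) w x y z ≢ 0ℤ
        v₃ = cycle≢0 {z} {w} {x} {y} v₂
        orient : ∃[ m ] UnitColumn (x ⟨ m ⟩) (y ⟨ m ⟩) (z ⟨ m ⟩) (w ⟨ m ⟩) → Pyramid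
        orient (m , unit₁ xm ym zm wm) = build v₁ y∈τ z∈τ w∈τ x∈τ ym zm wm xm
        orient (m , unit₂ xm ym zm wm) = build v₂ z∈τ w∈τ x∈τ y∈τ zm wm xm ym
        orient (m , unit₃ xm ym zm wm) = build v₃ w∈τ x∈τ y∈τ z∈τ wm xm ym zm
        orient (m , unit₄ xm ym zm wm) = build vol≢0 x∈τ y∈τ z∈τ w∈τ xm ym zm wm

-- Union of the two cases

module Main {τ : Polytope 4} (F : IsBFacet τ) where
  open Facet F
  open Classification F
  open Edges F using (edge-result)
  open Sparse F

  -- The vertex that `trident` singles out by its 0 becomes the `t₁` of a prism.
  fork-result : (no-edges : NoEdges) → ∀ {i j m l p p′ t₁ t₂ t₃} → Frame i j m l →
      Triangle no-edges i j l t₁ t₂ t₃ →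
    p ∈ τ → p′ ∈ τ → p ⟨ l ⟩ ≡ 1 → p′ ⟨ l ⟩ ≡ 1 → p ≢ p′ → Result
  fork-result no-edges {i} {j} {k} {l} {p} {p′} {t₁} {t₂} {t₃} fr T p∈τ p′∈τ pl p′l p≢p′ =
    [ from (swap-jk (swap-ij fr)) , [ from (swap-jk fr) , from fr ] ]
      (trident no-edges fr T p∈τ p′∈τ (≡1⇒≢0 pl) (≡1⇒≢0 p′l) p≢p′)
    where
    open Triangle T
    open Prisms F no-edges using (prism-result)
    from : ∀ {a b m} → Frame a b m l → Trident no-edges p p′ t₁ t₂ t₃ m → Result
    from fr (pm , p′m , inj₁ (t₁m , t₂m , t₃m)) = prism-result (record
      { fr = fr ; p∈τ = p∈τ ; p′∈τ = p′∈τ ; t₁∈τ = t₁∈τ ; t₂∈τ = t₂∈τ ; t₃∈τ = t₃∈τ ; p≢p′ = p≢p′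
          ; t₂≢t₃ = t₂≢t₃
      ; pk = pm ; p′k = p′m ; pl = pl ; p′l = p′l ; t₁k = t₁m ; t₂k = t₂m ; t₃k = t₃m ; t₁l = t₁l ; t₂l = t₂l
          ; t₃l = t₃l })
    from fr (pm , p′m , inj₂ (inj₁ (t₁m , t₂m , t₃m))) = prism-result (record
      { fr = fr ; p∈τ = p∈τ ; p′∈τ = p′∈τ ; t₁∈τ = t₂∈τ ; t₂∈τ = t₁∈τ ; t₃∈τ = t₃∈τ ; p≢p′ = p≢p′
          ; t₂≢t₃ = t₁≢t₃
      ; pk = pm ; p′k = p′m ; pl = pl ; p′l = p′l ; t₁k = t₂m ; t₂k = t₁m ; t₃k = t₃m ; t₁l = t₂l ; t₂l = t₁l
          ; t₃l = t₃l })
    from fr (pm , p′m , inj₂ (inj₂ (t₁m , t₂m , t₃m))) = prism-result (record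
      { fr = fr ; p∈τ = p∈τ ; p′∈τ = p′∈τ ; t₁∈τ = t₃∈τ ; t₂∈τ = t₁∈τ ; t₃∈τ = t₂∈τ ; p≢p′ = p≢p′
          ; t₂≢t₃ = t₁≢t₂
      ; pk = pm ; p′k = p′m ; pl = pl ; p′l = p′l ; t₁k = t₃m ; t₂k = t₁m ; t₃k = t₂m ; t₁l = t₃l ; t₂l = t₁l
          ; t₃l = t₂l })

  opaque
    sparse-result : NoEdges → Result
    sparse-result no-edges with Existence.pyramid F no-edges
    ... | i , j , k , l , t₁ , t₂ , t₃ , p , fr , T , p∈τ ,
        pl with search (λ x → ¬? (x ⟨ l ⟩ ℕP.≟ 0) ×-dec ¬? (x ≟P p)) τ
    ... | inj₁ (p′ , p′∈τ , p′l , p′≢p) =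
        fork-result no-edges fr T p∈τ p′∈τ pl (apex-unit no-edges fr T p′∈τ p′l) (p′≢p ∘ sym)
    ... | inj₂ none = b₁ (l , p , p∈τ , pl , λ y y∈τ yl →
        decidable-stable (y ≟P p) (λ y≢p → none y y∈τ (yl , y≢p)))

  SomeEdge : Set
  SomeEdge = ∃[ k ] ∃[ l ] (k ≢ l × Any (λ e → Any (λ e′ → e ≢ e′ ×
    e ⟨ k ⟩ ≡ 0 × e ⟨ l ⟩ ≡ 0 × e′ ⟨ k ⟩ ≡ 0 × e′ ⟨ l ⟩ ≡ 0) τ) τ)

  opaque
    some-edge? : Dec SomeEdge
    some-edge? = FinP.any? {n = 4} λ k → FinP.any? {n = 4} λ l → ¬? (k FinP.≟ l) ×-dec
      any? (λ e → any? (λ e′ → ¬? (e ≟P e′) ×-dec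
        (e ⟨ k ⟩ ℕP.≟ 0) ×-dec (e ⟨ l ⟩ ℕP.≟ 0) ×-dec (e′ ⟨ k ⟩ ℕP.≟ 0) ×-dec (e′ ⟨ l ⟩ ℕP.≟ 0)) τ) τ

  opaque
    result : Result
    result with some-edge?
    ... | no none = sparse-result λ {i} {j} {k} {l} fr E →
      let open Edge E in none (k , l , Frame.k≢l fr , lose e∈τ (lose e′∈τ (e≢e′ , ek , el , e′k , e′l)))
    ... | yes (k , l , k≢l , some) with find some
    ... | e , e∈τ , some′ with find some′
    ... | e′ , e′∈τ , e≢e′ , ek , el , e′k , e′l with frame-of-two k≢l
    ... | i , j , fr = edge-result fr
        (record { e∈τ = e∈τ ; e′∈τ = e′∈τ ; e≢e′ = e≢e′ ; ek = ek ; el = el ; e′k = e′k ; e′l = e′l })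

mainTheorem1 : (τ : Polytope 4) → IsBFacet τ →
    IsB₁ τ ⊎ IsB₂ τ ⊎ IsFlatBorder τ ⊎ IsCrossPolytope τ
mainTheorem1 τ F = Main.result F
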